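{- For all integers $n\ge0$ and $\alpha\ge0$: \begin{align*} &\overline{S_9}(12n+7)\equiv0\pmod 8,\\ &\overline{S_9}(6n+3)\equiv(-1)^\alpha\,\overline{S_9}(3^\alpha(6n+3))\pmod{16},\\ &\overline{S_9}(6n+5)\equiv\overline{S_9}(3^\alpha(6n+5))\pmod{16},\\ &\overline{S_9}(24n+23)\equiv0\pmod{32}. \end{align*}
   Context: For $|q|<1$ and a positive integer $k$, write $f_k=\prod_{j\ge1}(1-q^{kj})$. The function $\overline{S_9}(n)$ (number of $9$-Schur overpartitions of $n$) is defined by $\sum_{n\ge0}\overline{S_9}(n)q^n=\prod_{n\ge1}\frac{(1+q^{2n-1})(1-q^{9(2n-1)})}{(1+q^{9(2n-1)})(1-q^{2n-1})}=\frac{f_2^3f_9^2f_{36}}{f_1^2f_4f_{18}^3}$. -}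

module Defs where

open import Data.Nat as ℕ using (ℕ; zero; suc; _∸_; _%_; _/_)
open import Data.Nat.Properties using (_≟_)
open import Data.Integer using (ℤ; +_; -_; _+_; _*_; _^_)
open import Data.List using (List; []; _∷_; map; foldr; upTo)
open import Relation.Nullary using (yes; no)

sumℤ : List ℤ → ℤ
sumℤ = foldr _+_ (+ 0)

coeff : List ℤ → ℕ → ℤ
coeff []       _       = + 0
coeff (c ∷ _)  zero    = c
coeff (_ ∷ cs) (suc k) = coeff cs k

mulBy : ℕ → List ℤ → (ℕ → ℤ) → List ℤ
mulBy N s f =
  map (λ k → sumℤ (map (λ i → coeff s i * f (k ∸ i)) (upTo (suc k))))
      (upTo (suc N))

-- Coefficients of (1 + q^a)/(1 - q^a) = 1 + 2 Σ_{j≥1} q^{aj}, with a = suc m.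
facA : ℕ → ℕ → ℤ
facA m zero = + 1
facA m (suc k) with suc k % suc m ≟ 0
... | yes _ = + 2
... | no  _ = + 0

-- Coefficients of (1 - q^b)/(1 + q^b) = 1 + 2 Σ_{j≥1} (-1)^j q^{bj}, with b = suc m.
facB : ℕ → ℕ → ℤ
facB m zero = + 1
facB m (suc k) with suc k % suc m ≟ 0
... | yes _ = + 2 * ((- (+ 1)) ^ (suc k / suc m))
... | no  _ = + 0

-- One factor of the product, for the odd number a = 2i+1:
--   (1 + q^a)(1 - q^{9a}) / ((1 + q^{9a})(1 - q^a)).
-- Here 9a = 9(2i+1) = suc (18 i + 8).
mulFactor : ℕ → ℕ → List ℤ → List ℤ
mulFactor N i s = mulBy N (mulBy N s (facA (2 ℕ.* i))) (facB (18 ℕ.* i ℕ.+ 8))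

one : ℕ → List ℤ
one N = map (λ k → if0 k) (upTo (suc N))
  where
  if0 : ℕ → ℤ
  if0 zero    = + 1
  if0 (suc _) = + 0

-- ∏_{n≥1} (1+q^{2n-1})(1-q^{9(2n-1)}) / ((1+q^{9(2n-1)})(1-q^{2n-1}))
-- modulo q^{N+1}: factors with 2n-1 > N are ≡ 1 mod q^{N+1}, so taking
-- the factors for 2n-1 = 1, 3, …, 2N+1 gives the exact truncation.
series : ℕ → List ℤ
series N = foldr (mulFactor N) (one N) (upTo (suc N))

-- Number of 9-Schur overpartitions of n: coefficient of q^n in the product.
S9bar : ℕ → ℤ
S9bar n = coeff (series n) n

module Submission where

open import Defs
open import Data.Nat using (ℕ; _+_; _*_; _^_)
open import Data.Integer using (+_; -_; _-_) renaming (_*_ to _*ℤ_; _^_ to _^ℤ_)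
open import Data.Integer.Divisibility using (_∣_)
open import Data.Product using (_×_)

open import Algebra.Bundles using (CommutativeRing)
import Algebra.Properties.Semiring.Exp as Exp
import Algebra.Solver.Ring as RingSolver
open import Algebra.Solver.Ring.AlmostCommutativeRing
  using (fromCommutativeRing; _-Raw-AlmostCommutative⟶_)
open import Algebra.Structures using (IsCommutativeRing)
open import Data.Empty using (⊥; ⊥-elim)
open import Data.Integer using (ℤ; +-*-rawRing; ≢-nonZero) renaming (_+_ to _+ℤ_)
import Data.Integer.Divisibility.Signed as Signed
import Data.Integer.Properties as ℤ
import Data.Integer.Tactic.RingSolver as ℤ-Ring
open import Data.List using (map; foldr; upTo; applyUpTo)
open import Data.List.Properties using (map-applyUpTo)
open import Data.Maybe using (Maybe; just; nothing)
open import Data.Nat using (zero; suc; _∸_; _≤_; _<_; z≤n; s≤s; s≤s⁻¹; NonZero; >-nonZero⁻¹; ≢-nonZero⁻¹)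
open import Data.Nat.Divisibility using (_∣?_; divides; quotient; ∣⇒≤; m%n≡0⇒n∣m; n∣m⇒m%n≡0; m∣m*n)
  renaming (_∣_ to _∣ℕ_)
open import Data.Nat.DivMod using (_%_; _/_; [m+kn]%n≡m%n; m<n⇒m%n≡m; m%n<n; m≡m%n+[m/n]*n; m*n/n≡m; %-distribˡ-*)
import Data.Nat.Properties as ℕ
import Data.Nat.Tactic.RingSolver as ℕ-Ring
open import Data.Product using (_,_; ∃; proj₁; proj₂)
open import Data.Sum using (_⊎_; inj₁; inj₂)
open import Data.Vec using ([]; _∷_; allFin)
import Data.Vec as Vec
open import Data.Vec.N-ary using (N-ary; _$ⁿ_)
open import Data.Vec.Relation.Binary.Pointwise.Inductive using (Pointwise; []; _∷_) renaming (lookup to pointwise)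
open import Function using (_∘_; _∋_; id)
open import Level using (0ℓ)
open import Relation.Binary.PropositionalEquality
  using (_≡_; _≢_; refl; sym; trans; cong; cong₂; subst; module ≡-Reasoning)
import Relation.Binary.Reasoning.Setoid as SetoidReasoning
open import Relation.Nullary using (Dec; yes; no; ¬_; ¬?)
open import Relation.Nullary.Decidable using (True; toWitness; map′)

-- Write f_k = ∏ (1 - q^(kj)), φ(q) = Σ_{n∈ℤ} q^(n²), ψ(q) = f₂²/f₁ and a = f(-q,-q⁵), where φ(-q) = φ(-q⁹) - 2q a(q³).
-- By Gauss' identity φ(-q) = ∏ (1-q^n)/(1+q^n), the generating function equals φ(q) φ(-q⁹)/(φ(-q²) φ(-q¹⁸)),
-- and its odd part gives Σ S(2n+1) q^n = 2 f₆²/(φ(-q) φ(-q⁹)). Expanding 1/φ(-q) along residues mod 3, with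
-- φ(-q)⁴ ≡ 1 mod 8, yields Σ S(6n+3) q^n ≡ 4H mod 32 and Σ S(6n+5) q^n ≡ 8G mod 64, where H = f₁f₂f₃f₆ and
-- G = f₂² a². The 3-dissection of f₁f₂ = φ(-q) ψ(q) shows H(3n+1) = -H(n) and H(3n+2) = -2G(n), which are the
-- two recursions; the 2-dissection of a shows that 4 divides G(4n+3).
--
-- Apart from Gauss' identity and the norm φ(-q) φ(-ωq) φ(-ω²q) = φ(-q³)⁴/φ(-q⁹), no product formula is needed:
-- the ratio r of the two sides of an identity has constant term 1 and is seen to satisfy r(q) = r(q²) or
-- r(q)² = r(q²), so that r = 1.

-- Formal power series

-- The first congruence belongs to the remaining class: Σ S(6n+1) q^n ≡ 2 f₂² mod 8 is a series in
-- q². The series φ, ψ, a and A are given by indicators of squares, so that their dissections are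
-- statements about squares modulo small numbers; no f_k is ever defined. The square f₁² enters as
-- the combination `F` for which F(q⁴) is the even part of a φ(q³). What the standard theory reads
-- off from products is recovered by a chain: the classes modulo 3 of φ(q) φ(-q) = φ(-q²)² and ψ(q)²
-- = φ(q) ψ(q²) tie a and A to φ and ψ; multiplying a φ(q³) by its reflection gives F(q²)² as a
-- times a cubic form in φ(-q³) and a; and that form turns into the norm of ψ, which is ψ⁴/ψ(q³).
-- The moduli have three sources: the factor 2 of the odd part, the factors 1, 2, 4 of the conjugate
-- that rationalises 1/φ(-q) modulo 3, and the error 8 in φ(-q)⁴ ≡ 1. Hence the leading factors 2,
-- 4, 8 of the three classes, and the moduli 4·8 and 8·8 of the last two.

infixl 7 _⊗_
infixl 6 _⊕_
infix  8 ⊖_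
infix  4 _≈_ _≈⟨≤_⟩_

PS : Set
PS = ℕ → ℤ

-- A record rather than a function type, so that `f` and `g` can be inferred from a proof.
record _≈_ (f g : PS) : Set where
  constructor mk≈
  field at : ∀ n → f n ≡ g n
open _≈_

-- Congruence modulo q^(n+1), the form in which infinite products and partial sums are compared.
_≈⟨≤_⟩_ : PS → ℕ → PS → Set
f ≈⟨≤ n ⟩ g = ∀ k → k ≤ n → f k ≡ g k

tail : PS → PS
tail f n = f (suc n)

-- The Cauchy product as f g = f(0) g + q (tail f) g. The recursion consumes `f` alone, so that the
-- laws in the left factor are inductions on the degree.
mul : PS → PS → PS
mul f g zero    = f 0 *ℤ g 0
mul f g (suc n) = f 0 *ℤ g (suc n) +ℤ mul (tail f) g n

mul-congʳ≤ : ∀ n f {g g'} → g ≈⟨≤ n ⟩ g' → mul f g n ≡ mul f g' n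
mul-congʳ≤ zero    f e = cong (f 0 *ℤ_) (e 0 z≤n)
mul-congʳ≤ (suc n) f e = cong₂ _+ℤ_ (cong (f 0 *ℤ_) (e (suc n) ℕ.≤-refl))
  (mul-congʳ≤ n (tail f) λ k k≤n → e k (ℕ.m≤n⇒m≤1+n k≤n))

mul-congˡ≤ : ∀ n {f f'} g → f ≈⟨≤ n ⟩ f' → mul f g n ≡ mul f' g n
mul-congˡ≤ zero    g e = cong (_*ℤ g 0) (e 0 z≤n)
mul-congˡ≤ (suc n) g e = cong₂ _+ℤ_ (cong (_*ℤ g (suc n)) (e 0 z≤n))
  (mul-congˡ≤ n g λ k k≤n → e (suc k) (s≤s k≤n))

mul-distribʳ : ∀ n f f' g → mul (λ k → f k +ℤ f' k) g n ≡ mul f g n +ℤ mul f' g n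
mul-distribʳ zero    f f' g = ℤ.*-distribʳ-+ (g 0) (f 0) (f' 0)
mul-distribʳ (suc n) f f' g = trans
  (cong ((f 0 +ℤ f' 0) *ℤ g (suc n) +ℤ_) (mul-distribʳ n (tail f) (tail f') g))
  (regroup (f 0) (f' 0) (g (suc n)) _ _)
  where
  regroup : ∀ a b c x y → (a +ℤ b) *ℤ c +ℤ (x +ℤ y) ≡ (a *ℤ c +ℤ x) +ℤ (b *ℤ c +ℤ y)
  regroup = ℤ-Ring.solve-∀

mul-scaleˡ : ∀ n c f g → mul (λ k → c *ℤ f k) g n ≡ c *ℤ mul f g n
mul-scaleˡ zero    c f g = ℤ.*-assoc c (f 0) (g 0)
mul-scaleˡ (suc n) c f g = trans
  (cong ((c *ℤ f 0) *ℤ g (suc n) +ℤ_) (mul-scaleˡ n c (tail f) g))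
  (regroup c (f 0) (g (suc n)) _)
  where
  regroup : ∀ c a b x → (c *ℤ a) *ℤ b +ℤ c *ℤ x ≡ c *ℤ (a *ℤ b +ℤ x)
  regroup = ℤ-Ring.solve-∀

mul-assoc : ∀ n f g h → mul (mul f g) h n ≡ mul f (mul g h) n
mul-assoc zero    f g h = ℤ.*-assoc (f 0) (g 0) (h 0)
mul-assoc (suc n) f g h = begin
  (f 0 *ℤ g 0) *ℤ h (suc n) +ℤ mul (tail (mul f g)) h n
    ≡⟨ cong ((f 0 *ℤ g 0) *ℤ h (suc n) +ℤ_)
         (trans (mul-distribʳ n (λ k → f 0 *ℤ g (suc k)) (mul (tail f) g) h)
           (cong₂ _+ℤ_ (mul-scaleˡ n (f 0) (tail g) h) (mul-assoc n (tail f) g h))) ⟩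
  (f 0 *ℤ g 0) *ℤ h (suc n) +ℤ (f 0 *ℤ mul (tail g) h n +ℤ mul (tail f) (mul g h) n)
    ≡⟨ regroup (f 0) (g 0) (h (suc n)) _ _ ⟩
  f 0 *ℤ (g 0 *ℤ h (suc n) +ℤ mul (tail g) h n) +ℤ mul (tail f) (mul g h) n ∎
  where
  open ≡-Reasoning
  regroup : ∀ a b c x y → (a *ℤ b) *ℤ c +ℤ (a *ℤ x +ℤ y) ≡ a *ℤ (b *ℤ c +ℤ x) +ℤ y
  regroup = ℤ-Ring.solve-∀

-- Splits off the constant term of `g`, the mirror image of the recursion defining `mul`;
-- commutativity is the comparison of the two.
mul-sucʳ : ∀ n f g → mul f g (suc n) ≡ mul f (tail g) n +ℤ f (suc n) *ℤ g 0
mul-sucʳ zero    f g = refl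
mul-sucʳ (suc n) f g = trans
  (cong (f 0 *ℤ g (suc (suc n)) +ℤ_) (mul-sucʳ n (tail f) g))
  (sym (ℤ.+-assoc (f 0 *ℤ g (suc (suc n))) (mul (tail f) (tail g) n) _))

mul-comm : ∀ n f g → mul f g n ≡ mul g f n
mul-comm zero    f g = ℤ.*-comm (f 0) (g 0)
mul-comm (suc n) f g = begin
  f 0 *ℤ g (suc n) +ℤ mul (tail f) g n  ≡⟨ cong₂ _+ℤ_ (ℤ.*-comm (f 0) _) (mul-comm n (tail f) g) ⟩
  g (suc n) *ℤ f 0 +ℤ mul g (tail f) n  ≡⟨ ℤ.+-comm (g (suc n) *ℤ f 0) _ ⟩
  mul g (tail f) n +ℤ g (suc n) *ℤ f 0  ≡⟨ mul-sucʳ n g f ⟨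
  mul g f (suc n) ∎
  where open ≡-Reasoning

const : ℤ → PS
const c zero    = c
const c (suc _) = + 0

mul-zeroˡ : ∀ n {f} g → (∀ k → k ≤ n → f k ≡ + 0) → mul f g n ≡ + 0
mul-zeroˡ zero    g e rewrite e 0 z≤n = refl
mul-zeroˡ (suc n) g e rewrite e 0 z≤n | mul-zeroˡ n g (λ k k≤n → e (suc k) (s≤s k≤n)) = refl

mul-zeroʳ : ∀ n f {g} → (∀ k → k ≤ n → g k ≡ + 0) → mul f g n ≡ + 0
mul-zeroʳ n f e = trans (mul-comm n f _) (mul-zeroˡ n f e)

mul-const : ∀ n c g → mul (const c) g n ≡ c *ℤ g n
mul-const zero    c g = refl
mul-const (suc n) c g = trans
  (cong (c *ℤ g (suc n) +ℤ_) (mul-zeroˡ n {tail (const c)} g λ _ _ → refl)) (ℤ.+-identityʳ _)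

signs₀ : ∀ a b → + 1 *ℤ (a *ℤ b) ≡ (+ 1 *ℤ a) *ℤ (+ 1 *ℤ b)
signs₀ = ℤ-Ring.solve-∀

signs₁ : ∀ s a b m → (- (+ 1) *ℤ s) *ℤ (a *ℤ b +ℤ m) ≡
         (+ 1 *ℤ a) *ℤ ((- (+ 1) *ℤ s) *ℤ b) +ℤ - (+ 1) *ℤ (s *ℤ m)
signs₁ = ℤ-Ring.solve-∀

neg-assoc : ∀ s a → (- (+ 1) *ℤ s) *ℤ a ≡ - (s *ℤ a)
neg-assoc = ℤ-Ring.solve-∀

alternate : ∀ s → - (+ 1) *ℤ s +ℤ s ≡ + 0
alternate = ℤ-Ring.solve-∀

alternate₂ : ∀ s → - (+ 1) *ℤ s +ℤ - s ≡ + 2 *ℤ (- (+ 1) *ℤ s)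
alternate₂ = ℤ-Ring.solve-∀

neg-two : ∀ s → - (+ 2 *ℤ s) ≡ + 2 *ℤ (- (+ 1) *ℤ s)
neg-two = ℤ-Ring.solve-∀

-- Opacity keeps the ring solver from unfolding series into coefficients.
opaque
  _⊕_ _⊗_ : PS → PS → PS
  (f ⊕ g) n = f n +ℤ g n
  _⊗_ = mul

  ⊖_ : PS → PS
  (⊖ f) n = - f n

  κ : ℤ → PS
  κ = const

  X : PS
  X zero          = + 0
  X (suc zero)    = + 1
  X (suc (suc _)) = + 0

opaque
  unfolding _⊕_

  ⊕-at : ∀ f g n → (f ⊕ g) n ≡ f n +ℤ g n
  ⊕-at f g n = refl

  ⊖-at : ∀ f n → (⊖ f) n ≡ - f n
  ⊖-at f n = refl

  ⊗-at : ∀ f g n → (f ⊗ g) n ≡ mul f g n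
  ⊗-at f g n = refl

  ⊗-at0 : ∀ f g → (f ⊗ g) 0 ≡ f 0 *ℤ g 0
  ⊗-at0 f g = refl

  κ-at0 : ∀ c → κ c 0 ≡ c
  κ-at0 c = refl

  κ-suc : ∀ c n → κ c (suc n) ≡ + 0
  κ-suc c n = refl

  κ⊗-at : ∀ c f n → (κ c ⊗ f) n ≡ c *ℤ f n
  κ⊗-at c f n = mul-const n c f

  X-at : ∀ n → X (suc n) ≡ const (+ 1) n
  X-at zero    = refl
  X-at (suc n) = refl

  X⊗-at0 : ∀ f → (X ⊗ f) 0 ≡ + 0
  X⊗-at0 f = refl

  X⊗-suc : ∀ f n → (X ⊗ f) (suc n) ≡ f n
  X⊗-suc f n = begin
    + 0 *ℤ f (suc n) +ℤ mul (tail X) f n  ≡⟨ ℤ.+-identityˡ _ ⟩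
    mul (tail X) f n                      ≡⟨ mul-congˡ≤ n f (λ k _ → X-at k) ⟩
    mul (const (+ 1)) f n                 ≡⟨ mul-const n (+ 1) f ⟩
    + 1 *ℤ f n                            ≡⟨ ℤ.*-identityˡ _ ⟩
    f n ∎
    where open ≡-Reasoning

  κ-+ : ∀ c d → κ (c +ℤ d) ≈ κ c ⊕ κ d
  at (κ-+ c d) zero    = refl
  at (κ-+ c d) (suc n) = refl

  κ-* : ∀ c d → κ (c *ℤ d) ≈ κ c ⊗ κ d
  at (κ-* c d) zero    = refl
  at (κ-* c d) (suc n) = sym (trans (mul-const (suc n) c (const d)) (ℤ.*-zeroʳ c))

  κ-neg : ∀ c → κ (- c) ≈ ⊖ κ c
  at (κ-neg c) zero    = refl
  at (κ-neg c) (suc n) = refl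

  ⊗-cong≤ : ∀ n {f f' g g'} → f ≈⟨≤ n ⟩ f' → g ≈⟨≤ n ⟩ g' → f ⊗ g ≈⟨≤ n ⟩ f' ⊗ g'
  ⊗-cong≤ n {f} {f'} {g} d e k k≤n = trans
    (mul-congˡ≤ k g λ j j≤k → d j (ℕ.≤-trans j≤k k≤n))
    (mul-congʳ≤ k f' λ j j≤k → e j (ℕ.≤-trans j≤k k≤n))

  PS-isCommutativeRing : IsCommutativeRing _≈_ _⊕_ _⊗_ ⊖_ (κ (+ 0)) (κ (+ 1))
  PS-isCommutativeRing = record
      { isRing = record
        { +-isAbelianGroup = record
          { isGroup = record
            { isMonoid = record
              { isSemigroup = record
                { isMagma = record
                  { isEquivalence = record
                    { refl = mk≈ λ _ → refl
                    ; sym = λ e → mk≈ λ n → sym (at e n)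
                    ; trans = λ d e → mk≈ λ n → trans (at d n) (at e n) }
                  ; ∙-cong = λ d e → mk≈ λ n → cong₂ _+ℤ_ (at d n) (at e n) }
                ; assoc = λ f g h → mk≈ λ n → ℤ.+-assoc (f n) (g n) (h n) }
              ; identity = (λ f → mk≈ λ { zero → ℤ.+-identityˡ _ ; (suc n) → ℤ.+-identityˡ _ })
                         , (λ f → mk≈ λ { zero → ℤ.+-identityʳ _ ; (suc n) → ℤ.+-identityʳ _ }) }
            ; inverse = (λ f → mk≈ λ { zero → ℤ.+-inverseˡ (f 0) ; (suc n) → ℤ.+-inverseˡ (f (suc n)) })
                      , (λ f → mk≈ λ { zero → ℤ.+-inverseʳ (f 0) ; (suc n) → ℤ.+-inverseʳ (f (suc n)) })
            ; ⁻¹-cong = λ e → mk≈ λ n → cong -_ (at e n) }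
          ; comm = λ f g → mk≈ λ n → ℤ.+-comm (f n) (g n) }
        ; *-cong = λ {f} {f'} {g} {g'} d e → mk≈ λ n →
            ⊗-cong≤ n {f} {f'} {g} {g'} (λ k _ → at d k) (λ k _ → at e k) n ℕ.≤-refl
        ; *-assoc = λ f g h → mk≈ λ n → mul-assoc n f g h
        ; *-identity = (λ f → mk≈ (one-mul f))
                     , (λ f → mk≈ λ n → trans (mul-comm n f _) (one-mul f n))
        ; distrib = (λ f g h → mk≈ λ n → trans (mul-comm n f _)
                      (trans (mul-distribʳ n g h f) (cong₂ _+ℤ_ (mul-comm n g f) (mul-comm n h f))))
                  , (λ f g h → mk≈ λ n → mul-distribʳ n g h f)
        }
      ; *-comm = λ f g → mk≈ λ n → mul-comm n f g
      }
    where
    one-mul : ∀ f n → mul (const (+ 1)) f n ≡ f n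
    one-mul f n = trans (mul-const n (+ 1) f) (ℤ.*-identityˡ _)

PS-ring : CommutativeRing 0ℓ 0ℓ
PS-ring = record { isCommutativeRing = PS-isCommutativeRing }

open CommutativeRing PS-ring using ()
  renaming (refl to ≈-refl; sym to ≈-sym; trans to ≈-trans; setoid to PS-setoid
           ; semiring to PS-semiring; +-cong to ⊕-cong; *-cong to ⊗-cong; -‿cong to ⊖-cong)

ℤ⟶PS : +-*-rawRing -Raw-AlmostCommutative⟶ fromCommutativeRing PS-ring
ℤ⟶PS = record
  { ⟦_⟧ = κ ; +-homo = κ-+ ; *-homo = κ-* ; -‿homo = κ-neg ; 0-homo = ≈-refl ; 1-homo = ≈-refl }

coeff≟ : (c d : ℤ) → Maybe (κ c ≈ κ d)
coeff≟ c d with c ℤ.≟ d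
... | yes refl = just ≈-refl
... | no  _    = nothing

open RingSolver +-*-rawRing (fromCommutativeRing PS-ring) ℤ⟶PS coeff≟
  using (Polynomial; op; con; var; _:^_; [+]; [*]; ⟦_⟧; _:+_; _:*_; :-_; _:-_; _:=_; solve)

open Exp PS-semiring using () renaming (_^_ to _↑_; ^-congˡ to ↑-congˡ)

module ≈R = SetoidReasoning PS-setoid

≡⇒≈⟨≤⟩ : ∀ {f g} n → f ≈ g → f ≈⟨≤ n ⟩ g
≡⇒≈⟨≤⟩ n e k _ = at e k

-- Linear combination: f - g is a combination u - v of known equations.
lc : ∀ {f g u v} → u ≈ v → f ⊕ v ≈ g ⊕ u → f ≈ g
lc {f} {g} {u} {v} u≈v e = begin
  f              ≈⟨ solve 2 (λ f v → f := (f :+ v) :- v) ≈-refl f v ⟩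
  f ⊕ v ⊕ ⊖ v    ≈⟨ ⊕-cong e (⊖-cong (≈-sym u≈v)) ⟩
  g ⊕ u ⊕ ⊖ u    ≈⟨ solve 2 (λ g u → (g :+ u) :- u := g) ≈-refl g u ⟩
  g ∎
  where open ≈R

-- Cancellation laws and powers of q

κ0-at : ∀ n → κ (+ 0) n ≡ + 0
κ0-at zero    = κ-at0 (+ 0)
κ0-at (suc n) = κ-suc (+ 0) n

-- Every other product in the convolution contains a coefficient of `d` below `n`. So the lowest
-- nonzero coefficient survives multiplication by a series with nonzero constant term, which is what
-- cancellation rests on.
⊗-top : ∀ n f d → (∀ k → k < n → d k ≡ + 0) → (f ⊗ d) n ≡ f 0 *ℤ d n
⊗-top zero    f d z = ⊗-at0 f d
⊗-top (suc n) f d z = begin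
  (f ⊗ d) (suc n)                      ≡⟨ ⊗-at f d (suc n) ⟩
  f 0 *ℤ d (suc n) +ℤ mul (tail f) d n ≡⟨ cong (f 0 *ℤ d (suc n) +ℤ_) (mul-zeroʳ n (tail f) λ k k≤n → z k (s≤s k≤n)) ⟩
  f 0 *ℤ d (suc n) +ℤ + 0              ≡⟨ ℤ.+-identityʳ _ ⟩
  f 0 *ℤ d (suc n) ∎
  where open ≡-Reasoning

vanish-by-induction : ∀ {d : PS} → (∀ n → (∀ k → k < n → d k ≡ + 0) → d n ≡ + 0) → d ≈ κ (+ 0)
vanish-by-induction {d} step = mk≈ λ n → trans (step n (below n)) (sym (κ0-at n))
  where
  below : ∀ n k → k < n → d k ≡ + 0
  below (suc n) k (s≤s k≤n) = step k λ j j<k → below n j (ℕ.≤-trans j<k k≤n)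

⊗-vanish : ∀ {f d} → f 0 ≢ + 0 → f ⊗ d ≈ κ (+ 0) → d ≈ κ (+ 0)
⊗-vanish {f} {d} f0≢0 e = vanish-by-induction λ n z →
  ℤ.*-cancelˡ-≡ (f 0) (d n) (+ 0) ⦃ ≢-nonZero f0≢0 ⦄
    (trans (sym (⊗-top n f d z)) (trans (at e n) (trans (κ0-at n) (sym (ℤ.*-zeroʳ (f 0))))))

⊖-vanish : ∀ {f g} → f ⊕ ⊖ g ≈ κ (+ 0) → f ≈ g
⊖-vanish {f} {g} e = lc e (solve 2 (λ f g → f :+ con (+ 0) := g :+ (f :- g)) ≈-refl f g)

⊗-cancelˡ : ∀ {g h} f → f 0 ≢ + 0 → f ⊗ g ≈ f ⊗ h → g ≈ h
⊗-cancelˡ {g} {h} f f0≢0 e = ⊖-vanish (⊗-vanish {f} f0≢0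
  (lc e (solve 3 (λ f g h → f :* (g :- h) :+ f :* h := con (+ 0) :+ f :* g) ≈-refl f g h)))

square-cancel : ∀ {f g} → f 0 ≡ + 1 → g 0 ≡ + 1 → f ⊗ f ≈ g ⊗ g → f ≈ g
square-cancel {f} {g} f0 g0 e = ⊖-vanish (⊗-vanish {f ⊕ g} sum0
  (lc e (solve 2 (λ f g → (f :+ g) :* (f :- g) :+ g :* g := con (+ 0) :+ f :* f) ≈-refl f g)))
  where
  sum0 : (f ⊕ g) 0 ≢ + 0
  sum0 e' with trans (sym (trans (⊕-at f g 0) (cong₂ _+ℤ_ f0 g0))) e'
  ... | ()

X⊗-cancel : ∀ {f g} → X ⊗ f ≈ X ⊗ g → f ≈ g
at (X⊗-cancel {f} {g} e) n = trans (sym (X⊗-suc f n)) (trans (at e (suc n)) (X⊗-suc g n))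

-- The extra clause makes `X^ 1`, `X^ 2` and `X^ 3` compute to `X`, `X ⊗ X` and `X ⊗ (X ⊗ X)`, the
-- shapes in which small powers are handed to the ring solver.
X^_ : ℕ → PS
X^ zero          = κ (+ 1)
X^ suc zero      = X
X^ suc (suc n)   = X ⊗ X^ (suc n)

X^-suc : ∀ n → X^ (suc n) ≈ X ⊗ X^ n
X^-suc zero    = solve 1 (λ x → x := x :* con (+ 1)) ≈-refl X
X^-suc (suc n) = ≈-refl

X^-+ : ∀ m n → X^ (m + n) ≈ X^ m ⊗ X^ n
X^-+ zero    n = solve 1 (λ x → x := con (+ 1) :* x) ≈-refl (X^ n)
X^-+ (suc m) n = begin
  X^ (suc (m + n))   ≈⟨ X^-suc (m + n) ⟩
  X ⊗ X^ (m + n)     ≈⟨ ⊗-cong ≈-refl (X^-+ m n) ⟩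
  X ⊗ (X^ m ⊗ X^ n)  ≈⟨ solve 3 (λ x y z → x :* (y :* z) := x :* y :* z) ≈-refl X (X^ m) (X^ n) ⟩
  X ⊗ X^ m ⊗ X^ n    ≈⟨ ⊗-cong (X^-suc m) ≈-refl ⟨
  X^ (suc m) ⊗ X^ n ∎
  where open ≈R

X^⊗-suc : ∀ j f n → (X^ (suc j) ⊗ f) (suc n) ≡ (X^ j ⊗ f) n
X^⊗-suc j f n = trans
  (at (≈-trans (⊗-cong (X^-suc j) ≈-refl)
        (solve 3 (λ x y z → x :* y :* z := x :* (y :* z)) ≈-refl X (X^ j) f)) (suc n))
  (X⊗-suc _ n)

X^⊗-at : ∀ j f n → (X^ j ⊗ f) (j + n) ≡ f n
X^⊗-at zero    f n = trans (κ⊗-at (+ 1) f n) (ℤ.*-identityˡ _)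
X^⊗-at (suc j) f n = trans (X^⊗-suc j f (j + n)) (X^⊗-at j f n)

X^⊗-below : ∀ j f n → n < j → (X^ j ⊗ f) n ≡ + 0
X^⊗-below (suc j) f zero    _         = trans
  (at (≈-trans (⊗-cong (X^-suc j) ≈-refl)
        (solve 3 (λ x y z → x :* y :* z := x :* (y :* z)) ≈-refl X (X^ j) f)) 0)
  (X⊗-at0 _)
X^⊗-below (suc j) f (suc n) (s≤s n<j) = trans (X^⊗-suc j f n) (X^⊗-below j f n n<j)

X^-split : ∀ j n → n < j ⊎ ∃ λ m → n ≡ j + m
X^-split j n with n ℕ.<? j
... | yes n<j = inj₁ n<j
... | no  n≮j = inj₂ (n ∸ j , sym (ℕ.m+[n∸m]≡n (ℕ.≮⇒≥ n≮j)))

X^-cong≤ : ∀ j {f g} n → (∀ m → j + m ≤ n → f m ≡ g m) → X^ j ⊗ f ≈⟨≤ n ⟩ X^ j ⊗ g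
X^-cong≤ j {f} {g} n e k k≤n with X^-split j k
... | inj₁ k<j        = trans (X^⊗-below j f k k<j) (sym (X^⊗-below j g k k<j))
... | inj₂ (m , refl) = trans (X^⊗-at j f m) (trans (e m k≤n) (sym (X^⊗-at j g m)))

-- The substitutions q ↦ q^k and q ↦ -q, and sections along residue classes

V : (k : ℕ) .{{_ : NonZero k}} → PS → PS
V k f n with k ∣? n
... | yes k∣n = f (quotient k∣n)
... | no  _   = + 0

module _ (k : ℕ) .{{_ : NonZero k}} where

  V-at : ∀ f n → V k f (k * n) ≡ f n
  V-at f n with k ∣? (k * n)
  ... | yes (divides q eq) = cong f (ℕ.*-cancelʳ-≡ q n k (trans (sym eq) (ℕ.*-comm k n)))
  ... | no  ∤              = ⊥-elim (∤ (divides n (ℕ.*-comm k n)))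

  V-off : ∀ f n → ¬ k ∣ℕ n → V k f n ≡ + 0
  V-off f n ∤ with k ∣? n
  ... | yes k∣n = ⊥-elim (∤ k∣n)
  ... | no  _   = refl

  V-at0 : ∀ f → V k f 0 ≡ f 0
  V-at0 f = trans (cong (V k f) (sym (ℕ.*-zeroʳ k))) (V-at f 0)

  V-spec : ∀ {f g} → (∀ n → g (k * n) ≡ f n) → (∀ n → ¬ k ∣ℕ n → g n ≡ + 0) → V k f ≈ g
  at (V-spec {f} {g} on off) n with k ∣? n
  ... | yes (divides q eq) = trans (sym (on q)) (cong g (trans (ℕ.*-comm k q) (sym eq)))
  ... | no  ∤              = sym (off n ∤)

  V-cong≤ : ∀ n {f g} → f ≈⟨≤ n ⟩ g → V k f ≈⟨≤ n ⟩ V k g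
  V-cong≤ n e m m≤n with k ∣? m
  ... | yes (divides q refl) = e q (ℕ.≤-trans (ℕ.m≤m*n q k) m≤n)
  ... | no  _                = refl

  V-cong : ∀ {f g} → f ≈ g → V k f ≈ V k g
  at (V-cong e) n = V-cong≤ n (≡⇒≈⟨≤⟩ n e) n ℕ.≤-refl

  V-injective : ∀ {f g} → V k f ≈ V k g → f ≈ g
  at (V-injective {f} {g} e) n = trans (sym (V-at f n)) (trans (at e (k * n)) (V-at g n))

  V-⊕ : ∀ f g → V k (f ⊕ g) ≈ V k f ⊕ V k g
  V-⊕ f g = V-spec
    (λ n → trans (⊕-at _ _ _) (trans (cong₂ _+ℤ_ (V-at f n) (V-at g n)) (sym (⊕-at f g n))))
    (λ n ∤ → trans (⊕-at _ _ _) (cong₂ _+ℤ_ (V-off f n ∤) (V-off g n ∤)))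

  V-⊖ : ∀ f → V k (⊖ f) ≈ ⊖ V k f
  V-⊖ f = V-spec
    (λ n → trans (⊖-at _ _) (trans (cong -_ (V-at f n)) (sym (⊖-at f n))))
    (λ n ∤ → trans (⊖-at _ _) (cong -_ (V-off f n ∤)))

  V-κ⊗ : ∀ c f → V k (κ c ⊗ f) ≈ κ c ⊗ V k f
  V-κ⊗ c f = V-spec
    (λ n → trans (κ⊗-at c _ _) (trans (cong (c *ℤ_) (V-at f n)) (sym (κ⊗-at c f n))))
    (λ n ∤ → trans (κ⊗-at c _ _) (trans (cong (c *ℤ_) (V-off f n ∤)) (ℤ.*-zeroʳ c)))

  V-unfold : ∀ f → V k f ≈ κ (f 0) ⊕ X^ k ⊗ V k (tail f)
  V-unfold f = V-spec on off
    where
    val : ∀ n → (κ (f 0) ⊕ X^ k ⊗ V k (tail f)) (k + n) ≡ V k (tail f) n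
    val n = trans (⊕-at _ _ _) (trans (cong₂ _+ℤ_ (κ-at-pos k n) (X^⊗-at k _ n)) (ℤ.+-identityˡ _))
      where
      κ-at-pos : ∀ k .{{_ : NonZero k}} n → κ (f 0) (k + n) ≡ + 0
      κ-at-pos (suc k) n = κ-suc (f 0) (k + n)
    low : ∀ n → n < k → (κ (f 0) ⊕ X^ k ⊗ V k (tail f)) n ≡ κ (f 0) n
    low n n<k = trans (⊕-at _ _ _) (trans (cong (κ (f 0) n +ℤ_) (X^⊗-below k _ n n<k)) (ℤ.+-identityʳ _))
    on : ∀ n → (κ (f 0) ⊕ X^ k ⊗ V k (tail f)) (k * n) ≡ f n
    on zero rewrite ℕ.*-zeroʳ k = trans (low 0 (>-nonZero⁻¹ k)) (κ-at0 _)
    on (suc n) rewrite ℕ.*-suc k n = trans (val (k * n)) (V-at (tail f) n)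
    off : ∀ n → ¬ k ∣ℕ n → (κ (f 0) ⊕ X^ k ⊗ V k (tail f)) n ≡ + 0
    off n ∤ with X^-split k n
    ... | inj₁ n<k = trans (low n n<k) (nz n ∤)
      where
      nz : ∀ n → ¬ k ∣ℕ n → κ (f 0) n ≡ + 0
      nz zero    ∤ = ⊥-elim (∤ (divides 0 refl))
      nz (suc n) ∤ = κ-suc _ n
    ... | inj₂ (m , refl) = trans (val m) (V-off (tail f) m λ { (divides q refl) → ∤ (divides (suc q) refl) })

  V-κ : ∀ c → V k (κ c) ≈ κ c
  V-κ c = V-spec on off
    where
    on : ∀ n → κ c (k * n) ≡ κ c n
    on zero rewrite ℕ.*-zeroʳ k = refl
    on (suc n) with k * suc n in eq
    ... | zero  = ⊥-elim (≢-nonZero⁻¹ (k * suc n) ⦃ ℕ.m*n≢0 k (suc n) ⦄ eq)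
    ... | suc m = trans (κ-suc c m) (sym (κ-suc c n))
    off : ∀ n → ¬ k ∣ℕ n → κ c n ≡ + 0
    off zero    ∤ = ⊥-elim (∤ (divides 0 refl))
    off (suc n) ∤ = κ-suc c n

  V-X⊗ : ∀ f → V k (X ⊗ f) ≈ X^ k ⊗ V k f
  V-X⊗ f = begin
    V k (X ⊗ f)                                      ≈⟨ V-unfold (X ⊗ f) ⟩
    κ ((X ⊗ f) 0) ⊕ X^ k ⊗ V k (tail (X ⊗ f))        ≈⟨ ⊕-cong (mk≈ λ n → cong (λ c → κ c n) (X⊗-at0 f))
                                                          (⊗-cong ≈-refl (V-cong (mk≈ (X⊗-suc f)))) ⟩
    κ (+ 0) ⊕ X^ k ⊗ V k f                           ≈⟨ solve 1 (λ y → con (+ 0) :+ y := y) ≈-refl _ ⟩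
    X^ k ⊗ V k f ∎
    where open ≈R

  -- Both sides obey the same recursion along `f`: the constant term contributes f(0) g(q^k), and
  -- the tail is multiplied by q^k. `agree` compares them up to degree `n` for all `f` at once,
  -- since the tail is another series.
  V-⊗ : ∀ f g → V k (f ⊗ g) ≈ V k f ⊗ V k g
  V-⊗ f g = mk≈ λ n → agree n f n ℕ.≤-refl
    where
    unfold : ∀ f → f ≈ κ (f 0) ⊕ X ⊗ tail f
    at (unfold f) zero    = sym (trans (⊕-at _ _ _) (trans (cong₂ _+ℤ_ (κ-at0 _) (X⊗-at0 _)) (ℤ.+-identityʳ _)))
    at (unfold f) (suc n) = sym (trans (⊕-at _ _ _) (trans (cong₂ _+ℤ_ (κ-suc _ n) (X⊗-suc _ n)) (ℤ.+-identityˡ _)))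

    lhs : ∀ f → V k (f ⊗ g) ≈ κ (f 0) ⊗ V k g ⊕ X^ k ⊗ V k (tail f ⊗ g)
    lhs f = begin
      V k (f ⊗ g)                                  ≈⟨ V-cong (⊗-cong (unfold f) ≈-refl) ⟩
      V k ((κ (f 0) ⊕ X ⊗ tail f) ⊗ g)             ≈⟨ V-cong (solve 4 (λ c x t g → (c :+ x :* t) :* g := c :* g :+ x :* (t :* g)) ≈-refl (κ (f 0)) X (tail f) g) ⟩
      V k (κ (f 0) ⊗ g ⊕ X ⊗ (tail f ⊗ g))         ≈⟨ V-⊕ _ _ ⟩
      V k (κ (f 0) ⊗ g) ⊕ V k (X ⊗ (tail f ⊗ g))   ≈⟨ ⊕-cong (V-κ⊗ (f 0) g) (V-X⊗ (tail f ⊗ g)) ⟩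
      κ (f 0) ⊗ V k g ⊕ X^ k ⊗ V k (tail f ⊗ g) ∎
      where open ≈R

    rhs : ∀ f → κ (f 0) ⊗ V k g ⊕ X^ k ⊗ (V k (tail f) ⊗ V k g) ≈ V k f ⊗ V k g
    rhs f = ≈-trans
      (solve 4 (λ c x t g → c :* g :+ x :* (t :* g) := (c :+ x :* t) :* g) ≈-refl (κ (f 0)) (X^ k) (V k (tail f)) (V k g))
      (⊗-cong (≈-sym (V-unfold f)) ≈-refl)

    agree : ∀ n f → V k (f ⊗ g) ≈⟨≤ n ⟩ V k f ⊗ V k g
    step : ∀ n f m → k + m ≤ n → V k (tail f ⊗ g) m ≡ (V k (tail f) ⊗ V k g) m
    agree n f m m≤n = trans (at (lhs f) m) (trans
      (trans (⊕-at _ _ m)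
        (trans (cong ((κ (f 0) ⊗ V k g) m +ℤ_) (X^-cong≤ k n (step n f) m m≤n)) (sym (⊕-at _ _ m))))
      (at (rhs f) m))
    -- As k ≥ 1, the tail is compared only in degrees below `n`; for degree 0 nothing is left.
    step zero    f m k+m≤0 = ⊥-elim (ℕ.<⇒≱ (>-nonZero⁻¹ k) (ℕ.≤-trans (ℕ.m≤m+n k m) k+m≤0))
    step (suc n) f m k+m≤n = agree n (tail f) m
      (s≤s⁻¹ (ℕ.≤-trans (ℕ.+-monoˡ-≤ m (>-nonZero⁻¹ k)) k+m≤n))

  V-X : V k X ≈ X^ k
  V-X = begin
    V k X                ≈⟨ V-cong (solve 1 (λ x → x := x :* con (+ 1)) ≈-refl X) ⟩
    V k (X ⊗ κ (+ 1))    ≈⟨ V-X⊗ _ ⟩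
    X^ k ⊗ V k (κ (+ 1)) ≈⟨ ⊗-cong ≈-refl (V-κ (+ 1)) ⟩
    X^ k ⊗ κ (+ 1)       ≈⟨ solve 1 (λ x → x :* con (+ 1) := x) ≈-refl _ ⟩
    X^ k ∎
    where open ≈R

V-V : ∀ k l .{{_ : NonZero k}} .{{_ : NonZero l}} .{{_ : NonZero (k * l)}} f → V k (V l f) ≈ V (k * l) f
V-V k l f = ≈-sym (V-spec (k * l)
  (λ n → trans (cong (V k (V l f)) (ℕ.*-assoc k l n)) (trans (V-at k (V l f) (l * n)) (V-at l f n)))
  off)
  where
  off : ∀ n → ¬ (k * l) ∣ℕ n → V k (V l f) n ≡ + 0
  off n ∤ with k ∣? n
  ... | no  _ = refl
  ... | yes (divides q refl) = V-off l f q λ { (divides r refl) →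
          ∤ (divides r (trans (ℕ.*-assoc r l k) (cong (r *_) (ℕ.*-comm l k)))) }

ν : PS → PS
ν f n = (- (+ 1)) ^ℤ n *ℤ f n

ν-cong≤ : ∀ n {f g} → f ≈⟨≤ n ⟩ g → ν f ≈⟨≤ n ⟩ ν g
ν-cong≤ n e k k≤n = cong ((- (+ 1)) ^ℤ k *ℤ_) (e k k≤n)

ν-cong : ∀ {f g} → f ≈ g → ν f ≈ ν g
at (ν-cong e) n = cong ((- (+ 1)) ^ℤ n *ℤ_) (at e n)

ν-⊕ : ∀ f g → ν (f ⊕ g) ≈ ν f ⊕ ν g
at (ν-⊕ f g) n = trans (cong ((- (+ 1)) ^ℤ n *ℤ_) (⊕-at f g n))
  (trans (ℤ.*-distribˡ-+ ((- (+ 1)) ^ℤ n) (f n) (g n)) (sym (⊕-at _ _ n)))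

ν-⊖ : ∀ f → ν (⊖ f) ≈ ⊖ ν f
at (ν-⊖ f) n = trans (cong ((- (+ 1)) ^ℤ n *ℤ_) (⊖-at f n))
  (trans (sym (ℤ.neg-distribʳ-* ((- (+ 1)) ^ℤ n) (f n))) (sym (⊖-at _ n)))

ν-κ : ∀ c → ν (κ c) ≈ κ c
at (ν-κ c) zero    = ℤ.*-identityˡ _
at (ν-κ c) (suc n) = trans (cong ((- (+ 1)) ^ℤ suc n *ℤ_) (κ-suc c n)) (trans (ℤ.*-zeroʳ ((- (+ 1)) ^ℤ suc n)) (sym (κ-suc c n)))

ν-⊗ : ∀ f g → ν (f ⊗ g) ≈ ν f ⊗ ν g
at (ν-⊗ f g) n = trans (cong ((- (+ 1)) ^ℤ n *ℤ_) (⊗-at f g n)) (trans (go n f) (sym (⊗-at _ _ n)))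
  where
  go : ∀ n f → (- (+ 1)) ^ℤ n *ℤ mul f g n ≡ mul (ν f) (ν g) n
  go zero    f = signs₀ (f 0) (g 0)
  go (suc n) f = trans
    (signs₁ ((- (+ 1)) ^ℤ n) (f 0) (g (suc n)) (mul (tail f) g n))
    (cong ((+ 1 *ℤ f 0) *ℤ ν g (suc n) +ℤ_)
      (trans (cong (- (+ 1) *ℤ_) (go n (tail f)))
        (trans (sym (mul-scaleˡ n (- (+ 1)) (ν (tail f)) (ν g)))
          (mul-congˡ≤ n (ν g) λ k _ → sym (ℤ.*-assoc (- (+ 1)) ((- (+ 1)) ^ℤ k) (f (suc k)))))))

ν-X⊗ : ∀ f → ν (X ⊗ f) ≈ ⊖ (X ⊗ ν f)
at (ν-X⊗ f) zero    = trans (ℤ.*-identityˡ _)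
  (trans (X⊗-at0 f) (sym (trans (⊖-at _ 0) (cong -_ (X⊗-at0 (ν f))))))
at (ν-X⊗ f) (suc n) = trans (cong ((- (+ 1)) ^ℤ suc n *ℤ_) (X⊗-suc f n))
  (trans (neg-assoc ((- (+ 1)) ^ℤ n) (f n))
    (sym (trans (⊖-at _ (suc n)) (cong -_ (X⊗-suc (ν f) n)))))

ν-X : ν X ≈ ⊖ X
ν-X = begin
  ν X                   ≈⟨ ν-cong (solve 1 (λ x → x := x :* con (+ 1)) ≈-refl X) ⟩
  ν (X ⊗ κ (+ 1))       ≈⟨ ν-X⊗ _ ⟩
  ⊖ (X ⊗ ν (κ (+ 1)))   ≈⟨ ⊖-cong (⊗-cong ≈-refl (ν-κ (+ 1))) ⟩
  ⊖ (X ⊗ κ (+ 1))       ≈⟨ solve 1 (λ x → :- (x :* con (+ 1)) := :- x) ≈-refl X ⟩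
  ⊖ X ∎
  where open ≈R

sign-even : ∀ n → (- (+ 1)) ^ℤ (2 * n) ≡ + 1
sign-even n = trans (sym (ℤ.^-*-assoc (- (+ 1)) 2 n)) (ℤ.^-zeroˡ n)

sign-odd : ∀ i n → (- (+ 1)) ^ℤ (suc (2 * i) * n) ≡ (- (+ 1)) ^ℤ n
sign-odd i n = trans (sym (ℤ.^-*-assoc (- (+ 1)) (suc (2 * i)) n))
  (cong (λ s → (- (+ 1) *ℤ s) ^ℤ n) (sign-even i))

ν-ν : ∀ f → ν (ν f) ≈ f
at (ν-ν f) n = trans (sym (ℤ.*-assoc ((- (+ 1)) ^ℤ n) _ (f n)))
  (trans (cong (_*ℤ f n) (trans (sym (ℤ.^-distribˡ-+-* (- (+ 1)) n n))
           (trans (cong (λ m → (- (+ 1)) ^ℤ (n + m)) (sym (ℕ.+-identityʳ n))) (sign-even n))))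
    (ℤ.*-identityˡ _))

ν-V2 : ∀ f → ν (V 2 f) ≈ V 2 f
ν-V2 f = ≈-sym (V-spec 2
  (λ n → trans (cong (_*ℤ V 2 f (2 * n)) (sign-even n)) (trans (ℤ.*-identityˡ _) (V-at 2 f n)))
  (λ n ∤ → trans (cong ((- (+ 1)) ^ℤ n *ℤ_) (V-off 2 f n ∤)) (ℤ.*-zeroʳ ((- (+ 1)) ^ℤ n))))

ν-V-odd : ∀ i f → ν (V (suc (2 * i)) f) ≈ V (suc (2 * i)) (ν f)
ν-V-odd i f = ≈-sym (V-spec (suc (2 * i))
  (λ n → cong₂ _*ℤ_ (sign-odd i n) (V-at (suc (2 * i)) f n))
  (λ n ∤ → trans (cong ((- (+ 1)) ^ℤ n *ℤ_) (V-off (suc (2 * i)) f n ∤)) (ℤ.*-zeroʳ ((- (+ 1)) ^ℤ n))))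

ν-V3 : ∀ f → ν (V 3 f) ≈ V 3 (ν f)
ν-V3 = ν-V-odd 1

sec : ℕ → ℕ → PS → PS
sec k i f n = f (i + k * n)

sec-cong : ∀ k i {f g} → f ≈ g → sec k i f ≈ sec k i g
at (sec-cong k i e) n = at e (i + k * n)

sec-⊕ : ∀ k i f g → sec k i (f ⊕ g) ≈ sec k i f ⊕ sec k i g
at (sec-⊕ k i f g) n = trans (⊕-at f g _) (sym (⊕-at _ _ n))

sec-X^V : ∀ k i .{{_ : NonZero k}} f → sec k i (X^ i ⊗ V k f) ≈ f
at (sec-X^V k i f) n = trans (X^⊗-at i (V k f) (k * n)) (V-at k f n)

sec-X^V-off : ∀ k i j .{{_ : NonZero k}} → i < k → j < k → i ≢ j →
              ∀ f → sec k i (X^ j ⊗ V k f) ≈ κ (+ 0)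
at (sec-X^V-off k i j i<k j<k i≢j f) n = trans val (sym (κ0-at n))
  where
  val : (X^ j ⊗ V k f) (i + k * n) ≡ + 0
  val with X^-split j (i + k * n)
  ... | inj₁ lt       = X^⊗-below j _ _ lt
  ... | inj₂ (m , eq) = trans (cong (X^ j ⊗ V k f) eq) (trans (X^⊗-at j _ m) (V-off k f m ∤))
    where
    ∤ : ¬ k ∣ℕ m
    ∤ (divides q refl) = i≢j (begin
      i                ≡⟨ m<n⇒m%n≡m i<k ⟨
      i % k            ≡⟨ [m+kn]%n≡m%n i n k ⟨
      (i + n * k) % k  ≡⟨ cong (λ x → (i + x) % k) (ℕ.*-comm n k) ⟩
      (i + k * n) % k  ≡⟨ cong (_% k) eq ⟩
      (j + q * k) % k  ≡⟨ [m+kn]%n≡m%n j q k ⟩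
      j % k            ≡⟨ m<n⇒m%n≡m j<k ⟩
      j ∎)
      where open ≡-Reasoning

module _ (f₀ f₁ : PS) where
  weave₂ : PS
  weave₂ = V 2 f₀ ⊕ X ⊗ V 2 f₁

  private
    expand : weave₂ ≈ X^ 0 ⊗ V 2 f₀ ⊕ X^ 1 ⊗ V 2 f₁
    expand = solve 3 (λ x a b → a :+ x :* b := con (+ 1) :* a :+ x :* b) ≈-refl X (V 2 f₀) (V 2 f₁)

  sec-weave₂-0 : sec 2 0 weave₂ ≈ f₀
  sec-weave₂-0 = ≈-trans (sec-cong 2 0 expand) (≈-trans (sec-⊕ 2 0 _ _)
    (≈-trans (⊕-cong (sec-X^V 2 0 f₀) (sec-X^V-off 2 0 1 (s≤s z≤n) (s≤s (s≤s z≤n)) (λ ()) f₁))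
      (solve 1 (λ x → x :+ con (+ 0) := x) ≈-refl f₀)))

  sec-weave₂-1 : sec 2 1 weave₂ ≈ f₁
  sec-weave₂-1 = ≈-trans (sec-cong 2 1 expand) (≈-trans (sec-⊕ 2 1 _ _)
    (≈-trans (⊕-cong (sec-X^V-off 2 1 0 (s≤s (s≤s z≤n)) (s≤s z≤n) (λ ()) f₀) (sec-X^V 2 1 f₁))
      (solve 1 (λ x → con (+ 0) :+ x := x) ≈-refl f₁)))

module _ (f₀ f₁ f₂ : PS) where
  weave₃ : PS
  weave₃ = V 3 f₀ ⊕ X ⊗ V 3 f₁ ⊕ X ⊗ X ⊗ V 3 f₂

  private
    expand : weave₃ ≈ X^ 0 ⊗ V 3 f₀ ⊕ X^ 1 ⊗ V 3 f₁ ⊕ X^ 2 ⊗ V 3 f₂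
    expand = solve 4 (λ x a b c → a :+ x :* b :+ x :* x :* c := con (+ 1) :* a :+ x :* b :+ x :* x :* c)
      ≈-refl X (V 3 f₀) (V 3 f₁) (V 3 f₂)

    terms : ∀ i {g₀ g₁ g₂ g} → sec 3 i (X^ 0 ⊗ V 3 f₀) ≈ g₀ → sec 3 i (X^ 1 ⊗ V 3 f₁) ≈ g₁ →
            sec 3 i (X^ 2 ⊗ V 3 f₂) ≈ g₂ → g₀ ⊕ g₁ ⊕ g₂ ≈ g → sec 3 i weave₃ ≈ g
    terms i e₀ e₁ e₂ e = ≈-trans (sec-cong 3 i expand) (≈-trans (sec-⊕ 3 i _ _)
      (≈-trans (⊕-cong (≈-trans (sec-⊕ 3 i _ _) (⊕-cong e₀ e₁)) e₂) e))

    0<3 = s≤s {0} {2} z≤n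
    1<3 = s≤s {1} {2} (s≤s z≤n)
    2<3 = s≤s {2} {2} (s≤s (s≤s z≤n))

  sec-weave₃-0 : sec 3 0 weave₃ ≈ f₀
  sec-weave₃-0 = terms 0 (sec-X^V 3 0 f₀) (sec-X^V-off 3 0 1 0<3 1<3 (λ ()) f₁)
    (sec-X^V-off 3 0 2 0<3 2<3 (λ ()) f₂) (solve 1 (λ x → x :+ con (+ 0) :+ con (+ 0) := x) ≈-refl f₀)

  sec-weave₃-1 : sec 3 1 weave₃ ≈ f₁
  sec-weave₃-1 = terms 1 (sec-X^V-off 3 1 0 1<3 0<3 (λ ()) f₀) (sec-X^V 3 1 f₁)
    (sec-X^V-off 3 1 2 1<3 2<3 (λ ()) f₂) (solve 1 (λ x → con (+ 0) :+ x :+ con (+ 0) := x) ≈-refl f₁)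

  sec-weave₃-2 : sec 3 2 weave₃ ≈ f₂
  sec-weave₃-2 = terms 2 (sec-X^V-off 3 2 0 2<3 0<3 (λ ()) f₀) (sec-X^V-off 3 2 1 2<3 1<3 (λ ()) f₁)
    (sec-X^V 3 2 f₂) (solve 1 (λ x → con (+ 0) :+ con (+ 0) :+ x := x) ≈-refl f₂)

residue : ∀ k .{{_ : NonZero k}} n → ∃ λ i → i < k × ∃ λ m → n ≡ i + k * m
residue k n = n % k , m%n<n n k , n / k , trans (m≡m%n+[m/n]*n n k) (cong (λ x → n % k + x) (ℕ.*-comm (n / k) k))

≈-by-sec : ∀ k .{{_ : NonZero k}} {f g} → (∀ i → i < k → sec k i f ≈ sec k i g) → f ≈ g
at (≈-by-sec k {f} {g} e) n with residue k n
... | i , i<k , m , refl = at (e i i<k) m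

weave₂-sec : ∀ {f f₀ f₁} → sec 2 0 f ≈ f₀ → sec 2 1 f ≈ f₁ → f ≈ weave₂ f₀ f₁
weave₂-sec {f} {f₀} {f₁} e₀ e₁ = ≈-by-sec 2 λ
  { 0 _ → ≈-trans e₀ (≈-sym (sec-weave₂-0 f₀ f₁))
  ; 1 _ → ≈-trans e₁ (≈-sym (sec-weave₂-1 f₀ f₁))
  ; (suc (suc _)) (s≤s (s≤s ())) }

weave₃-sec : ∀ {f f₀ f₁ f₂} → sec 3 0 f ≈ f₀ → sec 3 1 f ≈ f₁ → sec 3 2 f ≈ f₂ → f ≈ weave₃ f₀ f₁ f₂
weave₃-sec {f} {f₀} {f₁} {f₂} e₀ e₁ e₂ = ≈-by-sec 3 λ
  { 0 _ → ≈-trans e₀ (≈-sym (sec-weave₃-0 f₀ f₁ f₂))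
  ; 1 _ → ≈-trans e₁ (≈-sym (sec-weave₃-1 f₀ f₁ f₂))
  ; 2 _ → ≈-trans e₂ (≈-sym (sec-weave₃-2 f₀ f₁ f₂))
  ; (suc (suc (suc _))) (s≤s (s≤s (s≤s ()))) }

-- If d had a lowest nonzero coefficient, in degree n > 0, then w d(q²) would start in degree 2n or
-- later, while z d has the coefficient z(0) d(n) ≠ 0 in degree n. This is the uniqueness behind all
-- arguments with ratios under q ↦ q².
V2-fixed-vanish : ∀ {d z w} → z 0 ≢ + 0 → d 0 ≡ + 0 → z ⊗ d ≈ w ⊗ V 2 d → d ≈ κ (+ 0)
V2-fixed-vanish {d} {z} {w} z0≢0 d0 e = vanish-by-induction step
  where
  step : ∀ n → (∀ k → k < n → d k ≡ + 0) → d n ≡ + 0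
  step zero    _ = d0
  step (suc n) h = ℤ.*-cancelˡ-≡ (z 0) (d (suc n)) (+ 0) ⦃ ≢-nonZero z0≢0 ⦄
    (trans (sym (⊗-top (suc n) z d h)) (trans (at e (suc n))
      (trans (⊗-at w (V 2 d) (suc n)) (trans (mul-zeroʳ (suc n) w V2d) (sym (ℤ.*-zeroʳ (z 0)))))))
    where
    V2d : ∀ k → k ≤ suc n → V 2 d k ≡ + 0
    V2d k k≤n with 2 ∣? k
    ... | no _                      = refl
    ... | yes (divides zero refl)    = d0
    ... | yes (divides (suc q) refl) = h (suc q) (ℕ.≤-trans (s≤s (s≤s (ℕ.m≤m*n q 2))) k≤n)

-- Products of series and Gauss' identity

≈⟨≤⟩-trans : ∀ {f g h} n → f ≈⟨≤ n ⟩ g → g ≈⟨≤ n ⟩ h → f ≈⟨≤ n ⟩ h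
≈⟨≤⟩-trans n d e k k≤n = trans (d k k≤n) (e k k≤n)

≈⟨≤⟩-sym : ∀ {f g} n → f ≈⟨≤ n ⟩ g → g ≈⟨≤ n ⟩ f
≈⟨≤⟩-sym n d k k≤n = sym (d k k≤n)

≈⟨≤⟩-refl : ∀ {f} n → f ≈⟨≤ n ⟩ f
≈⟨≤⟩-refl n k k≤n = refl

≈⟨≤⟩-weaken : ∀ {f g m n} → m ≤ n → f ≈⟨≤ n ⟩ g → f ≈⟨≤ m ⟩ g
≈⟨≤⟩-weaken m≤n d k k≤m = d k (ℕ.≤-trans k≤m m≤n)

⊕-cong≤ : ∀ n {f f' g g'} → f ≈⟨≤ n ⟩ f' → g ≈⟨≤ n ⟩ g' → f ⊕ g ≈⟨≤ n ⟩ f' ⊕ g'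
⊕-cong≤ n {f} {f'} {g} {g'} d e k k≤n =
  trans (⊕-at f g k) (trans (cong₂ _+ℤ_ (d k k≤n) (e k k≤n)) (sym (⊕-at f' g' k)))

∏ : (ℕ → PS) → ℕ → ℕ → PS
∏ u k zero    = κ (+ 1)
∏ u k (suc m) = u k ⊗ ∏ u (suc k) m

∏-snoc : ∀ u k m → ∏ u k (suc m) ≈ ∏ u k m ⊗ u (k + m)
∏-snoc u k zero rewrite ℕ.+-identityʳ k = solve 1 (λ x → x :* con (+ 1) := con (+ 1) :* x) ≈-refl (u k)
∏-snoc u k (suc m) = begin
  u k ⊗ ∏ u (suc k) (suc m)             ≈⟨ ⊗-cong ≈-refl (∏-snoc u (suc k) m) ⟩
  u k ⊗ (∏ u (suc k) m ⊗ u (suc k + m)) ≈⟨ solve 3 (λ x y z → x :* (y :* z) := x :* y :* z) ≈-refl _ _ _ ⟩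
  u k ⊗ ∏ u (suc k) m ⊗ u (suc k + m)   ≡⟨ cong (λ i → u k ⊗ ∏ u (suc k) m ⊗ u i) (sym (ℕ.+-suc k m)) ⟩
  u k ⊗ ∏ u (suc k) m ⊗ u (k + suc m) ∎
  where open ≈R

∏-⊗ : ∀ u u' k m → ∏ (λ i → u i ⊗ u' i) k m ≈ ∏ u k m ⊗ ∏ u' k m
∏-⊗ u u' k zero    = solve 0 (con (+ 1) := con (+ 1) :* con (+ 1)) ≈-refl
∏-⊗ u u' k (suc m) = ≈-trans (⊗-cong ≈-refl (∏-⊗ u u' (suc k) m))
  (solve 4 (λ a b c d → a :* b :* (c :* d) := a :* c :* (b :* d)) ≈-refl _ _ _ _)

∏-cong : ∀ {u u'} → (∀ i → u i ≈ u' i) → ∀ k m → ∏ u k m ≈ ∏ u' k m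
∏-cong e k zero    = ≈-refl
∏-cong e k (suc m) = ⊗-cong (e k) (∏-cong e (suc k) m)

∏-one : ∀ k m → ∏ (λ _ → κ (+ 1)) k m ≈ κ (+ 1)
∏-one k zero    = ≈-refl
∏-one k (suc m) = ≈-trans (⊗-cong ≈-refl (∏-one (suc k) m)) (solve 0 (con (+ 1) :* con (+ 1) := con (+ 1)) ≈-refl)

V-∏ : ∀ l .{{_ : NonZero l}} u k m → V l (∏ u k m) ≈ ∏ (λ i → V l (u i)) k m
V-∏ l u k zero    = V-κ l (+ 1)
V-∏ l u k (suc m) = ≈-trans (V-⊗ l _ _) (⊗-cong ≈-refl (V-∏ l u (suc k) m))

ν-∏ : ∀ u k m → ν (∏ u k m) ≈ ∏ (λ i → ν (u i)) k m
ν-∏ u k zero    = ν-κ (+ 1)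
ν-∏ u k (suc m) = ≈-trans (ν-⊗ _ _) (⊗-cong ≈-refl (ν-∏ u (suc k) m))

-- Meaningful when u i ≡ 1 mod q^(i+1).
∏∞ : (ℕ → PS) → PS
∏∞ u n = ∏ u 0 (suc n) n

module _ (u : ℕ → PS) (u≈1 : ∀ i → u i ≈⟨≤ i ⟩ κ (+ 1)) where

  ∏-stable : ∀ n j → ∏ u 0 (j + suc n) ≈⟨≤ n ⟩ ∏ u 0 (suc n)
  ∏-stable n zero    = ≈⟨≤⟩-refl n
  ∏-stable n (suc j) = ≈⟨≤⟩-trans n (≡⇒≈⟨≤⟩ n (∏-snoc u 0 (j + suc n))) (≈⟨≤⟩-trans n
    (⊗-cong≤ n (∏-stable n j) (≈⟨≤⟩-weaken (ℕ.≤-trans (ℕ.n≤1+n n) (ℕ.m≤n+m (suc n) j)) (u≈1 (j + suc n))))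
    (≡⇒≈⟨≤⟩ n (solve 1 (λ x → x :* con (+ 1) := x) ≈-refl _)))

  ∏∞-approx : ∀ n m → n < m → ∏∞ u ≈⟨≤ n ⟩ ∏ u 0 m
  ∏∞-approx n m n<m k k≤n = sym (trans
    (cong (λ i → ∏ u 0 i k) (sym (ℕ.m∸n+n≡m (ℕ.≤-trans (s≤s k≤n) n<m))))
    (∏-stable k (m ∸ suc k) k ℕ.≤-refl))

V≈1 : ∀ i k .{{_ : NonZero k}} f → i < k → f 0 ≡ + 1 → V k f ≈⟨≤ i ⟩ κ (+ 1)
V≈1 i k f i<k f0 zero    _   = trans (V-at0 k f) (trans f0 (sym (κ-at0 (+ 1))))
V≈1 i k f i<k f0 (suc n) n≤i = trans (V-off k f (suc n) λ k∣n → ℕ.<⇒≱ (ℕ.≤-trans (s≤s n≤i) i<k) (∣⇒≤ k∣n))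
  (sym (κ-suc (+ 1) n))

-- p = (1+q)/(1-q), w = (1-q)/(1+q) and v = 1/(1+q).
p w v : PS
p zero    = + 1
p (suc n) = + 2
w zero    = + 1
w (suc n) = + 2 *ℤ (- (+ 1)) ^ℤ suc n
v n = (- (+ 1)) ^ℤ n

νp≈w : ν p ≈ w
at νp≈w zero    = refl
at νp≈w (suc n) = ℤ.*-comm ((- (+ 1)) ^ℤ suc n) (+ 2)

v-inverse : (κ (+ 1) ⊕ X) ⊗ v ≈ κ (+ 1)
v-inverse = ≈-trans (solve 2 (λ x v → (con (+ 1) :+ x) :* v := v :+ x :* v) ≈-refl X v) (mk≈ λ
  { zero    → trans (⊕-at _ _ 0) (trans (cong (+ 1 +ℤ_) (X⊗-at0 v)) (sym (κ-at0 (+ 1))))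
  ; (suc n) → trans (⊕-at _ _ (suc n)) (trans (cong (v (suc n) +ℤ_) (X⊗-suc v n))
      (trans (alternate (v n)) (sym (κ-suc (+ 1) n)))) })

w-factor : w ≈ (κ (+ 1) ⊕ ⊖ X) ⊗ v
w-factor = ≈-trans (mk≈ λ
  { zero    → sym (trans (⊕-at _ _ 0) (cong (+ 1 +ℤ_) (trans (⊖-at _ 0) (cong -_ (X⊗-at0 v)))))
  ; (suc n) → sym (trans (⊕-at _ _ (suc n)) (trans (cong (v (suc n) +ℤ_) (trans (⊖-at _ (suc n)) (cong -_ (X⊗-suc v n))))
      (alternate₂ (v n)))) })
  (solve 2 (λ x v → v :- x :* v := (con (+ 1) :- x) :* v) ≈-refl X v)

-- Since w = (1 - q) v and p is its reflection (1 + q) `ν v`, the product regroups into two inverse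
-- pairs.
p⊗w : p ⊗ w ≈ κ (+ 1)
p⊗w = begin
  p ⊗ w                   ≈⟨ ⊗-cong p≈ w-factor ⟩
  ((κ (+ 1) ⊕ X) ⊗ ν v) ⊗ ((κ (+ 1) ⊕ ⊖ X) ⊗ v)
    ≈⟨ solve 3 (λ x a b → ((con (+ 1) :+ x) :* a) :* ((con (+ 1) :- x) :* b) := ((con (+ 1) :- x) :* a) :* ((con (+ 1) :+ x) :* b)) ≈-refl X (ν v) v ⟩
  ((κ (+ 1) ⊕ ⊖ X) ⊗ ν v) ⊗ ((κ (+ 1) ⊕ X) ⊗ v) ≈⟨ ⊗-cong νv-inverse v-inverse ⟩
  κ (+ 1) ⊗ κ (+ 1)       ≈⟨ solve 0 (con (+ 1) :* con (+ 1) := con (+ 1)) ≈-refl ⟩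
  κ (+ 1) ∎
  where
  open ≈R
  νv-inverse : (κ (+ 1) ⊕ ⊖ X) ⊗ ν v ≈ κ (+ 1)
  νv-inverse = begin
    (κ (+ 1) ⊕ ⊖ X) ⊗ ν v     ≈⟨ ⊗-cong (≈-trans (⊕-cong (≈-sym (ν-κ (+ 1))) (≈-sym ν-X)) (≈-sym (ν-⊕ _ _))) ≈-refl ⟩
    ν (κ (+ 1) ⊕ X) ⊗ ν v     ≈⟨ ν-⊗ _ _ ⟨
    ν ((κ (+ 1) ⊕ X) ⊗ v)     ≈⟨ ν-cong v-inverse ⟩
    ν (κ (+ 1))               ≈⟨ ν-κ (+ 1) ⟩
    κ (+ 1) ∎
  p≈ : p ≈ (κ (+ 1) ⊕ X) ⊗ ν v
  p≈ = begin
    p                              ≈⟨ ν-ν p ⟨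
    ν (ν p)                        ≈⟨ ν-cong (≈-trans νp≈w w-factor) ⟩
    ν ((κ (+ 1) ⊕ ⊖ X) ⊗ v)        ≈⟨ ν-⊗ _ _ ⟩
    ν (κ (+ 1) ⊕ ⊖ X) ⊗ ν v        ≈⟨ ⊗-cong (≈-trans (ν-⊕ _ _) (⊕-cong (ν-κ (+ 1)) (≈-trans (ν-⊖ X) (⊖-cong ν-X)))) ≈-refl ⟩
    (κ (+ 1) ⊕ ⊖ ⊖ X) ⊗ ν v        ≈⟨ solve 2 (λ x v → (con (+ 1) :+ :- (:- x)) :* v := (con (+ 1) :+ x) :* v) ≈-refl X (ν v) ⟩
    (κ (+ 1) ⊕ X) ⊗ ν v ∎

-- Shanks' finite form of Gauss' identity Σ (-1)^s q^(s²) = ∏ (1-q^j)/(1+q^j):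
-- the partial sum equals Σ_{0≤s≤n} T s with
-- T s = 2 (-1)^s q^(s(n+1)) / (1+q^s) ∏_{s<j≤n} (1-q^j)/(1+q^j), halved for s = 0.
-- Below, W j and U j belong to the exponent j + 1, T k m is the term s = k + 1 for n = k + 1 + m,
-- D k m is the sum over s ≤ k for n = k + m, and Φ n is the partial sum of the theta series.
W U : ℕ → PS
W j = V (suc j) w
U j = V (suc j) v

U-inverse : ∀ j → (κ (+ 1) ⊕ X^ suc j) ⊗ U j ≈ κ (+ 1)
U-inverse j = begin
  (κ (+ 1) ⊕ X^ suc j) ⊗ U j               ≈⟨ ⊗-cong (⊕-cong (V-κ k (+ 1)) (V-X k)) ≈-refl ⟨
  (V k (κ (+ 1)) ⊕ V k X) ⊗ U j            ≈⟨ ⊗-cong (V-⊕ k _ _) ≈-refl ⟨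
  V k (κ (+ 1) ⊕ X) ⊗ V k v                ≈⟨ V-⊗ k _ _ ⟨
  V k ((κ (+ 1) ⊕ X) ⊗ v)                  ≈⟨ V-cong k v-inverse ⟩
  V k (κ (+ 1))                            ≈⟨ V-κ k (+ 1) ⟩
  κ (+ 1) ∎
  where
  open ≈R
  k = suc j

W-factor : ∀ j → W j ≈ (κ (+ 1) ⊕ ⊖ X^ suc j) ⊗ U j
W-factor j = begin
  V k w                                    ≈⟨ V-cong k w-factor ⟩
  V k ((κ (+ 1) ⊕ ⊖ X) ⊗ v)                ≈⟨ V-⊗ k _ _ ⟩
  V k (κ (+ 1) ⊕ ⊖ X) ⊗ U j                ≈⟨ ⊗-cong (V-⊕ k _ _) ≈-refl ⟩
  (V k (κ (+ 1)) ⊕ V k (⊖ X)) ⊗ U j        ≈⟨ ⊗-cong (⊕-cong (V-κ k (+ 1)) (≈-trans (V-⊖ k X) (⊖-cong (V-X k)))) ≈-refl ⟩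
  (κ (+ 1) ⊕ ⊖ X^ suc j) ⊗ U j ∎
  where
  open ≈R
  k = suc j

σ : ℕ → PS
σ zero    = κ (+ 2)
σ (suc k) = ⊖ σ k

T : ℕ → ℕ → PS
T k m = X^ (suc k * (suc k + suc m)) ⊗ (σ (suc k) ⊗ U k ⊗ ∏ W (suc k) m)

D : ℕ → ℕ → PS
D zero    m = ∏ W 0 m
D (suc k) m = D k (suc m) ⊕ T k m

Φ : ℕ → PS
Φ zero    = κ (+ 1)
Φ (suc n) = Φ n ⊕ σ (suc n) ⊗ X^ (suc n * suc n)

X^-≡ : ∀ {m n} → m ≡ n → X^ m ≈ X^ n
X^-≡ refl = ≈-refl

-- When n grows by one, the changes of the terms with s ≤ k telescope in s and leave a single closed
-- term; the induction on `k` absorbs one more s.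
D-step : ∀ k m → D k (suc m) ⊕ X^ (suc k * (suc k + m)) ⊗ (σ k ⊗ U (k + m) ⊗ ∏ W k m) ≈ D k m
D-step zero m = begin
  ∏ W 0 (suc m) ⊕ X^ (suc m + 0) ⊗ (κ (+ 2) ⊗ U m ⊗ r)
    ≈⟨ ⊕-cong (≈-trans (∏-snoc W 0 m) (⊗-cong ≈-refl (W-factor m))) (⊗-cong (X^-≡ (ℕ.+-identityʳ (suc m))) ≈-refl) ⟩
  r ⊗ ((κ (+ 1) ⊕ ⊖ X^ suc m) ⊗ U m) ⊕ X^ (suc m) ⊗ (κ (+ 2) ⊗ U m ⊗ r)
    ≈⟨ solve 3 (λ r x u → r :* ((con (+ 1) :- x) :* u) :+ x :* (con (+ 2) :* u :* r) := r :* ((con (+ 1) :+ x) :* u)) ≈-refl r (X^ suc m) (U m) ⟩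
  r ⊗ ((κ (+ 1) ⊕ X^ suc m) ⊗ U m)
    ≈⟨ ⊗-cong ≈-refl (U-inverse m) ⟩
  r ⊗ κ (+ 1)
    ≈⟨ solve 1 (λ r → r :* con (+ 1) := r) ≈-refl r ⟩
  r ∎
  where
  open ≈R
  r = ∏ W 0 m
D-step (suc k) m = begin
  D k (suc (suc m)) ⊕ T k (suc m) ⊕ X^ (suc (suc k) * n) ⊗ (⊖ s ⊗ U (suc k + m) ⊗ r)
    ≈⟨ ⊕-cong (⊕-cong ≈-refl (⊗-cong xz (⊗-cong ≈-refl (≈-trans (∏-snoc W (suc k) m) (⊗-cong ≈-refl (W-factor (suc k + m)))))))
         (⊗-cong (X^-+ n (suc k * n)) ≈-refl) ⟩
  D k (suc (suc m)) ⊕ z ⊗ x ⊗ (⊖ s ⊗ a ⊗ (r ⊗ ((κ (+ 1) ⊕ ⊖ y) ⊗ b))) ⊕ y ⊗ z ⊗ (⊖ s ⊗ b ⊗ r)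
    -- Here a = 1/(1 + x) and b = 1/(1 + y). Apart from the common summand, clearing both
    -- denominators turns either side into (-x - y) z s r; the chosen multiples of the two inverse
    -- relations do this clearing.
    ≈⟨ lc (⊕-cong (⊗-cong (≈-refl {z ⊗ s ⊗ r ⊗ b ⊗ y}) (U-inverse k)) (⊗-cong (≈-refl {z ⊗ s ⊗ r ⊗ a}) (≈-sym (U-inverse (suc k + m)))))
          (solve 8 (λ d z x s a r y b →
             (d :+ z :* x :* (:- s :* a :* (r :* ((con (+ 1) :- y) :* b))) :+ y :* z :* (:- s :* b :* r))
               :+ (z :* s :* r :* b :* y :* con (+ 1) :+ z :* s :* r :* a :* ((con (+ 1) :+ y) :* b))
             := (d :+ z :* (s :* b :* (((con (+ 1) :- x) :* a) :* r)) :+ z :* (:- s :* a :* r))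
               :+ (z :* s :* r :* b :* y :* ((con (+ 1) :+ x) :* a) :+ z :* s :* r :* a :* con (+ 1)))
             ≈-refl (D k (suc (suc m))) z x s a r y b) ⟩
  D k (suc (suc m)) ⊕ z ⊗ (s ⊗ b ⊗ (((κ (+ 1) ⊕ ⊖ x) ⊗ a) ⊗ r)) ⊕ z ⊗ (⊖ s ⊗ a ⊗ r)
    ≈⟨ ⊕-cong (⊕-cong ≈-refl (⊗-cong (X^-≡ (cong (suc k *_) (sym (ℕ.+-suc (suc k) m)))) (⊗-cong (⊗-cong ≈-refl b≡) (⊗-cong (≈-sym (W-factor k)) ≈-refl))))
         (⊗-cong (X^-≡ (cong (suc k *_) (sym (ℕ.+-suc (suc k) m)))) ≈-refl) ⟩
  D k (suc (suc m)) ⊕ X^ (suc k * (suc k + suc m)) ⊗ (s ⊗ U (k + suc m) ⊗ (W k ⊗ r)) ⊕ T k m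
    ≈⟨ ⊕-cong (D-step k (suc m)) ≈-refl ⟩
  D k (suc m) ⊕ T k m ∎
  where
  open ≈R
  n = suc (suc k) + m
  s = σ k
  r = ∏ W (suc k) m
  x = X^ suc k
  y = X^ n
  z = X^ (suc k * n)
  a = U k
  b = U (suc k + m)
  b≡ : b ≈ U (k + suc m)
  b≡ = ≈≡ (cong U (sym (ℕ.+-suc k m)))
    where
    ≈≡ : ∀ {f g : PS} → f ≡ g → f ≈ g
    ≈≡ refl = ≈-refl
  xz : X^ (suc k * (suc k + suc (suc m))) ≈ z ⊗ x
  xz = ≈-trans (X^-≡ (((∀ k m → (1 + k) * (1 + k + (2 + m)) ≡ (1 + k) * (2 + k + m) + (1 + k)) ∋ ℕ-Ring.solve-∀) k m))
      (X^-+ (suc k * n) (suc k))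

-- The correction from `D-step` and the new term s = n + 1 share the denominator 1 + y, with y =
-- q^(n+1), and have numerators in the ratio 1 : y. It cancels in their sum, which leaves the next
-- term of the theta series.
D-diagonal : ∀ n → D n 0 ≈ Φ n
D-diagonal zero    = ≈-refl
D-diagonal (suc n) = begin
  D n 1 ⊕ T n 0
    ≈⟨ ⊕-cong ≈-refl t ⟩
  D n 1 ⊕ x ⊗ y ⊗ (⊖ s ⊗ u)
    ≈⟨ lc (⊕-cong step (⊗-cong (≈-refl {s ⊗ x}) (≈-sym (U-inverse n))))
         (solve 6 (λ d₁ d₀ s x y u →
            (d₁ :+ x :* y :* (:- s :* u)) :+ (d₀ :+ s :* x :* ((con (+ 1) :+ y) :* u))
            := (d₀ :+ :- s :* x) :+ ((d₁ :+ x :* (s :* u)) :+ s :* x :* con (+ 1)))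
          ≈-refl (D n 1) (D n 0) s x y u) ⟩
  D n 0 ⊕ ⊖ s ⊗ x
    ≈⟨ ⊕-cong (D-diagonal n) ≈-refl ⟩
  Φ n ⊕ ⊖ s ⊗ x ∎
  where
  open ≈R
  s = σ n
  x = X^ (suc n * suc n)
  y = X^ (suc n)
  u = U n
  reindex : ∀ i → i ≡ n → X^ (suc n * suc i) ⊗ (s ⊗ U i ⊗ κ (+ 1)) ≈ x ⊗ (s ⊗ u)
  reindex _ refl = solve 3 (λ x s u → x :* (s :* u :* con (+ 1)) := x :* (s :* u)) ≈-refl x s u
  step : D n 1 ⊕ x ⊗ (s ⊗ u) ≈ D n 0
  step = ≈-trans (⊕-cong ≈-refl (≈-sym (reindex (n + 0) (ℕ.+-identityʳ n)))) (D-step n 0)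
  t : T n 0 ≈ x ⊗ y ⊗ (⊖ s ⊗ u)
  t = ⊗-cong (≈-trans (X^-≡ (((∀ n → (1 + n) * (1 + n + 1) ≡ (1 + n) * (1 + n) + (1 + n)) ∋ ℕ-Ring.solve-∀) n)) (X^-+ (suc n * suc n) (suc n)))
        (solve 2 (λ s u → :- s :* u :* con (+ 1) := :- s :* u) ≈-refl s u)

-- The term with index s ≥ 1 is divisible by q^(s(n+1)), so only the product for s = 0 is visible
-- modulo q^(n+1).
D-approx : ∀ k m → D k m ≈⟨≤ k + m ⟩ ∏ W 0 (k + m)
D-approx zero    m = ≈⟨≤⟩-refl m
D-approx (suc k) m i i≤ = begin
  (D k (suc m) ⊕ T k m) i        ≡⟨ ⊕-at _ _ i ⟩
  D k (suc m) i +ℤ T k m i       ≡⟨ cong₂ _+ℤ_ (D-approx k (suc m) i (subst (i ≤_) (sym (ℕ.+-suc k m)) i≤))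
                                      (X^⊗-below (suc k * (suc k + suc m)) _ i
                                        (ℕ.≤-trans (s≤s i≤) (ℕ.≤-trans (ℕ.≤-reflexive (sym (ℕ.+-suc (suc k) m))) (ℕ.m≤n*m _ (suc k))))) ⟩
  ∏ W 0 (k + suc m) i +ℤ + 0     ≡⟨ ℤ.+-identityʳ _ ⟩
  ∏ W 0 (k + suc m) i            ≡⟨ cong (λ j → ∏ W 0 j i) (ℕ.+-suc k m) ⟩
  ∏ W 0 (suc (k + m)) i ∎
  where open ≡-Reasoning

Φ-approx : ∀ n → Φ n ≈⟨≤ n ⟩ ∏ W 0 n
Φ-approx n i i≤n = trans (sym (at (D-diagonal n) i))
  (subst (λ j → i ≤ j → D n 0 i ≡ ∏ W 0 j i) (ℕ.+-identityʳ n) (D-approx n 0 i) i≤n)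

-- Theta functions and their dissections

IsSquare : ℕ → Set
IsSquare n = ∃ λ s → s * s ≡ n

root≤ : ∀ s → s ≤ s * s
root≤ zero    = z≤n
root≤ (suc s) = ℕ.m≤m*n (suc s) (suc s)

isSquare? : ∀ n → Dec (IsSquare n)
isSquare? n = map′ (λ (s , _ , e) → s , e) (λ { (s , refl) → s , s≤s (root≤ s) , refl })
  (ℕ.anyUpTo? (λ s → s * s ℕ.≟ n) (suc n))

□ : ℕ → ℤ
□ n with isSquare? n
... | yes _ = + 1
... | no  _ = + 0

□-yes : ∀ {n} → IsSquare n → □ n ≡ + 1
□-yes {n} sq with isSquare? n
... | yes _  = refl
... | no ¬sq = ⊥-elim (¬sq sq)

□-no : ∀ {n} → ¬ IsSquare n → □ n ≡ + 0
□-no {n} ¬sq with isSquare? n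
... | yes sq = ⊥-elim (¬sq sq)
... | no  _  = refl

□-cong : ∀ {m n} → (IsSquare m → IsSquare n) → (IsSquare n → IsSquare m) → □ m ≡ □ n
□-cong {m} f g with isSquare? m
... | yes sq = sym (□-yes (f sq))
... | no ¬sq = sym (□-no λ sq → ¬sq (g sq))

NonResidue : ∀ k .{{_ : NonZero k}} → ℕ → Set
NonResidue k r = ∀ {i} → i < k → ¬ (i * i) % k ≡ r % k

nonResidue? : ∀ k .{{_ : NonZero k}} r → Dec (NonResidue k r)
nonResidue? k r = ℕ.allUpTo? (λ i → ¬? ((i * i) % k ℕ.≟ r % k)) k

-- The implicit `True` argument is discharged by evaluating the finite table of squares modulo `k`;
-- each use then supplies only the residue of `m`.
□-nonresidue : ∀ k .{{_ : NonZero k}} r {_ : True (nonResidue? k r)} n → ∀ {m} → m ≡ r + k * n → □ m ≡ + 0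
□-nonresidue k r {nr} n {m} m≡ = □-no λ { (s , e) → toWitness nr (m%n<n s k) (begin
  ((s % k) * (s % k)) % k ≡⟨ %-distribˡ-* s s k ⟨
  (s * s) % k             ≡⟨ cong (_% k) (trans e (trans m≡ (cong (λ x → r + x) (ℕ.*-comm k n)))) ⟩
  (r + n * k) % k         ≡⟨ [m+kn]%n≡m%n r n k ⟩
  r % k ∎) }
  where open ≡-Reasoning

□-4* : ∀ n {m} → m ≡ 4 * n → □ m ≡ □ n
□-4* n refl = □-cong down λ { (t , refl) → 2 * t , ((∀ t → 2 * t * (2 * t) ≡ 4 * (t * t)) ∋ ℕ-Ring.solve-∀) t }
  where
  down : IsSquare (4 * n) → IsSquare n
  down (s , e) with residue 2 s
  ... | 0 , _ , t , refl = t , ℕ.*-cancelˡ-≡ _ _ 4 (trans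
        (((∀ t → 4 * (t * t) ≡ 2 * t * (2 * t)) ∋ ℕ-Ring.solve-∀) t) e)
  ... | 1 , _ , t , refl = ⊥-elim (0≢1 (trans (sym ([m+kn]%n≡m%n 0 (2 * n) 2)) (trans (cong (_% 2) (trans
        (((∀ n → 2 * n * 2 ≡ 4 * n) ∋ ℕ-Ring.solve-∀) n) (trans (sym e)
        (((∀ t → (1 + 2 * t) * (1 + 2 * t) ≡ 1 + (2 * (t + t * t)) * 2) ∋ ℕ-Ring.solve-∀) t))))
        ([m+kn]%n≡m%n 1 (2 * (t + t * t)) 2))))
    where
    0≢1 : ¬ 0 ≡ 1
    0≢1 ()
  ... | suc (suc _) , s≤s (s≤s ()) , _

□-9* : ∀ n {m} → m ≡ 9 * n → □ m ≡ □ n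
□-9* n refl = □-cong down λ { (t , refl) → 3 * t , ((∀ t → 3 * t * (3 * t) ≡ 9 * (t * t)) ∋ ℕ-Ring.solve-∀) t }
  where
  0≢1 : ¬ 0 ≡ 1
  0≢1 ()
  multiple : ∀ x → 9 * n ≡ 1 + x * 3 → ⊥
  multiple x e = 0≢1 (trans (sym ([m+kn]%n≡m%n 0 (3 * n) 3)) (trans (cong (_% 3) (trans
    (((∀ n → 3 * n * 3 ≡ 9 * n) ∋ ℕ-Ring.solve-∀) n) e)) ([m+kn]%n≡m%n 1 x 3)))
  down : IsSquare (9 * n) → IsSquare n
  down (s , e) with residue 3 s
  ... | 0 , _ , t , refl = t , ℕ.*-cancelˡ-≡ _ _ 9 (trans
        (((∀ t → 9 * (t * t) ≡ 3 * t * (3 * t)) ∋ ℕ-Ring.solve-∀) t) e)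
  ... | 1 , _ , t , refl = ⊥-elim (multiple (2 * t + 3 * (t * t)) (trans (sym e)
        (((∀ t → (1 + 3 * t) * (1 + 3 * t) ≡ 1 + (2 * t + 3 * (t * t)) * 3) ∋ ℕ-Ring.solve-∀) t)))
  ... | 2 , _ , t , refl = ⊥-elim (multiple (1 + 4 * t + 3 * (t * t)) (trans (sym e)
        (((∀ t → (2 + 3 * t) * (2 + 3 * t) ≡ 1 + (1 + 4 * t + 3 * (t * t)) * 3) ∋ ℕ-Ring.solve-∀) t)))
  ... | suc (suc (suc _)) , s≤s (s≤s (s≤s ())) , _

-- Ramanujan's φ(q) = Σ q^(n²) over n ∈ ℤ and ψ(q) = Σ q^(n(n+1)/2) over n ≥ 0
-- (m is triangular iff 8m+1 is a square); θ = φ(-q).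
φ ψ θ : PS
φ zero    = + 1
φ (suc n) = + 2 *ℤ □ (suc n)
ψ n = □ (1 + 8 * n)
θ = ν φ

-- The sections of φ and ψ that are not theta functions of the same kind:
-- a⁺ = f(q,q⁵), a = f(-q,-q⁵) and A = f(q,q²) in Ramanujan's notation.
a⁺ a A : PS
a⁺ n = □ (1 + 3 * n)
a = ν a⁺
A n = □ (1 + 24 * n)

V2-by-sec : ∀ {f g} → sec 2 0 f ≈ g → sec 2 1 f ≈ κ (+ 0) → f ≈ V 2 g
V2-by-sec {f} {g} e₀ e₁ = ≈-trans (weave₂-sec e₀ e₁)
  (≈-trans (⊕-cong ≈-refl (⊗-cong ≈-refl (V-κ 2 (+ 0)))) (solve 2 (λ x y → y :+ x :* con (+ 0) := y) ≈-refl X (V 2 g)))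

V3-by-sec : ∀ {f g} → sec 3 0 f ≈ g → sec 3 1 f ≈ κ (+ 0) → sec 3 2 f ≈ κ (+ 0) → f ≈ V 3 g
V3-by-sec {f} {g} e₀ e₁ e₂ = ≈-trans (weave₃-sec e₀ e₁ e₂)
  (≈-trans (⊕-cong (⊕-cong ≈-refl (⊗-cong ≈-refl (V-κ 3 (+ 0)))) (⊗-cong ≈-refl (V-κ 3 (+ 0))))
    (solve 2 (λ x y → y :+ x :* con (+ 0) :+ x :* x :* con (+ 0) := y) ≈-refl X (V 3 g)))

zero-by : ∀ {f} → (∀ n → f n ≡ + 0) → f ≈ κ (+ 0)
zero-by e = mk≈ λ n → trans (e n) (sym (κ0-at n))

twice-zero : ∀ {x} → x ≡ + 0 → + 2 *ℤ x ≡ + 0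
twice-zero refl = refl

sec20φ : sec 2 0 φ ≈ V 2 φ
sec20φ = V2-by-sec
  (mk≈ λ { zero → refl ; (suc n) → cong (+ 2 *ℤ_) (□-4* (suc n) (lit n)) })
  (zero-by λ n → twice-zero (□-nonresidue 4 2 n (((∀ n → 2 * (1 + 2 * n) ≡ 2 + 4 * n) ∋ ℕ-Ring.solve-∀) n)))
  where
  lit : ∀ n → 2 * (2 * suc n) ≡ 4 * suc n
  lit n = sym (ℕ.*-assoc 2 2 (suc n))

sec21φ : sec 2 1 φ ≈ κ (+ 2) ⊗ V 2 (V 2 ψ)
sec21φ = ≈-trans (mk≈ λ n → sym (κ⊗-at (+ 2) (λ n → □ (1 + 2 * n)) n)) (⊗-cong ≈-refl (V2-by-sec
  (V2-by-sec
    (mk≈ λ n → cong □ (((∀ n → 1 + 2 * (2 * (2 * n)) ≡ 1 + 8 * n) ∋ ℕ-Ring.solve-∀) n))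
    (zero-by λ n → □-nonresidue 8 5 n (((∀ n → 1 + 2 * (2 * (1 + 2 * n)) ≡ 5 + 8 * n) ∋ ℕ-Ring.solve-∀) n)))
  (zero-by λ n → □-nonresidue 4 3 n (((∀ n → 1 + 2 * (1 + 2 * n) ≡ 3 + 4 * n) ∋ ℕ-Ring.solve-∀) n))))

-- Even squares are four times a square; odd ones are 8t + 1 with t triangular, whence ψ(q⁸).
φ-dissection₂ : φ ≈ V 2 (V 2 φ) ⊕ κ (+ 2) ⊗ X ⊗ V 2 (V 2 (V 2 ψ))
φ-dissection₂ = ≈-trans (weave₂-sec sec20φ sec21φ) (≈-trans
  (⊕-cong ≈-refl (⊗-cong ≈-refl (V-κ⊗ 2 (+ 2) _)))
  (solve 3 (λ x u y → u :+ x :* (con (+ 2) :* y) := u :+ con (+ 2) :* x :* y) ≈-refl X _ _))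

-- Squares are 0 or 1 modulo 3, and those divisible by 3 are nine times a square, whence φ(q⁹).
φ-dissection₃ : φ ≈ V 3 (V 3 φ) ⊕ κ (+ 2) ⊗ X ⊗ V 3 a⁺
φ-dissection₃ = ≈-trans (weave₃-sec
  (V3-by-sec
    (mk≈ λ { zero → refl ; (suc n) → cong (+ 2 *ℤ_) (□-9* (suc n) (sym (ℕ.*-assoc 3 3 (suc n)))) })
    (zero-by λ n → twice-zero (□-nonresidue 9 3 n (((∀ n → 3 * (1 + 3 * n) ≡ 3 + 9 * n) ∋ ℕ-Ring.solve-∀) n)))
    (zero-by λ n → twice-zero (□-nonresidue 9 6 n (((∀ n → 3 * (2 + 3 * n) ≡ 6 + 9 * n) ∋ ℕ-Ring.solve-∀) n))))
  (mk≈ λ n → sym (κ⊗-at (+ 2) a⁺ n))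
  (zero-by λ n → twice-zero (□-nonresidue 3 2 n refl)))
  (≈-trans (⊕-cong (⊕-cong ≈-refl (⊗-cong ≈-refl (V-κ⊗ 3 (+ 2) _))) (⊗-cong ≈-refl (V-κ 3 (+ 0))))
    (solve 3 (λ x u y → u :+ x :* (con (+ 2) :* y) :+ x :* x :* con (+ 0) := u :+ con (+ 2) :* x :* y) ≈-refl X _ _))

-- As 8n + 1 ≡ 1 - n mod 3, the class n ≡ 2 is empty, and n ≡ 1 makes the square divisible by 9.
ψ-dissection₃ : ψ ≈ V 3 A ⊕ X ⊗ V 3 (V 3 ψ)
ψ-dissection₃ = ≈-trans (weave₃-sec
  (mk≈ λ n → cong □ (((∀ n → 1 + 8 * (3 * n) ≡ 1 + 24 * n) ∋ ℕ-Ring.solve-∀) n))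
  (V3-by-sec
    (mk≈ λ n → □-9* (1 + 8 * n) (((∀ n → 1 + 8 * (1 + 3 * (3 * n)) ≡ 9 * (1 + 8 * n)) ∋ ℕ-Ring.solve-∀) n))
    (zero-by λ n → □-nonresidue 9 6 (3 + 8 * n) (((∀ n → 1 + 8 * (1 + 3 * (1 + 3 * n)) ≡ 6 + 9 * (3 + 8 * n)) ∋ ℕ-Ring.solve-∀) n))
    (zero-by λ n → □-nonresidue 9 3 (6 + 8 * n) (((∀ n → 1 + 8 * (1 + 3 * (2 + 3 * n)) ≡ 3 + 9 * (6 + 8 * n)) ∋ ℕ-Ring.solve-∀) n)))
  (zero-by λ n → □-nonresidue 3 2 (5 + 8 * n) (((∀ n → 1 + 8 * (2 + 3 * n) ≡ 2 + 3 * (5 + 8 * n)) ∋ ℕ-Ring.solve-∀) n)))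
  (≈-trans (⊕-cong ≈-refl (⊗-cong ≈-refl (V-κ 3 (+ 0))))
    (solve 3 (λ x u y → u :+ x :* y :+ x :* x :* con (+ 0) := u :+ x :* y) ≈-refl X _ _))

-- For even n the square 3n + 1 is odd, hence 1 modulo 8, so that 8 divides n. For odd n it is
-- divisible by 4, so that n ≡ 1 mod 4, and division by 4 leads back to `a⁺`.
a⁺-dissection₂ : a⁺ ≈ V 2 (V 2 (V 2 A)) ⊕ X ⊗ V 2 (V 2 a⁺)
a⁺-dissection₂ = weave₂-sec
  (V2-by-sec
    (V2-by-sec
      (mk≈ λ n → cong □ (((∀ n → 1 + 3 * (2 * (2 * (2 * n))) ≡ 1 + 24 * n) ∋ ℕ-Ring.solve-∀) n))
      (zero-by λ n → □-nonresidue 8 5 (1 + 3 * n) (((∀ n → 1 + 3 * (2 * (2 * (1 + 2 * n))) ≡ 5 + 8 * (1 + 3 * n)) ∋ ℕ-Ring.solve-∀) n)))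
    (zero-by λ n → □-nonresidue 4 3 (1 + 3 * n) (((∀ n → 1 + 3 * (2 * (1 + 2 * n)) ≡ 3 + 4 * (1 + 3 * n)) ∋ ℕ-Ring.solve-∀) n)))
  (V2-by-sec
    (mk≈ λ n → □-4* (1 + 3 * n) (((∀ n → 1 + 3 * (1 + 2 * (2 * n)) ≡ 4 * (1 + 3 * n)) ∋ ℕ-Ring.solve-∀) n))
    (zero-by λ n → □-nonresidue 4 2 (2 + 3 * n) (((∀ n → 1 + 3 * (1 + 2 * (1 + 2 * n)) ≡ 2 + 4 * (2 + 3 * n)) ∋ ℕ-Ring.solve-∀) n)))

-- The theta series as the limit of its partial sums

σ-value : ∀ s → σ s ≈ κ (+ 2 *ℤ (- (+ 1)) ^ℤ s)
σ-value zero    = ≈-refl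
σ-value (suc s) = ≈-trans (⊖-cong (σ-value s)) (≈-trans (≈-sym (κ-neg _))
  (mk≈ λ n → cong (λ c → κ c n) (neg-two ((- (+ 1)) ^ℤ s))))

term-hit : ∀ s m → (σ s ⊗ X^ m) m ≡ + 2 *ℤ (- (+ 1)) ^ℤ s
term-hit s m = begin
  (σ s ⊗ X^ m) m          ≡⟨ at (solve 2 (λ x y → x :* y := y :* x) ≈-refl (σ s) (X^ m)) m ⟩
  (X^ m ⊗ σ s) m          ≡⟨ cong (X^ m ⊗ σ s) (sym (ℕ.+-identityʳ m)) ⟩
  (X^ m ⊗ σ s) (m + 0)    ≡⟨ X^⊗-at m (σ s) 0 ⟩
  σ s 0                   ≡⟨ at (σ-value s) 0 ⟩
  κ (+ 2 *ℤ (- (+ 1)) ^ℤ s) 0 ≡⟨ κ-at0 _ ⟩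
  + 2 *ℤ (- (+ 1)) ^ℤ s ∎
  where open ≡-Reasoning

term-miss : ∀ s m k → m ≢ k → (σ s ⊗ X^ m) k ≡ + 0
term-miss s m k m≢k with X^-split m k
... | inj₁ k<m = trans (at (solve 2 (λ x y → x :* y := y :* x) ≈-refl (σ s) (X^ m)) k) (X^⊗-below m (σ s) k k<m)
... | inj₂ (zero  , refl) = ⊥-elim (m≢k (sym (ℕ.+-identityʳ m)))
... | inj₂ (suc j , refl) = trans (at (solve 2 (λ x y → x :* y := y :* x) ≈-refl (σ s) (X^ m)) (m + suc j))
        (trans (X^⊗-at m (σ s) (suc j)) (trans (at (σ-value s) (suc j)) (κ-suc _ j)))

Φ-miss : ∀ n k → (∀ s → s ≤ n → s * s ≢ k) → Φ n k ≡ + 0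
Φ-miss zero    zero    h = ⊥-elim (h 0 z≤n refl)
Φ-miss zero    (suc k) h = κ-suc (+ 1) k
Φ-miss (suc n) k       h = trans (⊕-at _ _ k) (cong₂ _+ℤ_
  (Φ-miss n k λ s s≤n → h s (ℕ.m≤n⇒m≤1+n s≤n))
  (term-miss (suc n) (suc n * suc n) k (h (suc n) ℕ.≤-refl)))

-- `Φ` carries the sign (-1)^s, while `θ`, being a reflection, carries (-1)^(s²).
sign-square : ∀ s → (- (+ 1)) ^ℤ (s * s) ≡ (- (+ 1)) ^ℤ s
sign-square zero    = refl
sign-square (suc t) = begin
  (- (+ 1)) ^ℤ (suc t + t * suc t)                     ≡⟨ ℤ.^-distribˡ-+-* (- (+ 1)) (suc t) (t * suc t) ⟩
  (- (+ 1)) ^ℤ suc t *ℤ (- (+ 1)) ^ℤ (t * suc t)       ≡⟨ cong ((- (+ 1)) ^ℤ suc t *ℤ_) (pronic t) ⟩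
  (- (+ 1)) ^ℤ suc t *ℤ + 1                            ≡⟨ ℤ.*-identityʳ _ ⟩
  (- (+ 1)) ^ℤ suc t ∎
  where
  open ≡-Reasoning
  pronic : ∀ t → (- (+ 1)) ^ℤ (t * suc t) ≡ + 1
  pronic zero    = refl
  pronic (suc t) = begin
    (- (+ 1)) ^ℤ (suc t * suc (suc t))                    ≡⟨ cong ((- (+ 1)) ^ℤ_) (((∀ t → (1 + t) * (2 + t) ≡ 2 * (1 + t) + t * (1 + t)) ∋ ℕ-Ring.solve-∀) t) ⟩
    (- (+ 1)) ^ℤ (2 * suc t + t * suc t)                  ≡⟨ ℤ.^-distribˡ-+-* (- (+ 1)) (2 * suc t) (t * suc t) ⟩
    (- (+ 1)) ^ℤ (2 * suc t) *ℤ (- (+ 1)) ^ℤ (t * suc t)  ≡⟨ cong₂ _*ℤ_ (sign-even (suc t)) (pronic t) ⟩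
    + 1 ∎

Φ-hit : ∀ n s → s ≤ n → Φ n (s * s) ≡ θ (s * s)
Φ-hit zero    zero    z≤n = trans (κ-at0 (+ 1)) refl
Φ-hit (suc n) s       s≤1+n with ℕ.m≤n⇒m<n∨m≡n s≤1+n
... | inj₁ (s≤s s≤n) = trans (⊕-at _ _ (s * s)) (trans (cong₂ _+ℤ_ (Φ-hit n s s≤n)
        (term-miss (suc n) (suc n * suc n) (s * s) λ e → ℕ.<⇒≢ (ℕ.*-mono-< (s≤s s≤n) (s≤s s≤n)) (sym e)))
        (ℤ.+-identityʳ _))
... | inj₂ refl = begin
  (Φ n ⊕ σ s ⊗ X^ (s * s)) (s * s)             ≡⟨ ⊕-at _ _ (s * s) ⟩
  Φ n (s * s) +ℤ (σ s ⊗ X^ (s * s)) (s * s)    ≡⟨ cong₂ _+ℤ_ (Φ-miss n (s * s) λ t t≤n e → ℕ.<⇒≢ (ℕ.*-mono-< (s≤s t≤n) (s≤s t≤n)) e)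
                                                    (term-hit s (s * s)) ⟩
  + 0 +ℤ + 2 *ℤ (- (+ 1)) ^ℤ s                 ≡⟨ ℤ.+-identityˡ _ ⟩
  + 2 *ℤ (- (+ 1)) ^ℤ s                        ≡⟨ ℤ.*-comm (+ 2) ((- (+ 1)) ^ℤ s) ⟩
  (- (+ 1)) ^ℤ s *ℤ + 2                        ≡⟨ cong₂ _*ℤ_ (sign-square s) (cong (+ 2 *ℤ_) (□-yes (s , refl))) ⟨
  (- (+ 1)) ^ℤ (s * s) *ℤ (+ 2 *ℤ □ (s * s)) ∎
  where open ≡-Reasoning

θ-approx : ∀ n → θ ≈⟨≤ n ⟩ Φ n
θ-approx n k k≤n with isSquare? k
... | yes (s , refl) = sym (Φ-hit n s (ℕ.≤-trans (root≤ s) k≤n))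
... | no ¬sq = trans (zeros k ¬sq) (sym (Φ-miss n k λ s _ e → ¬sq (s , e)))
  where
  zeros : ∀ k → ¬ IsSquare k → θ k ≡ + 0
  zeros zero    ¬sq = ⊥-elim (¬sq (0 , refl))
  zeros (suc k) ¬sq = trans (cong (λ x → (- (+ 1)) ^ℤ suc k *ℤ (+ 2 *ℤ x)) (□-no ¬sq)) (ℤ.*-zeroʳ ((- (+ 1)) ^ℤ suc k))

θ-product : ∀ n m → n ≤ m → θ ≈⟨≤ n ⟩ ∏ W 0 m
θ-product n m n≤m = ≈⟨≤⟩-weaken n≤m (≈⟨≤⟩-trans m (θ-approx m) (Φ-approx m))

-- Gauss' identity in the limit, and its reflection

podd wodd : ℕ → PS
podd i = V (suc (2 * i)) p
wodd i = V (suc (2 * i)) w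

odd-bound : ∀ i → i < suc (2 * i)
odd-bound i = s≤s (ℕ.m≤m+n i (i + 0))

podd≈1 : ∀ i → podd i ≈⟨≤ i ⟩ κ (+ 1)
podd≈1 i = V≈1 i (suc (2 * i)) p (odd-bound i) refl

P : PS
P = ∏∞ podd

podd⊗wodd : ∀ i → podd i ⊗ wodd i ≈ κ (+ 1)
podd⊗wodd i = ≈-trans (≈-sym (V-⊗ k p w)) (≈-trans (V-cong k p⊗w) (V-κ k (+ 1)))
  where k = suc (2 * i)

V-≡ : ∀ {k l} .{{_ : NonZero k}} .{{_ : NonZero l}} f → k ≡ l → V k f ≈ V l f
V-≡ f refl = ≈-refl

-- Among the exponents up to 2m, the odd ones cancel against `podd` because p w = 1, and the even
-- ones form the product in q².
gauss-finite : ∀ m → ∏ W 0 (m + m) ⊗ ∏ podd 0 m ≈ V 2 (∏ W 0 m)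
gauss-finite zero    = ≈-trans (solve 0 (con (+ 1) :* con (+ 1) := con (+ 1)) ≈-refl) (≈-sym (V-κ 2 (+ 1)))
gauss-finite (suc m) = begin
  ∏ W 0 (suc m + suc m) ⊗ ∏ podd 0 (suc m)
    ≈⟨ ⊗-cong (≈-trans (≡⇒≈ (cong (∏ W 0) (ℕ.+-suc (suc m) m))) (≈-trans (∏-snoc W 0 (suc (m + m))) (⊗-cong (∏-snoc W 0 (m + m)) ≈-refl)))
         (∏-snoc podd 0 m) ⟩
  ∏ W 0 (m + m) ⊗ W (m + m) ⊗ W (suc (m + m)) ⊗ (∏ podd 0 m ⊗ podd m)
    ≈⟨ ⊗-cong (⊗-cong (⊗-cong ≈-refl (V-≡ w (cong suc 2m))) double) ≈-refl ⟩
  ∏ W 0 (m + m) ⊗ wodd m ⊗ V 2 (W m) ⊗ (∏ podd 0 m ⊗ podd m)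
    ≈⟨ solve 5 (λ g x y h z → g :* x :* y :* (h :* z) := g :* h :* y :* (z :* x)) ≈-refl _ _ _ _ _ ⟩
  ∏ W 0 (m + m) ⊗ ∏ podd 0 m ⊗ V 2 (W m) ⊗ (podd m ⊗ wodd m)
    ≈⟨ ⊗-cong (⊗-cong (gauss-finite m) ≈-refl) (podd⊗wodd m) ⟩
  V 2 (∏ W 0 m) ⊗ V 2 (W m) ⊗ κ (+ 1)
    ≈⟨ solve 2 (λ x y → x :* y :* con (+ 1) := x :* y) ≈-refl _ _ ⟩
  V 2 (∏ W 0 m) ⊗ V 2 (W m)
    ≈⟨ V-⊗ 2 _ _ ⟨
  V 2 (∏ W 0 m ⊗ W m)
    ≈⟨ V-cong 2 (∏-snoc W 0 m) ⟨
  V 2 (∏ W 0 (suc m)) ∎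
  where
  open ≈R
  ≡⇒≈ : ∀ {f g : PS} → f ≡ g → f ≈ g
  ≡⇒≈ refl = ≈-refl
  2m : m + m ≡ 2 * m
  2m = cong (λ x → m + x) (sym (ℕ.+-identityʳ m))
  double : W (suc (m + m)) ≈ V 2 (W m)
  double = ≈-trans (V-≡ {suc (suc (m + m))} {2 * suc m} w
      (((∀ m → 2 + (m + m) ≡ 2 * (1 + m)) ∋ ℕ-Ring.solve-∀) m))
    (≈-sym (V-V 2 (suc m) w))

≈-from-≤ : ∀ {f g} → (∀ n → f ≈⟨≤ n ⟩ g) → f ≈ g
≈-from-≤ e = mk≈ λ n → e n n ℕ.≤-refl

gauss : θ ⊗ P ≈ V 2 θ
gauss = ≈-from-≤ λ n →
  ≈⟨≤⟩-trans n (⊗-cong≤ n (θ-product n (suc n + suc n) (ℕ.≤-trans (ℕ.n≤1+n n) (ℕ.m≤m+n (suc n) (suc n)))) (∏∞-approx podd podd≈1 n (suc n) ℕ.≤-refl))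
  (≈⟨≤⟩-trans n (≡⇒≈⟨≤⟩ n (gauss-finite (suc n)))
    (≈⟨≤⟩-sym n (V-cong≤ 2 n (θ-product n (suc n) (ℕ.n≤1+n n)))))

-- For odd j, the reflection turns p(q^j) into its inverse w(q^j).
P⊗νP : P ⊗ ν P ≈ κ (+ 1)
P⊗νP = ≈-from-≤ λ n →
  let approx = ∏∞-approx podd podd≈1 n (suc n) ℕ.≤-refl in
  ≈⟨≤⟩-trans n (⊗-cong≤ n approx (ν-cong≤ n approx)) (≡⇒≈⟨≤⟩ n (begin
    ∏ podd 0 (suc n) ⊗ ν (∏ podd 0 (suc n))           ≈⟨ ⊗-cong ≈-refl (ν-∏ podd 0 (suc n)) ⟩
    ∏ podd 0 (suc n) ⊗ ∏ (λ i → ν (podd i)) 0 (suc n) ≈⟨ ∏-⊗ podd _ 0 (suc n) ⟨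
    ∏ (λ i → podd i ⊗ ν (podd i)) 0 (suc n)           ≈⟨ ∏-cong cancel 0 (suc n) ⟩
    ∏ (λ _ → κ (+ 1)) 0 (suc n)                       ≈⟨ ∏-one 0 (suc n) ⟩
    κ (+ 1) ∎))
  where
  open ≈R
  cancel : ∀ i → podd i ⊗ ν (podd i) ≈ κ (+ 1)
  cancel i = ≈-trans (⊗-cong ≈-refl (≈-trans (ν-V-odd i p) (V-cong (suc (2 * i)) νp≈w))) (podd⊗wodd i)

-- The product of `gauss` with its own reflection, in which `P` and `ν P` cancel.
φ⊗θ : φ ⊗ θ ≈ V 2 θ ⊗ V 2 θ
φ⊗θ = begin
  φ ⊗ θ                         ≈⟨ solve 2 (λ x y → x :* y := x :* y :* con (+ 1)) ≈-refl φ θ ⟩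
  φ ⊗ θ ⊗ κ (+ 1)               ≈⟨ ⊗-cong ≈-refl P⊗νP ⟨
  φ ⊗ θ ⊗ (P ⊗ ν P)             ≈⟨ solve 4 (λ x y a b → x :* y :* (a :* b) := y :* a :* (x :* b)) ≈-refl φ θ P (ν P) ⟩
  θ ⊗ P ⊗ (φ ⊗ ν P)             ≈⟨ ⊗-cong gauss φνP ⟩
  V 2 θ ⊗ V 2 θ ∎
  where
  open ≈R
  φνP : φ ⊗ ν P ≈ V 2 θ
  φνP = begin
    φ ⊗ ν P     ≈⟨ ⊗-cong (ν-ν φ) ≈-refl ⟨
    ν θ ⊗ ν P   ≈⟨ ν-⊗ θ P ⟨
    ν (θ ⊗ P)   ≈⟨ ν-cong gauss ⟩
    ν (V 2 θ)   ≈⟨ ν-V2 θ ⟩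
    V 2 θ ∎

P⊗V2θ : P ⊗ V 2 θ ≈ φ
P⊗V2θ = begin
  P ⊗ V 2 θ      ≈⟨ ⊗-cong ≈-refl (≈-trans (≈-sym (ν-V2 θ)) (≈-trans (ν-cong (≈-sym gauss)) (ν-⊗ θ P))) ⟩
  P ⊗ (ν θ ⊗ ν P) ≈⟨ solve 3 (λ a t b → a :* (t :* b) := t :* (a :* b)) ≈-refl P (ν θ) (ν P) ⟩
  ν θ ⊗ (P ⊗ ν P) ≈⟨ ⊗-cong (ν-ν φ) P⊗νP ⟩
  φ ⊗ κ (+ 1)    ≈⟨ solve 1 (λ x → x :* con (+ 1) := x) ≈-refl φ ⟩
  φ ∎
  where open ≈R

-- The generating function and its agreement with `S9bar`

Sfac : ℕ → PS
Sfac i = podd i ⊗ V (suc (18 * i + 8)) w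

S : PS
S = ∏∞ Sfac

-- Each factor w(q^(9j)) of `S` is inverse to the factor p(q^(9j)) of P(q⁹), for j odd.
S⊗V9P : S ⊗ V 3 (V 3 P) ≈ P
S⊗V9P = ≈-from-≤ λ n →
  let approx = ∏∞-approx podd podd≈1 n (suc n) ℕ.≤-refl in
  ≈⟨≤⟩-trans n (⊗-cong≤ n (∏∞-approx Sfac Sfac≈1 n (suc n) ℕ.≤-refl) (V-cong≤ 3 n (V-cong≤ 3 n approx)))
  (≈⟨≤⟩-trans n (≡⇒≈⟨≤⟩ n (begin
    ∏ Sfac 0 (suc n) ⊗ V 3 (V 3 (∏ podd 0 (suc n)))
      ≈⟨ ⊗-cong ≈-refl (≈-trans (V-cong 3 (V-∏ 3 podd 0 (suc n))) (V-∏ 3 _ 0 (suc n))) ⟩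
    ∏ Sfac 0 (suc n) ⊗ ∏ (λ i → V 3 (V 3 (podd i))) 0 (suc n)
      ≈⟨ ∏-⊗ Sfac _ 0 (suc n) ⟨
    ∏ (λ i → Sfac i ⊗ V 3 (V 3 (podd i))) 0 (suc n)
      ≈⟨ ∏-cong cancel 0 (suc n) ⟩
    ∏ podd 0 (suc n) ∎))
  (≈⟨≤⟩-sym n approx))
  where
  open ≈R
  Sfac≈1 : ∀ i → Sfac i ≈⟨≤ i ⟩ κ (+ 1)
  Sfac≈1 i = ≈⟨≤⟩-trans i (⊗-cong≤ i (podd≈1 i)
    (V≈1 i (suc (18 * i + 8)) w (s≤s (ℕ.≤-trans (ℕ.m≤n*m i 18) (ℕ.m≤m+n (18 * i) 8))) refl))
    (≡⇒≈⟨≤⟩ i (solve 0 (con (+ 1) :* con (+ 1) := con (+ 1)) ≈-refl))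
  cancel : ∀ i → Sfac i ⊗ V 3 (V 3 (podd i)) ≈ podd i
  cancel i = begin
    podd i ⊗ V k w ⊗ V 3 (V 3 (podd i))
      ≈⟨ ⊗-cong ≈-refl (≈-trans (V-cong 3 (V-V 3 (suc (2 * i)) p)) (≈-trans (V-V 3 (3 * suc (2 * i)) p)
           (V-≡ {3 * (3 * suc (2 * i))} {k} p
             (((∀ i → 3 * (3 * (1 + 2 * i)) ≡ 1 + (18 * i + 8)) ∋ ℕ-Ring.solve-∀) i)))) ⟩
    podd i ⊗ V k w ⊗ V k p      ≈⟨ solve 3 (λ x a b → x :* a :* b := x :* (b :* a)) ≈-refl (podd i) (V k w) (V k p) ⟩
    podd i ⊗ (V k p ⊗ V k w)    ≈⟨ ⊗-cong ≈-refl (≈-trans (≈-sym (V-⊗ k p w)) (≈-trans (V-cong k p⊗w) (V-κ k (+ 1)))) ⟩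
    podd i ⊗ κ (+ 1)            ≈⟨ solve 1 (λ x → x :* con (+ 1) := x) ≈-refl (podd i) ⟩
    podd i ∎
    where k = suc (18 * i + 8)

coeff-map : ∀ g M {h : ℕ → ℕ} k → k < M → coeff (map g (applyUpTo h M)) k ≡ g (h k)
coeff-map g (suc M) zero    _         = refl
coeff-map g (suc M) (suc k) (s≤s k<M) = coeff-map g M k k<M

sum-mul : ∀ c f k → sumℤ (applyUpTo (λ i → c i *ℤ f (k ∸ i)) (suc k)) ≡ mul c f k
sum-mul c f zero    = ℤ.+-identityʳ _
sum-mul c f (suc k) = cong (c 0 *ℤ f (suc k) +ℤ_) (sum-mul (tail c) f k)

coeff-mulBy : ∀ N s {g} f f' → coeff s ≈⟨≤ N ⟩ g → f ≈ f' → coeff (mulBy N s f) ≈⟨≤ N ⟩ g ⊗ f'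
coeff-mulBy N s {g} f f' s≈g f≈f' k k≤N = begin
  coeff (mulBy N s f) k                         ≡⟨ coeff-map (λ j → sumℤ (map (summand j) (upTo (suc j)))) (suc N) {id} k (s≤s k≤N) ⟩
  sumℤ (map (summand k) (upTo (suc k)))         ≡⟨ cong sumℤ (map-applyUpTo id (summand k) (suc k)) ⟩
  sumℤ (applyUpTo (summand k) (suc k))          ≡⟨ sum-mul (coeff s) f k ⟩
  mul (coeff s) f k                             ≡⟨ ⊗-at (coeff s) f k ⟨
  (coeff s ⊗ f) k                               ≡⟨ ⊗-cong≤ N s≈g (≡⇒≈⟨≤⟩ N f≈f') k k≤N ⟩
  (g ⊗ f') k ∎
  where
  open ≡-Reasoning
  summand : ℕ → ℕ → ℤ
  summand j i = coeff s i *ℤ f (j ∸ i)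

facA-V : ∀ m → facA m ≈ V (suc m) p
facA-V m = ≈-sym (V-spec (suc m) on off)
  where
  on : ∀ n → facA m (suc m * n) ≡ p n
  on zero rewrite ℕ.*-zeroʳ m = refl
  on (suc n) with (suc m * suc n) % suc m ℕ.≟ 0
  ... | yes _  = refl
  ... | no ≢0  = ⊥-elim (≢0 (n∣m⇒m%n≡0 (suc m * suc n) (suc m) (m∣m*n (suc n))))
  off : ∀ n → ¬ suc m ∣ℕ n → facA m n ≡ + 0
  off zero    ∤ = ⊥-elim (∤ (divides 0 refl))
  off (suc n) ∤ with suc n % suc m ℕ.≟ 0
  ... | yes ≡0 = ⊥-elim (∤ (m%n≡0⇒n∣m (suc n) (suc m) ≡0))
  ... | no _   = refl

facB-V : ∀ m → facB m ≈ V (suc m) w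
facB-V m = ≈-sym (V-spec (suc m) on off)
  where
  on : ∀ n → facB m (suc m * n) ≡ w n
  on zero rewrite ℕ.*-zeroʳ m = refl
  on (suc n) with (suc m * suc n) % suc m ℕ.≟ 0
  ... | yes _  = cong (λ j → + 2 *ℤ (- (+ 1)) ^ℤ j)
                   (trans (cong (_/ suc m) (ℕ.*-comm (suc m) (suc n))) (m*n/n≡m (suc n) (suc m)))
  ... | no ≢0  = ⊥-elim (≢0 (n∣m⇒m%n≡0 (suc m * suc n) (suc m) (m∣m*n (suc n))))
  off : ∀ n → ¬ suc m ∣ℕ n → facB m n ≡ + 0
  off zero    ∤ = ⊥-elim (∤ (divides 0 refl))
  off (suc n) ∤ with suc n % suc m ℕ.≟ 0
  ... | yes ≡0 = ⊥-elim (∤ (m%n≡0⇒n∣m (suc n) (suc m) ≡0))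
  ... | no _   = refl

coeff-one : ∀ N → coeff (one N) ≈⟨≤ N ⟩ κ (+ 1)
coeff-one N zero    _         = sym (κ-at0 (+ 1))
coeff-one N (suc k) k<N       = trans (coeff-map _ N {suc} k k<N) (sym (κ-suc (+ 1) k))

-- Stated for `applyUpTo h`, because the tail of `upTo` is not an `upTo`; `j` records where the list
-- starts.
coeff-foldr : ∀ N j M (h : ℕ → ℕ) → (∀ i → h i ≡ j + i) →
              coeff (foldr (mulFactor N) (one N) (applyUpTo h M)) ≈⟨≤ N ⟩ ∏ Sfac j M
coeff-foldr N j zero    h e = coeff-one N
coeff-foldr N j (suc M) h e rewrite trans (e 0) (ℕ.+-identityʳ j) = ≈⟨≤⟩-trans N
  (coeff-mulBy N (mulBy N rest (facA (2 * j))) (facB (18 * j + 8)) (V (suc (18 * j + 8)) w)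
    (coeff-mulBy N rest (facA (2 * j)) (podd j)
      (coeff-foldr N (suc j) M (h ∘ suc) λ i → trans (e (suc i)) (ℕ.+-suc j i))
      (facA-V (2 * j)))
    (facB-V (18 * j + 8)))
  (≡⇒≈⟨≤⟩ N (solve 3 (λ x a b → x :* a :* b := a :* b :* x) ≈-refl (∏ Sfac (suc j) M) (podd j) (V (suc (18 * j + 8)) w)))
  where rest = foldr (mulFactor N) (one N) (applyUpTo (h ∘ suc) M)

-- The n + 1 factors in `series n` are exactly those by which `∏∞` defines its coefficient of q^n,
-- so the two agree by unfolding.
S9bar≡S : ∀ n → S9bar n ≡ S n
S9bar≡S n = coeff-foldr n 0 (suc n) id (λ i → refl) n ℕ.≤-refl

-- Identities between theta functions

record Hom (h : PS → PS) : Set where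
  field
    hom-cong : ∀ {f g} → f ≈ g → h f ≈ h g
    hom-⊕    : ∀ f g → h (f ⊕ g) ≈ h f ⊕ h g
    hom-⊗    : ∀ f g → h (f ⊗ g) ≈ h f ⊗ h g
    hom-⊖    : ∀ f → h (⊖ f) ≈ ⊖ h f
    hom-κ    : ∀ c → h (κ c) ≈ κ c

V-isHom : ∀ k .{{_ : NonZero k}} → Hom (V k)
V-isHom k = record { hom-cong = V-cong k ; hom-⊕ = V-⊕ k ; hom-⊗ = V-⊗ k ; hom-⊖ = V-⊖ k ; hom-κ = V-κ k }

ν-isHom : Hom ν
ν-isHom = record { hom-cong = ν-cong ; hom-⊕ = ν-⊕ ; hom-⊗ = ν-⊗ ; hom-⊖ = ν-⊖ ; hom-κ = ν-κ }

close : ∀ n → N-ary n (Polynomial n) (Polynomial n) → Polynomial n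
close n f = f $ⁿ Vec.map var (allFin n)

module _ {h : PS → PS} (H : Hom h) where
  open Hom H

  private
    eval : ∀ {n} (p : Polynomial n) {ρ ρ'} → Pointwise (λ x y → h x ≈ y) ρ ρ' → h (⟦ p ⟧ ρ) ≈ ⟦ p ⟧ ρ'
    eval (op [+] p₁ p₂) e = ≈-trans (hom-⊕ _ _) (⊕-cong (eval p₁ e) (eval p₂ e))
    eval (op [*] p₁ p₂) e = ≈-trans (hom-⊗ _ _) (⊗-cong (eval p₁ e) (eval p₂ e))
    eval (con c)        e = hom-κ c
    eval (var i)        e = pointwise e i
    eval (p :^ zero)    e = hom-κ (+ 1)
    eval (p :^ suc m)   e = ≈-trans (hom-⊗ _ _) (⊗-cong (eval p e) (eval (p :^ m) e))
    eval (:- p)         e = ≈-trans (hom-⊖ _) (⊖-cong (eval p e))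

  -- A ring endomorphism commutes with every polynomial expression. Reusing the syntax of the ring
  -- solver lets a substitution be pushed through a whole expression at once, given its effect on
  -- the variables.
  hom : ∀ n (f : N-ary n (Polynomial n) (Polynomial n)) {ρ ρ'} →
        Pointwise (λ x y → h x ≈ y) ρ ρ' → h (⟦ close n f ⟧ ρ) ≈ ⟦ close n f ⟧ ρ'
  hom n f = eval (close n f)

V₂ = hom (V-isHom 2)
V₃ = hom (V-isHom 3)
νʰ = hom ν-isHom

record Unit (f : PS) : Set where
  constructor unit
  field at0 : f 0 ≡ + 1
open Unit

unit-⊗ : ∀ {f g} → Unit f → Unit g → Unit (f ⊗ g)
at0 (unit-⊗ {f} {g} uf ug) = trans (⊗-at0 f g) (cong₂ _*ℤ_ (at0 uf) (at0 ug))

unit-↑ : ∀ {f} n → Unit f → Unit (f ↑ n)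
unit-↑ zero    uf = unit (κ-at0 (+ 1))
unit-↑ (suc n) uf = unit-⊗ uf (unit-↑ n uf)

unit-V : ∀ k .{{_ : NonZero k}} {f} → Unit f → Unit (V k f)
at0 (unit-V k {f} uf) = trans (V-at0 k f) (at0 uf)

unit-ν : ∀ {f} → Unit f → Unit (ν f)
at0 (unit-ν {f} uf) = trans (ℤ.*-identityˡ (f 0)) (at0 uf)

unit-cong : ∀ {f g} → f ≈ g → Unit g → Unit f
at0 (unit-cong e ug) = trans (at e 0) (at0 ug)

unit≢0 : ∀ {f} → Unit f → f 0 ≢ + 0
unit≢0 uf f0≡0 with trans (sym (at0 uf)) f0≡0
... | ()

unit-cancel : ∀ {g h} f → Unit f → f ⊗ g ≈ f ⊗ h → g ≈ h
unit-cancel f uf = ⊗-cancelˡ f (unit≢0 uf)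

κ-cancel : ∀ {g h} n → κ (+ suc n) ⊗ g ≈ κ (+ suc n) ⊗ h → g ≈ h
κ-cancel n = ⊗-cancelˡ (κ (+ suc n)) λ e → nonzero (trans (sym (κ-at0 (+ suc n))) e)
  where
  nonzero : ¬ + suc n ≡ + 0
  nonzero ()

-- x/y is fixed by q ↦ q², hence constant.
V2-ratio-fixed : ∀ {x y} → Unit x → Unit y → x ⊗ V 2 y ≈ y ⊗ V 2 x → x ≈ y
V2-ratio-fixed {x} {y} ux uy e = ⊖-vanish (V2-fixed-vanish {x ⊕ ⊖ y} {V 2 y} {y}
  (unit≢0 (unit-V 2 uy))
  (trans (⊕-at x _ 0) (cong₂ _+ℤ_ (at0 ux) (trans (⊖-at y 0) (cong -_ (at0 uy)))))
  (≈-trans (lc e (solve 4 (λ x y x' y' → y' :* (x :- y) :+ y :* x' := y :* (x' :- y') :+ x :* y') ≈-refl x y (V 2 x) (V 2 y)))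
    (⊗-cong ≈-refl (≈-sym (V₂ 2 (λ x y → x :- y) (≈-refl ∷ ≈-refl ∷ []))))))

-- r = x/y satisfies r(q)² = r(q²), which forces r = 1.
V2-ratio-square : ∀ {x y m} → Unit x → Unit y → x ↑ 2 ≈ m ⊗ V 2 x → y ↑ 2 ≈ m ⊗ V 2 y → x ≈ y
V2-ratio-square {x} {y} {m} ux uy ex ey = ⊖-vanish (V2-fixed-vanish {x ⊕ ⊖ y} {(x ⊕ y) ⊗ V 2 y} {y ↑ 2}
  z≢0
  (trans (⊕-at x _ 0) (cong₂ _+ℤ_ (at0 ux) (trans (⊖-at y 0) (cong -_ (at0 uy)))))
  -- Both x² y(q²) and y² x(q²) equal m x(q²) y(q²), so (x² - y²) y(q²) = y² (x(q²) - y(q²)), the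
  -- form that `V2-fixed-vanish` takes.
  (≈-trans (lc (⊕-cong (⊗-cong (≈-refl {V 2 y}) ex) (⊗-cong (≈-refl {V 2 x}) (≈-sym ey)))
     (solve 5 (λ x y x' y' m → (x :+ y) :* y' :* (x :- y) :+ (y' :* (m :* x') :+ x' :* (y :^ 2))
         := y :^ 2 :* (x' :- y') :+ (y' :* (x :^ 2) :+ x' :* (m :* y'))) ≈-refl x y (V 2 x) (V 2 y) m))
    (⊗-cong ≈-refl (≈-sym (V₂ 2 (λ x y → x :- y) (≈-refl ∷ ≈-refl ∷ []))))))
  where
  z≢0 : ((x ⊕ y) ⊗ V 2 y) 0 ≢ + 0
  z≢0 e with trans (sym (trans (⊗-at0 _ _) (cong₂ _*ℤ_ (trans (⊕-at x y 0) (cong₂ _+ℤ_ (at0 ux) (at0 uy))) (at0 (unit-V 2 uy))))) e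
  ... | ()

weave₃-injective : ∀ {f₀ f₁ f₂ g₀ g₁ g₂} → weave₃ f₀ f₁ f₂ ≈ weave₃ g₀ g₁ g₂ → f₀ ≈ g₀ × f₁ ≈ g₁ × f₂ ≈ g₂
weave₃-injective {f₀} {f₁} {f₂} {g₀} {g₁} {g₂} e =
    ≈-trans (≈-sym (sec-weave₃-0 f₀ f₁ f₂)) (≈-trans (sec-cong 3 0 e) (sec-weave₃-0 g₀ g₁ g₂))
  , ≈-trans (≈-sym (sec-weave₃-1 f₀ f₁ f₂)) (≈-trans (sec-cong 3 1 e) (sec-weave₃-1 g₀ g₁ g₂))
  , ≈-trans (≈-sym (sec-weave₃-2 f₀ f₁ f₂)) (≈-trans (sec-cong 3 2 e) (sec-weave₃-2 g₀ g₁ g₂))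

V3-V2 : ∀ f → V 3 (V 2 f) ≈ V 2 (V 3 f)
V3-V2 f = ≈-trans (V-V 3 2 f) (≈-sym (V-V 2 3 f))

-- Relations from dissecting quadratic identities

φ₃ θ₃ ψ₃ : PS
φ₃ = V 3 φ
θ₃ = V 3 θ
ψ₃ = V 3 ψ

θ-dissection₃ : θ ≈ V 3 θ₃ ⊕ ⊖ (κ (+ 2) ⊗ X ⊗ V 3 a)
θ-dissection₃ = ≈-trans (ν-cong φ-dissection₃) (≈-trans
  (νʰ 3 (λ u x y → u :+ con (+ 2) :* x :* y)
    (≈-trans (ν-V3 φ₃) (V-cong 3 (ν-V3 φ)) ∷ ν-X ∷ ν-V3 a⁺ ∷ []))
  (solve 3 (λ u x y → u :+ con (+ 2) :* (:- x) :* y := u :- con (+ 2) :* x :* y) ≈-refl _ _ _))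

θ-dissection₂ : θ ≈ V 2 (V 2 φ) ⊕ ⊖ (κ (+ 2) ⊗ X ⊗ V 2 (V 2 (V 2 ψ)))
θ-dissection₂ = ≈-trans (ν-cong φ-dissection₂) (≈-trans
  (νʰ 3 (λ u x y → u :+ con (+ 2) :* x :* y) (ν-V2 _ ∷ ν-X ∷ ν-V2 _ ∷ []))
  (solve 3 (λ u x y → u :+ con (+ 2) :* (:- x) :* y := u :- con (+ 2) :* x :* y) ≈-refl _ _ _))

a-dissection₂ : a ≈ V 2 (V 2 (V 2 A)) ⊕ ⊖ (X ⊗ V 2 (V 2 a⁺))
a-dissection₂ = ≈-trans (ν-cong a⁺-dissection₂) (≈-trans
  (νʰ 3 (λ u x y → u :+ x :* y) (ν-V2 _ ∷ ν-X ∷ ν-V2 _ ∷ []))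
  (solve 3 (λ u x y → u :+ (:- x) :* y := u :- x :* y) ≈-refl _ _ _))

νa : ν a ≈ a⁺
νa = ν-ν a⁺

νθ : ν θ ≈ φ
νθ = ν-ν φ

νθ₃ : ν θ₃ ≈ φ₃
νθ₃ = ≈-trans (ν-V3 θ) (V-cong 3 νθ)

-- Computes φ(q)² - φ(-q)² in two ways. The 2-dissections give 8q φ(q⁴) ψ(q⁸). Dissecting φ(q) φ(-q)
-- = φ(-q²)² and halving exponents gives φ(-q)² = φ(q²)² - 4q ψ(q⁴)², hence with its reflection 8q
-- ψ(q⁴)².
ψ² : ψ ↑ 2 ≈ φ ⊗ V 2 ψ
ψ² = V-injective 2 (V-injective 2 (begin
  V 2 (V 2 (ψ ↑ 2))                 ≈⟨ V-cong 2 (V₂ 1 (λ x → x :^ 2) (≈-refl ∷ [])) ⟩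
  V 2 (V 2 ψ ↑ 2)                   ≈⟨ V₂ 1 (λ x → x :^ 2) (≈-refl ∷ []) ⟩
  V 2 (V 2 ψ) ↑ 2                   ≈⟨ X⊗-cancel (κ-cancel 7 scaled) ⟩
  V 2 (V 2 φ) ⊗ V 2 (V 2 (V 2 ψ))   ≈⟨ V₂ 2 (λ x y → x :* y) (≈-refl ∷ ≈-refl ∷ []) ⟨
  V 2 (V 2 φ ⊗ V 2 (V 2 ψ))         ≈⟨ V-cong 2 (V₂ 2 (λ x y → x :* y) (≈-refl ∷ ≈-refl ∷ [])) ⟨
  V 2 (V 2 (φ ⊗ V 2 ψ)) ∎))
  where
  open ≈R
  e = V 2 (V 2 φ)
  o = V 2 (V 2 (V 2 ψ))
  θ² : V 2 φ ↑ 2 ⊕ ⊖ (κ (+ 4) ⊗ X ⊗ V 2 (V 2 ψ) ↑ 2) ≈ θ ↑ 2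
  θ² = V-injective 2 (begin
    V 2 (V 2 φ ↑ 2 ⊕ ⊖ (κ (+ 4) ⊗ X ⊗ V 2 (V 2 ψ) ↑ 2))
      ≈⟨ V₂ 3 (λ u x y → u :^ 2 :- con (+ 4) :* x :* y :^ 2) (≈-refl ∷ V-X 2 ∷ ≈-refl ∷ []) ⟩
    e ↑ 2 ⊕ ⊖ (κ (+ 4) ⊗ (X ⊗ X) ⊗ o ↑ 2)
      ≈⟨ solve 3 (λ e x o → e :^ 2 :- con (+ 4) :* (x :* x) :* o :^ 2 := (e :+ con (+ 2) :* x :* o) :* (e :- con (+ 2) :* x :* o)) ≈-refl e X o ⟩
    (e ⊕ κ (+ 2) ⊗ X ⊗ o) ⊗ (e ⊕ ⊖ (κ (+ 2) ⊗ X ⊗ o))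
      ≈⟨ ⊗-cong φ-dissection₂ θ-dissection₂ ⟨
    φ ⊗ θ
      ≈⟨ φ⊗θ ⟩
    V 2 θ ⊗ V 2 θ
      ≈⟨ solve 1 (λ x → x :* x := x :^ 2) ≈-refl _ ⟩
    V 2 θ ↑ 2
      ≈⟨ V₂ 1 (λ x → x :^ 2) (≈-refl ∷ []) ⟨
    V 2 (θ ↑ 2) ∎)
  φ² : V 2 φ ↑ 2 ⊕ κ (+ 4) ⊗ X ⊗ V 2 (V 2 ψ) ↑ 2 ≈ φ ↑ 2
  φ² = begin
    V 2 φ ↑ 2 ⊕ κ (+ 4) ⊗ X ⊗ V 2 (V 2 ψ) ↑ 2
      ≈⟨ solve 3 (λ u x y → u :^ 2 :+ con (+ 4) :* x :* y :^ 2 := u :^ 2 :- con (+ 4) :* (:- x) :* y :^ 2) ≈-refl _ _ _ ⟩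
    V 2 φ ↑ 2 ⊕ ⊖ (κ (+ 4) ⊗ (⊖ X) ⊗ V 2 (V 2 ψ) ↑ 2)
      ≈⟨ νʰ 3 (λ u x y → u :^ 2 :- con (+ 4) :* x :* y :^ 2) (ν-V2 _ ∷ ν-X ∷ ν-V2 _ ∷ []) ⟨
    ν (V 2 φ ↑ 2 ⊕ ⊖ (κ (+ 4) ⊗ X ⊗ V 2 (V 2 ψ) ↑ 2))
      ≈⟨ ν-cong θ² ⟩
    ν (θ ↑ 2)
      ≈⟨ νʰ 1 (λ x → x :^ 2) (νθ ∷ []) ⟩
    φ ↑ 2 ∎
  scaled : κ (+ 8) ⊗ (X ⊗ V 2 (V 2 ψ) ↑ 2) ≈ κ (+ 8) ⊗ (X ⊗ (e ⊗ o))
  scaled = begin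
    κ (+ 8) ⊗ (X ⊗ V 2 (V 2 ψ) ↑ 2)
      ≈⟨ solve 3 (λ u x y → con (+ 8) :* (x :* y :^ 2) := (u :^ 2 :+ con (+ 4) :* x :* y :^ 2) :- (u :^ 2 :- con (+ 4) :* x :* y :^ 2)) ≈-refl (V 2 φ) X _ ⟩
    _ ≈⟨ ⊕-cong φ² (⊖-cong θ²) ⟩
    φ ↑ 2 ⊕ ⊖ (θ ↑ 2)
      ≈⟨ ⊕-cong (↑-congˡ 2 φ-dissection₂) (⊖-cong (↑-congˡ 2 θ-dissection₂)) ⟩
    (e ⊕ κ (+ 2) ⊗ X ⊗ o) ↑ 2 ⊕ ⊖ ((e ⊕ ⊖ (κ (+ 2) ⊗ X ⊗ o)) ↑ 2)
      ≈⟨ solve 3 (λ e x o → (e :+ con (+ 2) :* x :* o) :^ 2 :- (e :- con (+ 2) :* x :* o) :^ 2 := con (+ 8) :* (x :* (e :* o))) ≈-refl e X o ⟩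
    κ (+ 8) ⊗ (X ⊗ (e ⊗ o)) ∎

unit-φ : Unit φ
unit-φ = unit refl

unit-θ : Unit θ
unit-θ = unit-ν unit-φ

unit-ψ : Unit ψ
unit-ψ = unit (□-yes (1 , refl))

unit-a⁺ : Unit a⁺
unit-a⁺ = unit (□-yes (1 , refl))

unit-a : Unit a
unit-a = unit-ν unit-a⁺

unit-A : Unit A
unit-A = unit (□-yes (1 , refl))

square-unit-cancel : ∀ {f g} → Unit f → Unit g → f ↑ 2 ≈ g ↑ 2 → f ≈ g
square-unit-cancel {f} {g} uf ug e = square-cancel (at0 uf) (at0 ug)
  (≈-trans (solve 1 (λ x → x :* x := x :^ 2) ≈-refl f) (≈-trans e (solve 1 (λ x → x :^ 2 := x :* x) ≈-refl g)))

-- Its square is `ψ²` times the reflection of `ψ²`, evaluated by `φ⊗θ`.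
ψ⊗νψ : ψ ⊗ ν ψ ≈ V 2 θ ⊗ V 2 ψ
ψ⊗νψ = square-unit-cancel (unit-⊗ unit-ψ (unit-ν unit-ψ)) (unit-⊗ (unit-V 2 unit-θ) (unit-V 2 unit-ψ)) (begin
  (ψ ⊗ ν ψ) ↑ 2                   ≈⟨ solve 2 (λ x y → (x :* y) :^ 2 := x :^ 2 :* y :^ 2) ≈-refl ψ (ν ψ) ⟩
  ψ ↑ 2 ⊗ ν ψ ↑ 2                 ≈⟨ ⊗-cong ψ² (≈-trans (≈-sym (νʰ 1 (λ x → x :^ 2) (≈-refl ∷ []))) (≈-trans (ν-cong ψ²)
                                       (νʰ 2 (λ x y → x :* y) (≈-refl ∷ ν-V2 ψ ∷ [])))) ⟩
  φ ⊗ V 2 ψ ⊗ (θ ⊗ V 2 ψ)         ≈⟨ solve 3 (λ f t p → f :* p :* (t :* p) := f :* t :* p :^ 2) ≈-refl φ θ (V 2 ψ) ⟩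
  φ ⊗ θ ⊗ V 2 ψ ↑ 2               ≈⟨ ⊗-cong φ⊗θ ≈-refl ⟩
  V 2 θ ⊗ V 2 θ ⊗ V 2 ψ ↑ 2       ≈⟨ solve 2 (λ t p → t :* t :* p :^ 2 := (t :* p) :^ 2) ≈-refl (V 2 θ) (V 2 ψ) ⟩
  (V 2 θ ⊗ V 2 ψ) ↑ 2 ∎)
  where open ≈R

X³ : V 3 X ≈ X ⊗ (X ⊗ X)
X³ = V-X 3

X² : V 2 X ≈ X ⊗ X
X² = V-X 2

-- Both sides dissect φ(q) φ(-q) = φ(-q²)² modulo 3, so each class yields a relation. On the right
-- q⁴ = q q³ falls into class 1, which explains the factor `X` there.
φ⊗θ-weave : weave₃ (φ₃ ⊗ θ₃) (κ (+ 2) ⊗ (a⁺ ⊗ θ₃ ⊕ ⊖ (a ⊗ φ₃))) (⊖ (κ (+ 4) ⊗ (a ⊗ a⁺)))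
          ≈ weave₃ (V 2 θ₃ ↑ 2) (κ (+ 4) ⊗ (X ⊗ V 2 a ↑ 2)) (⊖ (κ (+ 4) ⊗ (V 2 a ⊗ V 2 θ₃)))
φ⊗θ-weave = begin
  weave₃ (φ₃ ⊗ θ₃) (κ (+ 2) ⊗ (a⁺ ⊗ θ₃ ⊕ ⊖ (a ⊗ φ₃))) (⊖ (κ (+ 4) ⊗ (a ⊗ a⁺)))
    ≈⟨ ⊕-cong (⊕-cong
         (V₃ 2 (λ c d → c :* d) (≈-refl ∷ ≈-refl ∷ []))
         (⊗-cong ≈-refl (V₃ 4 (λ c d a a⁺ → con (+ 2) :* (a⁺ :* d :- a :* c)) (≈-refl ∷ ≈-refl ∷ ≈-refl ∷ ≈-refl ∷ []))))
         (⊗-cong ≈-refl (V₃ 2 (λ a a⁺ → :- (con (+ 4) :* (a :* a⁺))) (≈-refl ∷ ≈-refl ∷ []))) ⟩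
  _ ≈⟨ solve 5 (λ x c d a a⁺ →
         c :* d :+ x :* (con (+ 2) :* (a⁺ :* d :- a :* c)) :+ x :* x :* (:- (con (+ 4) :* (a :* a⁺)))
         := (c :+ con (+ 2) :* x :* a⁺) :* (d :- con (+ 2) :* x :* a)) ≈-refl X (V 3 φ₃) (V 3 θ₃) (V 3 a) (V 3 a⁺) ⟩
  (V 3 φ₃ ⊕ κ (+ 2) ⊗ X ⊗ V 3 a⁺) ⊗ (V 3 θ₃ ⊕ ⊖ (κ (+ 2) ⊗ X ⊗ V 3 a))
    ≈⟨ ⊗-cong φ-dissection₃ θ-dissection₃ ⟨
  φ ⊗ θ
    ≈⟨ φ⊗θ ⟩
  V 2 θ ⊗ V 2 θ
    ≈⟨ ⊗-cong V2θ V2θ ⟩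
  (V 3 (V 2 θ₃) ⊕ ⊖ (κ (+ 2) ⊗ (X ⊗ X) ⊗ V 3 (V 2 a))) ⊗ (V 3 (V 2 θ₃) ⊕ ⊖ (κ (+ 2) ⊗ (X ⊗ X) ⊗ V 3 (V 2 a)))
    ≈⟨ solve 3 (λ x d a → (d :- con (+ 2) :* (x :* x) :* a) :* (d :- con (+ 2) :* (x :* x) :* a)
         := d :^ 2 :+ x :* (con (+ 4) :* (x :* (x :* x) :* a :^ 2)) :+ x :* x :* (:- (con (+ 4) :* (a :* d)))) ≈-refl X _ _ ⟩
  _ ≈⟨ ⊕-cong (⊕-cong
         (V₃ 1 (λ d → d :^ 2) (≈-refl ∷ []))
         (⊗-cong ≈-refl (V₃ 2 (λ x a → con (+ 4) :* (x :* a :^ 2)) (X³ ∷ ≈-refl ∷ []))))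
         (⊗-cong ≈-refl (V₃ 2 (λ a d → :- (con (+ 4) :* (a :* d))) (≈-refl ∷ ≈-refl ∷ []))) ⟨
  weave₃ (V 2 θ₃ ↑ 2) (κ (+ 4) ⊗ (X ⊗ V 2 a ↑ 2)) (⊖ (κ (+ 4) ⊗ (V 2 a ⊗ V 2 θ₃))) ∎
  where
  open ≈R
  V2θ : V 2 θ ≈ V 3 (V 2 θ₃) ⊕ ⊖ (κ (+ 2) ⊗ (X ⊗ X) ⊗ V 3 (V 2 a))
  V2θ = ≈-trans (V-cong 2 θ-dissection₃)
    (V₂ 3 (λ d x a → d :- con (+ 2) :* x :* a) (≈-sym (V3-V2 θ₃) ∷ X² ∷ ≈-sym (V3-V2 a) ∷ []))

φ₃⊗θ₃ : φ₃ ⊗ θ₃ ≈ V 2 θ₃ ↑ 2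
φ₃⊗θ₃ = proj₁ (weave₃-injective φ⊗θ-weave)

a⁺θ₃-aφ₃ : a⁺ ⊗ θ₃ ⊕ ⊖ (a ⊗ φ₃) ≈ κ (+ 2) ⊗ (X ⊗ V 2 a ↑ 2)
a⁺θ₃-aφ₃ = κ-cancel 1 (≈-trans (proj₁ (proj₂ (weave₃-injective φ⊗θ-weave)))
  (solve 1 (λ x → con (+ 4) :* x := con (+ 2) :* (con (+ 2) :* x)) ≈-refl _))

a⊗a⁺ : a ⊗ a⁺ ≈ V 2 a ⊗ V 2 θ₃
a⊗a⁺ = κ-cancel 3 (lc (⊖-cong (proj₂ (proj₂ (weave₃-injective φ⊗θ-weave))))
  (solve 2 (λ x y → con (+ 4) :* x :+ :- (:- (con (+ 4) :* y)) := con (+ 4) :* y :+ :- (:- (con (+ 4) :* x))) ≈-refl _ _))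

-- Class 1 modulo 3 of ψ(q)² = φ(q) ψ(q²). Since φ has no class 2 and ψ(q²) no class 1, each side
-- contributes a single product, taken twice.
A⊗ψ₃ : A ⊗ ψ₃ ≈ a⁺ ⊗ V 2 A
A⊗ψ₃ = κ-cancel 1 (proj₁ (proj₂ (weave₃-injective {A ↑ 2} {κ (+ 2) ⊗ (A ⊗ ψ₃)} {ψ₃ ↑ 2}
    {φ₃ ⊗ V 2 A ⊕ κ (+ 2) ⊗ (X ⊗ (a⁺ ⊗ V 2 ψ₃))} {κ (+ 2) ⊗ (a⁺ ⊗ V 2 A)} {φ₃ ⊗ V 2 ψ₃} (begin
  weave₃ (A ↑ 2) (κ (+ 2) ⊗ (A ⊗ ψ₃)) (ψ₃ ↑ 2)
    ≈⟨ ⊕-cong (⊕-cong (V₃ 1 (λ x → x :^ 2) (≈-refl ∷ []))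
         (⊗-cong ≈-refl (V₃ 2 (λ x y → con (+ 2) :* (x :* y)) (≈-refl ∷ ≈-refl ∷ []))))
         (⊗-cong ≈-refl (V₃ 1 (λ x → x :^ 2) (≈-refl ∷ []))) ⟩
  _ ≈⟨ solve 3 (λ x a t → a :^ 2 :+ x :* (con (+ 2) :* (a :* t)) :+ x :* x :* t :^ 2 := (a :+ x :* t) :^ 2) ≈-refl X (V 3 A) (V 3 ψ₃) ⟩
  (V 3 A ⊕ X ⊗ V 3 ψ₃) ↑ 2
    ≈⟨ ↑-congˡ 2 ψ-dissection₃ ⟨
  ψ ↑ 2
    ≈⟨ ψ² ⟩
  φ ⊗ V 2 ψ
    ≈⟨ ⊗-cong φ-dissection₃ V2ψ ⟩
  (V 3 φ₃ ⊕ κ (+ 2) ⊗ X ⊗ V 3 a⁺) ⊗ (V 3 (V 2 A) ⊕ X ⊗ X ⊗ V 3 (V 2 ψ₃))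
    ≈⟨ solve 5 (λ x c a b t → (c :+ con (+ 2) :* x :* a) :* (b :+ x :* x :* t)
         := (c :* b :+ con (+ 2) :* (x :* (x :* x) :* (a :* t))) :+ x :* (con (+ 2) :* (a :* b)) :+ x :* x :* (c :* t)) ≈-refl X _ _ _ _ ⟩
  _ ≈⟨ ⊕-cong (⊕-cong (V₃ 5 (λ x c a b t → c :* b :+ con (+ 2) :* (x :* (a :* t))) (X³ ∷ ≈-refl ∷ ≈-refl ∷ ≈-refl ∷ ≈-refl ∷ []))
         (⊗-cong ≈-refl (V₃ 2 (λ x y → con (+ 2) :* (x :* y)) (≈-refl ∷ ≈-refl ∷ []))))
         (⊗-cong ≈-refl (V₃ 2 (λ x y → x :* y) (≈-refl ∷ ≈-refl ∷ []))) ⟨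
  weave₃ (φ₃ ⊗ V 2 A ⊕ κ (+ 2) ⊗ (X ⊗ (a⁺ ⊗ V 2 ψ₃))) (κ (+ 2) ⊗ (a⁺ ⊗ V 2 A)) (φ₃ ⊗ V 2 ψ₃) ∎))))
  where
  open ≈R
  V2ψ : V 2 ψ ≈ V 3 (V 2 A) ⊕ X ⊗ X ⊗ V 3 (V 2 ψ₃)
  V2ψ = ≈-trans (V-cong 2 ψ-dissection₃)
    (V₂ 3 (λ a x t → a :+ x :* t) (≈-sym (V3-V2 A) ∷ X² ∷ ≈-sym (V3-V2 ψ₃) ∷ []))

ψ₃² : ψ₃ ↑ 2 ≈ φ₃ ⊗ V 2 ψ₃
ψ₃² = ≈-trans (≈-sym (V₃ 1 (λ x → x :^ 2) (≈-refl ∷ []))) (≈-trans (V-cong 3 ψ²)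
  (V₃ 2 (λ x y → x :* y) (≈-refl ∷ V3-V2 ψ ∷ [])))

-- a A/(φ(-q³) ψ(q³)) is fixed by q ↦ q².
a⊗A : a ⊗ A ≈ θ₃ ⊗ ψ₃
a⊗A = V2-ratio-fixed (unit-⊗ unit-a unit-A) (unit-⊗ (unit-V 3 unit-θ) unit-ψ₃) (unit-cancel ψ₃ unit-ψ₃ (begin
  ψ₃ ⊗ (a ⊗ A ⊗ V 2 (θ₃ ⊗ ψ₃))
    ≈⟨ ⊗-cong ≈-refl (⊗-cong ≈-refl (V₂ 2 (λ x y → x :* y) (≈-refl ∷ ≈-refl ∷ []))) ⟩
  ψ₃ ⊗ (a ⊗ A ⊗ (V 2 θ₃ ⊗ V 2 ψ₃))
    ≈⟨ solve 5 (λ p a b d q → p :* (a :* b :* (d :* q)) := a :* (b :* p) :* (d :* q)) ≈-refl ψ₃ a A (V 2 θ₃) (V 2 ψ₃) ⟩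
  a ⊗ (A ⊗ ψ₃) ⊗ (V 2 θ₃ ⊗ V 2 ψ₃)
    ≈⟨ ⊗-cong (⊗-cong ≈-refl A⊗ψ₃) ≈-refl ⟩
  a ⊗ (a⁺ ⊗ V 2 A) ⊗ (V 2 θ₃ ⊗ V 2 ψ₃)
    ≈⟨ solve 5 (λ a a⁺ b d q → a :* (a⁺ :* b) :* (d :* q) := a :* a⁺ :* (b :* d :* q)) ≈-refl a a⁺ (V 2 A) (V 2 θ₃) (V 2 ψ₃) ⟩
  a ⊗ a⁺ ⊗ (V 2 A ⊗ V 2 θ₃ ⊗ V 2 ψ₃)
    ≈⟨ ⊗-cong a⊗a⁺ ≈-refl ⟩
  V 2 a ⊗ V 2 θ₃ ⊗ (V 2 A ⊗ V 2 θ₃ ⊗ V 2 ψ₃)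
    ≈⟨ solve 4 (λ a b d q → a :* d :* (b :* d :* q) := a :* b :* q :* d :^ 2) ≈-refl (V 2 a) (V 2 A) (V 2 θ₃) (V 2 ψ₃) ⟩
  V 2 a ⊗ V 2 A ⊗ V 2 ψ₃ ⊗ V 2 θ₃ ↑ 2
    ≈⟨ ⊗-cong ≈-refl φ₃⊗θ₃ ⟨
  V 2 a ⊗ V 2 A ⊗ V 2 ψ₃ ⊗ (φ₃ ⊗ θ₃)
    ≈⟨ solve 5 (λ a b c d q → a :* b :* q :* (c :* d) := (c :* q) :* (d :* (a :* b))) ≈-refl (V 2 a) (V 2 A) φ₃ θ₃ (V 2 ψ₃) ⟩
  φ₃ ⊗ V 2 ψ₃ ⊗ (θ₃ ⊗ (V 2 a ⊗ V 2 A))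
    ≈⟨ ⊗-cong ψ₃² (⊗-cong ≈-refl (V₂ 2 (λ x y → x :* y) (≈-refl ∷ ≈-refl ∷ []))) ⟨
  ψ₃ ↑ 2 ⊗ (θ₃ ⊗ V 2 (a ⊗ A))
    ≈⟨ solve 3 (λ p d y → p :^ 2 :* (d :* y) := p :* (d :* p :* y)) ≈-refl ψ₃ θ₃ _ ⟩
  ψ₃ ⊗ (θ₃ ⊗ ψ₃ ⊗ V 2 (a ⊗ A)) ∎))
  where
  open ≈R
  unit-ψ₃ = unit-V 3 unit-ψ

-- F is f₁².
F : PS
F = V 2 A ⊗ φ₃ ⊕ ⊖ (κ (+ 2) ⊗ (X ⊗ (a⁺ ⊗ V 2 ψ₃)))

V4F : PS
V4F = V 2 (V 2 F)

-- The origin of `F`. The summands are exchanged by q ↦ -q, so the sum is twice the even part of a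
-- φ(q³), and the 2-dissections show that this part is a series in q⁴.
aφ₃+a⁺θ₃ : a ⊗ φ₃ ⊕ a⁺ ⊗ θ₃ ≈ κ (+ 2) ⊗ V4F
aφ₃+a⁺θ₃ = begin
  a ⊗ φ₃ ⊕ a⁺ ⊗ θ₃
    ≈⟨ ⊕-cong (⊗-cong a-dissection₂ φ₃-dissection₂) (⊗-cong a⁺-dissection₂ θ₃-dissection₂) ⟩
  _ ≈⟨ solve 5 (λ x u s m r →
         (u :- x :* s) :* (m :+ con (+ 2) :* (x :* (x :* x)) :* r) :+ (u :+ x :* s) :* (m :- con (+ 2) :* (x :* (x :* x)) :* r)
         := con (+ 2) :* (u :* m :- con (+ 2) :* (x :* x :* (x :* x) :* (s :* r))))
       ≈-refl X _ _ _ _ ⟩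
  _ ≈⟨ ⊗-cong ≈-refl (≈-trans (V-cong 2 (V₂ 5 F-shape (≈-refl ∷ ≈-refl ∷ X² ∷ ≈-refl ∷ ≈-refl ∷ [])))
         (V₂ 5 F-shape (≈-refl ∷ ≈-refl ∷ V₂ 1 (λ x → x :* x) (X² ∷ []) ∷ ≈-refl ∷ ≈-refl ∷ []))) ⟨
  κ (+ 2) ⊗ V4F ∎
  where
  open ≈R
  F-shape : N-ary 5 (Polynomial 5) (Polynomial 5)
  F-shape u m x s r = u :* m :- con (+ 2) :* (x :* (s :* r))
  φ₃-dissection₂ : φ₃ ≈ V 2 (V 2 φ₃) ⊕ κ (+ 2) ⊗ (X ⊗ (X ⊗ X)) ⊗ V 2 (V 2 (V 2 ψ₃))
  φ₃-dissection₂ = ≈-trans (V-cong 3 φ-dissection₂) (V₃ 3 (λ u x y → u :+ con (+ 2) :* x :* y)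
    (≈-trans (V3-V2 _) (V-cong 2 (V3-V2 φ)) ∷ X³ ∷ ≈-trans (V3-V2 _) (V-cong 2 (≈-trans (V3-V2 _) (V-cong 2 (V3-V2 ψ)))) ∷ []))
  θ₃-dissection₂ : θ₃ ≈ V 2 (V 2 φ₃) ⊕ ⊖ (κ (+ 2) ⊗ (X ⊗ (X ⊗ X)) ⊗ V 2 (V 2 (V 2 ψ₃)))
  θ₃-dissection₂ = ≈-trans (V-cong 3 θ-dissection₂) (V₃ 3 (λ u x y → u :- con (+ 2) :* x :* y)
    (≈-trans (V3-V2 _) (V-cong 2 (V3-V2 φ)) ∷ X³ ∷ ≈-trans (V3-V2 _) (V-cong 2 (≈-trans (V3-V2 _) (V-cong 2 (V3-V2 ψ)))) ∷ []))

a⊗φ₃ : a ⊗ φ₃ ≈ V4F ⊕ ⊖ (X ⊗ V 2 a ↑ 2)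
a⊗φ₃ = κ-cancel 1 (lc (⊕-cong aφ₃+a⁺θ₃ (⊖-cong a⁺θ₃-aφ₃))
  (solve 4 (λ u v f y → con (+ 2) :* u :+ (con (+ 2) :* f :- con (+ 2) :* y)
     := con (+ 2) :* (f :- y) :+ (u :+ v :- (v :- u))) ≈-refl (a ⊗ φ₃) (a⁺ ⊗ θ₃) V4F (X ⊗ V 2 a ↑ 2)))

a⁺⊗θ₃ : a⁺ ⊗ θ₃ ≈ V4F ⊕ X ⊗ V 2 a ↑ 2
a⁺⊗θ₃ = κ-cancel 1 (lc (⊕-cong aφ₃+a⁺θ₃ a⁺θ₃-aφ₃)
  (solve 4 (λ u v f y → con (+ 2) :* v :+ (con (+ 2) :* f :+ con (+ 2) :* y)
     := con (+ 2) :* (f :+ y) :+ (u :+ v :+ (v :- u))) ≈-refl (a ⊗ φ₃) (a⁺ ⊗ θ₃) V4F (X ⊗ V 2 a ↑ 2)))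

-- Multiplying `a⊗φ₃` by its reflection `a⁺⊗θ₃` gives F(q⁴)² - q² a(q²)⁴ on one side and, by `a⊗a⁺`
-- and `φ₃⊗θ₃`, a series in q² on the other; then exponents are halved.
V2F² : V 2 F ↑ 2 ≈ a ⊗ (θ₃ ↑ 3 ⊕ X ⊗ a ↑ 3)
V2F² = ≈-sym (lc core (solve 4 (λ f a d x → a :* (d :^ 3 :+ x :* a :^ 3) :+ (f :^ 2 :- x :* a :^ 4) := f :^ 2 :+ a :* d :^ 3)
    ≈-refl (V 2 F) a θ₃ X))
  where
  open ≈R
  core : a ⊗ θ₃ ↑ 3 ≈ V 2 F ↑ 2 ⊕ ⊖ (X ⊗ a ↑ 4)
  core = V-injective 2 (begin
    V 2 (a ⊗ θ₃ ↑ 3)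
      ≈⟨ V₂ 2 (λ a d → a :* d :^ 3) (≈-refl ∷ ≈-refl ∷ []) ⟩
    V 2 a ⊗ V 2 θ₃ ↑ 3
      ≈⟨ solve 2 (λ a d → a :* d :^ 3 := a :* d :* d :^ 2) ≈-refl _ _ ⟩
    V 2 a ⊗ V 2 θ₃ ⊗ V 2 θ₃ ↑ 2
      ≈⟨ ⊗-cong a⊗a⁺ φ₃⊗θ₃ ⟨
    a ⊗ a⁺ ⊗ (φ₃ ⊗ θ₃)
      ≈⟨ solve 4 (λ a b c d → a :* b :* (c :* d) := a :* c :* (b :* d)) ≈-refl a a⁺ φ₃ θ₃ ⟩
    a ⊗ φ₃ ⊗ (a⁺ ⊗ θ₃)
      ≈⟨ ⊗-cong a⊗φ₃ a⁺⊗θ₃ ⟩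
    (V4F ⊕ ⊖ (X ⊗ V 2 a ↑ 2)) ⊗ (V4F ⊕ X ⊗ V 2 a ↑ 2)
      ≈⟨ solve 3 (λ f x a → (f :- x :* a :^ 2) :* (f :+ x :* a :^ 2) := f :^ 2 :- x :* x :* a :^ 4) ≈-refl V4F X (V 2 a) ⟩
    V4F ↑ 2 ⊕ ⊖ (X ⊗ X ⊗ V 2 a ↑ 4)
      ≈⟨ V₂ 3 (λ f x a → f :^ 2 :- x :* a :^ 4) (≈-refl ∷ X² ∷ ≈-refl ∷ []) ⟨
    V 2 (V 2 F ↑ 2 ⊕ ⊖ (X ⊗ a ↑ 4)) ∎)

-- norm x f₀ f₁ f₂ is the product of f₀ + ω r f₁ + ω² r² f₂ over the cube roots of unity ω, where r³ = x.
norm : PS → PS → PS → PS → PS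
norm x f₀ f₁ f₂ = f₀ ↑ 3 ⊕ x ⊗ f₁ ↑ 3 ⊕ x ↑ 2 ⊗ f₂ ↑ 3 ⊕ ⊖ (κ (+ 3) ⊗ x ⊗ f₀ ⊗ f₁ ⊗ f₂)

normᵖ : ∀ {n} (x f₀ f₁ f₂ : Polynomial n) → Polynomial n
normᵖ x f₀ f₁ f₂ = f₀ :^ 3 :+ x :* f₁ :^ 3 :+ x :^ 2 :* f₂ :^ 3 :- con (+ 3) :* x :* f₀ :* f₁ :* f₂

norm-cong : ∀ {x f₀ f₁ f₂ g₀ g₁ g₂} → f₀ ≈ g₀ → f₁ ≈ g₁ → f₂ ≈ g₂ → norm x f₀ f₁ f₂ ≈ norm x g₀ g₁ g₂
norm-cong e₀ e₁ e₂ = ⊕-cong (⊕-cong (⊕-cong (↑-congˡ 3 e₀) (⊗-cong ≈-refl (↑-congˡ 3 e₁))) (⊗-cong ≈-refl (↑-congˡ 3 e₂)))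
  (⊖-cong (⊗-cong (⊗-cong (⊗-cong ≈-refl e₀) e₁) e₂))

-- The three arguments on the left are the components of (a + r b + r² c)(d + r e + r² f), reduced
-- by r³ = x.
norm-⊗ : ∀ x a b c d e f →
  norm x (a ⊗ d ⊕ x ⊗ (b ⊗ f ⊕ c ⊗ e)) (a ⊗ e ⊕ b ⊗ d ⊕ x ⊗ (c ⊗ f)) (a ⊗ f ⊕ b ⊗ e ⊕ c ⊗ d) ≈ norm x a b c ⊗ norm x d e f
norm-⊗ = solve 7 (λ x a b c d e f →
  normᵖ x (a :* d :+ x :* (b :* f :+ c :* e)) (a :* e :+ b :* d :+ x :* (c :* f)) (a :* f :+ b :* e :+ c :* d)
  := normᵖ x a b c :* normᵖ x d e f) ≈-refl

-- The norm of a series over the cube roots of unity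

N : PS → PS
N f = norm X (sec 3 0 f) (sec 3 1 f) (sec 3 2 f)

N-weave : ∀ {f} f₀ f₁ f₂ → f ≈ weave₃ f₀ f₁ f₂ → N f ≈ norm X f₀ f₁ f₂
N-weave f₀ f₁ f₂ e = norm-cong
  (≈-trans (sec-cong 3 0 e) (sec-weave₃-0 f₀ f₁ f₂))
  (≈-trans (sec-cong 3 1 e) (sec-weave₃-1 f₀ f₁ f₂))
  (≈-trans (sec-cong 3 2 e) (sec-weave₃-2 f₀ f₁ f₂))

N-cong : ∀ {f g} → f ≈ g → N f ≈ N g
N-cong e = norm-cong (sec-cong 3 0 e) (sec-cong 3 1 e) (sec-cong 3 2 e)

weave₃-expand : ∀ f → f ≈ weave₃ (sec 3 0 f) (sec 3 1 f) (sec 3 2 f)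
weave₃-expand f = weave₃-sec ≈-refl ≈-refl ≈-refl

N-⊗ : ∀ f g → N (f ⊗ g) ≈ N f ⊗ N g
N-⊗ f g = ≈-trans (N-weave _ _ _ (begin
  f ⊗ g
    ≈⟨ ⊗-cong (weave₃-expand f) (weave₃-expand g) ⟩
  weave₃ f₀ f₁ f₂ ⊗ weave₃ g₀ g₁ g₂
    ≈⟨ solve 7 (λ x a b c d e f →
         (a :+ x :* b :+ x :* x :* c) :* (d :+ x :* e :+ x :* x :* f)
         := (a :* d :+ x :* (x :* x) :* (b :* f :+ c :* e)) :+ x :* (a :* e :+ b :* d :+ x :* (x :* x) :* (c :* f))
            :+ x :* x :* (a :* f :+ b :* e :+ c :* d)) ≈-refl X _ _ _ _ _ _ ⟩
  _ ≈⟨ ⊕-cong (⊕-cong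
         (V₃ 7 (λ x a b c d e f → a :* d :+ x :* (b :* f :+ c :* e)) vars)
         (⊗-cong ≈-refl (V₃ 7 (λ x a b c d e f → a :* e :+ b :* d :+ x :* (c :* f)) vars)))
         (⊗-cong ≈-refl (V₃ 7 (λ x a b c d e f → a :* f :+ b :* e :+ c :* d) vars)) ⟨
  weave₃ (f₀ ⊗ g₀ ⊕ X ⊗ (f₁ ⊗ g₂ ⊕ f₂ ⊗ g₁)) (f₀ ⊗ g₁ ⊕ f₁ ⊗ g₀ ⊕ X ⊗ (f₂ ⊗ g₂)) (f₀ ⊗ g₂ ⊕ f₁ ⊗ g₁ ⊕ f₂ ⊗ g₀) ∎))
  (norm-⊗ X f₀ f₁ f₂ g₀ g₁ g₂)
  where
  open ≈R
  f₀ = sec 3 0 f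
  f₁ = sec 3 1 f
  f₂ = sec 3 2 f
  g₀ = sec 3 0 g
  g₁ = sec 3 1 g
  g₂ = sec 3 2 g
  vars : Pointwise (λ x y → V 3 x ≈ y) (X ∷ f₀ ∷ f₁ ∷ f₂ ∷ g₀ ∷ g₁ ∷ g₂ ∷ [])
           (X ⊗ (X ⊗ X) ∷ V 3 f₀ ∷ V 3 f₁ ∷ V 3 f₂ ∷ V 3 g₀ ∷ V 3 g₁ ∷ V 3 g₂ ∷ [])
  vars = X³ ∷ ≈-refl ∷ ≈-refl ∷ ≈-refl ∷ ≈-refl ∷ ≈-refl ∷ ≈-refl ∷ []

N-V3 : ∀ f → N (V 3 f) ≈ f ↑ 3
N-V3 f = ≈-trans (N-weave f (κ (+ 0)) (κ (+ 0)) (begin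
  V 3 f
    ≈⟨ solve 2 (λ x y → y := y :+ x :* con (+ 0) :+ x :* x :* con (+ 0)) ≈-refl X (V 3 f) ⟩
  V 3 f ⊕ X ⊗ κ (+ 0) ⊕ X ⊗ X ⊗ κ (+ 0)
    ≈⟨ ⊕-cong (⊕-cong ≈-refl (⊗-cong ≈-refl (V-κ 3 (+ 0)))) (⊗-cong ≈-refl (V-κ 3 (+ 0))) ⟨
  weave₃ f (κ (+ 0)) (κ (+ 0)) ∎))
  (solve 2 (λ x f → normᵖ x f (con (+ 0)) (con (+ 0)) := f :^ 3) ≈-refl X f)
  where open ≈R

-- Squaring q exchanges the classes 1 and 2 modulo 3; class 2 becomes q⁴ = q q³ and so acquires the
-- factor `X`.
N-V2 : ∀ f → N (V 2 f) ≈ V 2 (N f)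
N-V2 f = ≈-trans (N-weave (V 2 f₀) (X ⊗ V 2 f₂) (V 2 f₁) (begin
  V 2 f
    ≈⟨ V-cong 2 (weave₃-expand f) ⟩
  V 2 (weave₃ f₀ f₁ f₂)
    ≈⟨ V₂ 4 (λ x a b c → a :+ x :* b :+ x :* x :* c) (X² ∷ ≈-sym (V3-V2 f₀) ∷ ≈-sym (V3-V2 f₁) ∷ ≈-sym (V3-V2 f₂) ∷ []) ⟩
  V 3 (V 2 f₀) ⊕ X ⊗ X ⊗ V 3 (V 2 f₁) ⊕ X ⊗ X ⊗ (X ⊗ X) ⊗ V 3 (V 2 f₂)
    ≈⟨ solve 4 (λ x a b c → a :+ x :* x :* b :+ x :* x :* (x :* x) :* c := a :+ x :* (x :* (x :* x) :* c) :+ x :* x :* b) ≈-refl X _ _ _ ⟩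
  V 3 (V 2 f₀) ⊕ X ⊗ (X ⊗ (X ⊗ X) ⊗ V 3 (V 2 f₂)) ⊕ X ⊗ X ⊗ V 3 (V 2 f₁)
    ≈⟨ ⊕-cong (⊕-cong ≈-refl (⊗-cong ≈-refl (V₃ 2 (λ x c → x :* c) (X³ ∷ ≈-refl ∷ [])))) ≈-refl ⟨
  weave₃ (V 2 f₀) (X ⊗ V 2 f₂) (V 2 f₁) ∎))
  (≈-trans (solve 4 (λ x a b c → normᵖ x a (x :* c) b := normᵖ (x :* x) a b c) ≈-refl X _ _ _)
    (≈-sym (V₂ 4 normᵖ (X² ∷ ≈-refl ∷ ≈-refl ∷ ≈-refl ∷ []))))
  where
  open ≈R
  f₀ = sec 3 0 f
  f₁ = sec 3 1 f
  f₂ = sec 3 2 f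

N-ν : ∀ f → N (ν f) ≈ ν (N f)
N-ν f = ≈-trans (N-weave (ν f₀) (⊖ ν f₁) (ν f₂) (begin
  ν f
    ≈⟨ ν-cong (weave₃-expand f) ⟩
  ν (weave₃ f₀ f₁ f₂)
    ≈⟨ νʰ 4 (λ x a b c → a :+ x :* b :+ x :* x :* c) (ν-X ∷ ν-V3 f₀ ∷ ν-V3 f₁ ∷ ν-V3 f₂ ∷ []) ⟩
  V 3 (ν f₀) ⊕ ⊖ X ⊗ V 3 (ν f₁) ⊕ ⊖ X ⊗ ⊖ X ⊗ V 3 (ν f₂)
    ≈⟨ solve 4 (λ x a b c → a :+ :- x :* b :+ :- x :* :- x :* c := a :+ x :* (:- b) :+ x :* x :* c) ≈-refl X _ _ _ ⟩
  V 3 (ν f₀) ⊕ X ⊗ ⊖ V 3 (ν f₁) ⊕ X ⊗ X ⊗ V 3 (ν f₂)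
    ≈⟨ ⊕-cong (⊕-cong ≈-refl (⊗-cong ≈-refl (V-⊖ 3 (ν f₁)))) ≈-refl ⟨
  weave₃ (ν f₀) (⊖ ν f₁) (ν f₂) ∎))
  (≈-trans (solve 4 (λ x a b c → normᵖ x a (:- b) c := normᵖ (:- x) a b c) ≈-refl X _ _ _)
    (≈-sym (νʰ 4 normᵖ (ν-X ∷ ≈-refl ∷ ≈-refl ∷ ≈-refl ∷ []))))
  where
  open ≈R
  f₀ = sec 3 0 f
  f₁ = sec 3 1 f
  f₂ = sec 3 2 f

norm-cong≤ : ∀ n x {f₀ f₁ f₂ g₀ g₁ g₂} → f₀ ≈⟨≤ n ⟩ g₀ → f₁ ≈⟨≤ n ⟩ g₁ → f₂ ≈⟨≤ n ⟩ g₂ →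
             norm x f₀ f₁ f₂ ≈⟨≤ n ⟩ norm x g₀ g₁ g₂
norm-cong≤ n x {f₀} {f₁} {f₂} {g₀} {g₁} {g₂} e₀ e₁ e₂ =
  ⊕-cong≤ n {f₀ ↑ 3 ⊕ x ⊗ f₁ ↑ 3 ⊕ x ↑ 2 ⊗ f₂ ↑ 3} {g₀ ↑ 3 ⊕ x ⊗ g₁ ↑ 3 ⊕ x ↑ 2 ⊗ g₂ ↑ 3}
    (⊕-cong≤ n {f₀ ↑ 3 ⊕ x ⊗ f₁ ↑ 3} {g₀ ↑ 3 ⊕ x ⊗ g₁ ↑ 3}
      (⊕-cong≤ n {f₀ ↑ 3} {g₀ ↑ 3} (cube e₀) (⊗-cong≤ n {x} {x} (≈⟨≤⟩-refl n) (cube e₁)))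
      (⊗-cong≤ n {x ↑ 2} {x ↑ 2} (≈⟨≤⟩-refl n) (cube e₂)))
    λ k k≤n → trans (⊖-at _ k) (trans (cong -_ (⊗-cong≤ n {κ (+ 3) ⊗ x ⊗ f₀ ⊗ f₁} {κ (+ 3) ⊗ x ⊗ g₀ ⊗ g₁}
      (⊗-cong≤ n {κ (+ 3) ⊗ x ⊗ f₀} {κ (+ 3) ⊗ x ⊗ g₀} (⊗-cong≤ n {κ (+ 3) ⊗ x} {κ (+ 3) ⊗ x} (≈⟨≤⟩-refl n) e₀) e₁) e₂ k k≤n))
      (sym (⊖-at _ k)))
  where
  cube : ∀ {f g} → f ≈⟨≤ n ⟩ g → f ↑ 3 ≈⟨≤ n ⟩ g ↑ 3
  cube {f} {g} e = ⊗-cong≤ n {f} {g} e (⊗-cong≤ n {f} {g} e (⊗-cong≤ n {f} {g} e (≈⟨≤⟩-refl n)))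

sec-cong≤ : ∀ n i {f g} → i ≤ 2 → f ≈⟨≤ 2 + 3 * n ⟩ g → sec 3 i f ≈⟨≤ n ⟩ sec 3 i g
sec-cong≤ n i i≤2 e k k≤n = e (i + 3 * k) (ℕ.+-mono-≤ i≤2 (ℕ.*-monoʳ-≤ 3 k≤n))

N-cong≤ : ∀ n {f g} → f ≈⟨≤ 2 + 3 * n ⟩ g → N f ≈⟨≤ n ⟩ N g
N-cong≤ n e = norm-cong≤ n X (sec-cong≤ n 0 z≤n e) (sec-cong≤ n 1 (s≤s z≤n) e) (sec-cong≤ n 2 ℕ.≤-refl e)

V3-X^ : ∀ l → V 3 (X^ l) ≈ X^ (3 * l)
V3-X^ zero    = V-κ 3 (+ 1)
V3-X^ (suc l) = begin
  V 3 (X^ suc l)      ≈⟨ V-cong 3 (X^-suc l) ⟩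
  V 3 (X ⊗ X^ l)      ≈⟨ V-⊗ 3 _ _ ⟩
  V 3 X ⊗ V 3 (X^ l)  ≈⟨ ⊗-cong (V-X 3) (V3-X^ l) ⟩
  X^ 3 ⊗ X^ (3 * l)   ≈⟨ X^-+ 3 (3 * l) ⟨
  X^ (3 + 3 * l)      ≈⟨ X^-≡ (sym (ℕ.*-suc 3 l)) ⟩
  X^ (3 * suc l) ∎
  where open ≈R

X^-cube : ∀ l → X^ l ↑ 3 ≈ X^ (3 * l)
X^-cube l = begin
  X^ l ↑ 3                    ≈⟨ solve 1 (λ x → x :^ 3 := x :* (x :* x)) ≈-refl _ ⟩
  X^ l ⊗ (X^ l ⊗ X^ l)        ≈⟨ ⊗-cong ≈-refl (X^-+ l l) ⟨
  X^ l ⊗ X^ (l + l)           ≈⟨ X^-+ l (l + l) ⟨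
  X^ (l + (l + l))            ≈⟨ X^-≡ (((∀ l → l + (l + l) ≡ 3 * l) ∋ ℕ-Ring.solve-∀) l) ⟩
  X^ (3 * l) ∎
  where open ≈R

-- If 3 ∤ k then ∏_ω (1 ± ω^k q^k) = 1 ± q^(3k), and N reads off the series in q³.
N-binomial : ∀ s k l → k ≡ 1 + 3 * l ⊎ k ≡ 2 + 3 * l → s ↑ 3 ≈ s → V 3 s ≈ s →
             N (κ (+ 1) ⊕ s ⊗ X^ k) ≈ κ (+ 1) ⊕ s ⊗ X^ k
N-binomial s k l (inj₁ refl) s³ sV = ≈-trans (N-weave (κ (+ 1)) (s ⊗ X^ l) (κ (+ 0)) (begin
  κ (+ 1) ⊕ s ⊗ X^ (1 + 3 * l)
    ≈⟨ ⊕-cong ≈-refl (⊗-cong ≈-refl (X^-+ 1 (3 * l))) ⟩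
  κ (+ 1) ⊕ s ⊗ (X ⊗ X^ (3 * l))
    ≈⟨ solve 3 (λ s x y → con (+ 1) :+ s :* (x :* y) := con (+ 1) :+ x :* (s :* y) :+ x :* x :* con (+ 0)) ≈-refl s X _ ⟩
  κ (+ 1) ⊕ X ⊗ (s ⊗ X^ (3 * l)) ⊕ X ⊗ X ⊗ κ (+ 0)
    ≈⟨ ⊕-cong (⊕-cong (V-κ 3 (+ 1)) (⊗-cong ≈-refl (V₃ 2 (λ s y → s :* y) (sV ∷ V3-X^ l ∷ [])))) (⊗-cong ≈-refl (V-κ 3 (+ 0))) ⟨
  weave₃ (κ (+ 1)) (s ⊗ X^ l) (κ (+ 0)) ∎)) (begin
  norm X (κ (+ 1)) (s ⊗ X^ l) (κ (+ 0))
    ≈⟨ solve 3 (λ s x y → normᵖ x (con (+ 1)) (s :* y) (con (+ 0)) := con (+ 1) :+ s :^ 3 :* (x :* y :^ 3)) ≈-refl s X _ ⟩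
  κ (+ 1) ⊕ s ↑ 3 ⊗ (X ⊗ X^ l ↑ 3)
    ≈⟨ ⊕-cong ≈-refl (⊗-cong s³ (⊗-cong ≈-refl (X^-cube l))) ⟩
  κ (+ 1) ⊕ s ⊗ (X ⊗ X^ (3 * l))
    ≈⟨ ⊕-cong ≈-refl (⊗-cong ≈-refl (X^-+ 1 (3 * l))) ⟨
  κ (+ 1) ⊕ s ⊗ X^ (1 + 3 * l) ∎)
  where open ≈R
N-binomial s k l (inj₂ refl) s³ sV = ≈-trans (N-weave (κ (+ 1)) (κ (+ 0)) (s ⊗ X^ l) (begin
  κ (+ 1) ⊕ s ⊗ X^ (2 + 3 * l)
    ≈⟨ ⊕-cong ≈-refl (⊗-cong ≈-refl (X^-+ 2 (3 * l))) ⟩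
  κ (+ 1) ⊕ s ⊗ (X ⊗ X ⊗ X^ (3 * l))
    ≈⟨ solve 3 (λ s x y → con (+ 1) :+ s :* (x :* x :* y) := con (+ 1) :+ x :* con (+ 0) :+ x :* x :* (s :* y)) ≈-refl s X _ ⟩
  κ (+ 1) ⊕ X ⊗ κ (+ 0) ⊕ X ⊗ X ⊗ (s ⊗ X^ (3 * l))
    ≈⟨ ⊕-cong (⊕-cong (V-κ 3 (+ 1)) (⊗-cong ≈-refl (V-κ 3 (+ 0)))) (⊗-cong ≈-refl (V₃ 2 (λ s y → s :* y) (sV ∷ V3-X^ l ∷ []))) ⟨
  weave₃ (κ (+ 1)) (κ (+ 0)) (s ⊗ X^ l) ∎)) (begin
  norm X (κ (+ 1)) (κ (+ 0)) (s ⊗ X^ l)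
    ≈⟨ solve 3 (λ s x y → normᵖ x (con (+ 1)) (con (+ 0)) (s :* y) := con (+ 1) :+ s :^ 3 :* (x :* x :* y :^ 3)) ≈-refl s X _ ⟩
  κ (+ 1) ⊕ s ↑ 3 ⊗ (X ⊗ X ⊗ X^ l ↑ 3)
    ≈⟨ ⊕-cong ≈-refl (⊗-cong s³ (⊗-cong ≈-refl (X^-cube l))) ⟩
  κ (+ 1) ⊕ s ⊗ (X ⊗ X ⊗ X^ (3 * l))
    ≈⟨ ⊕-cong ≈-refl (⊗-cong ≈-refl (X^-+ 2 (3 * l))) ⟨
  κ (+ 1) ⊕ s ⊗ X^ (2 + 3 * l) ∎)
  where open ≈R

N-one : N (κ (+ 1)) ≈ κ (+ 1)
N-one = ≈-trans (N-cong (≈-sym (V-κ 3 (+ 1)))) (≈-trans (N-V3 (κ (+ 1))) (solve 0 (con (+ 1) :^ 3 := con (+ 1)) ≈-refl))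

N-W : ∀ j l → suc j ≡ 1 + 3 * l ⊎ suc j ≡ 2 + 3 * l → N (W j) ≈ W j
N-W j l k≡ = begin
  N (W j)                                 ≈⟨ N-cong (W-factor j) ⟩
  N ((κ (+ 1) ⊕ ⊖ x) ⊗ U j)               ≈⟨ N-⊗ _ _ ⟩
  N (κ (+ 1) ⊕ ⊖ x) ⊗ N (U j)             ≈⟨ ⊗-cong minus N-U ⟩
  (κ (+ 1) ⊕ ⊖ x) ⊗ U j                   ≈⟨ W-factor j ⟨
  W j ∎
  where
  open ≈R
  x = X^ suc j
  plus : N (κ (+ 1) ⊕ x) ≈ κ (+ 1) ⊕ x
  plus = ≈-trans (N-cong (solve 1 (λ x → con (+ 1) :+ x := con (+ 1) :+ con (+ 1) :* x) ≈-refl x))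
    (≈-trans (N-binomial (κ (+ 1)) (suc j) l k≡ (solve 0 (con (+ 1) :^ 3 := con (+ 1)) ≈-refl) (V-κ 3 (+ 1)))
      (solve 1 (λ x → con (+ 1) :+ con (+ 1) :* x := con (+ 1) :+ x) ≈-refl x))
  minus : N (κ (+ 1) ⊕ ⊖ x) ≈ κ (+ 1) ⊕ ⊖ x
  minus = ≈-trans (N-cong (solve 1 (λ x → con (+ 1) :- x := con (+ 1) :+ con (- (+ 1)) :* x) ≈-refl x))
    (≈-trans (N-binomial (κ (- (+ 1))) (suc j) l k≡ (solve 0 (con (- (+ 1)) :^ 3 := con (- (+ 1))) ≈-refl) (V-κ 3 (- (+ 1))))
      (solve 1 (λ x → con (+ 1) :+ con (- (+ 1)) :* x := con (+ 1) :- x) ≈-refl x))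
  unit-plus : Unit (κ (+ 1) ⊕ x)
  unit-plus = unit (trans (⊕-at _ _ 0) (cong₂ _+ℤ_ (κ-at0 (+ 1))
    (trans (at (≈-trans (X^-suc j) (≈-refl)) 0) (X⊗-at0 _))))
  N-U : N (U j) ≈ U j
  N-U = unit-cancel (κ (+ 1) ⊕ x) unit-plus (begin
    (κ (+ 1) ⊕ x) ⊗ N (U j)       ≈⟨ ⊗-cong plus ≈-refl ⟨
    N (κ (+ 1) ⊕ x) ⊗ N (U j)     ≈⟨ N-⊗ _ _ ⟨
    N ((κ (+ 1) ⊕ x) ⊗ U j)       ≈⟨ N-cong (U-inverse j) ⟩
    N (κ (+ 1))                   ≈⟨ N-one ⟩
    κ (+ 1)                       ≈⟨ U-inverse j ⟨
    (κ (+ 1) ⊕ x) ⊗ U j ∎)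

-- Of three consecutive factors, the two with exponent prime to 3 are fixed by `N`, and `V 3 (W l)`
-- becomes the cube of `W l`. The factor thus lost from the product is supplied by the multiplier
-- `V 3 (∏ W 0 l)`.
N-∏W : ∀ l → N (∏ W 0 (l * 3)) ⊗ V 3 (∏ W 0 l) ≈ ∏ W 0 (l * 3) ⊗ ∏ W 0 l ↑ 3
N-∏W zero    = ≈-trans (⊗-cong N-one (V-κ 3 (+ 1))) (solve 0 (con (+ 1) :* con (+ 1) := con (+ 1) :* con (+ 1) :^ 3) ≈-refl)
N-∏W (suc l) = begin
  N (∏ W 0 (3 + m)) ⊗ V 3 (∏ W 0 (suc l))
    ≈⟨ ⊗-cong (N-cong split) (≈-trans (V-cong 3 (∏-snoc W 0 l)) (V-⊗ 3 _ _)) ⟩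
  N (g ⊗ W m ⊗ W (1 + m) ⊗ V 3 (W l)) ⊗ (V 3 h ⊗ V 3 (W l))
    ≈⟨ ⊗-cong (≈-trans (N-⊗ _ _) (⊗-cong (≈-trans (N-⊗ _ _) (⊗-cong (≈-trans (N-⊗ _ _) (⊗-cong ≈-refl
         (N-W m l (inj₁ (cong suc (ℕ.*-comm l 3)))))) (N-W (1 + m) l (inj₂ (cong (λ i → 2 + i) (ℕ.*-comm l 3)))))) (N-V3 (W l)))) ≈-refl ⟩
  N g ⊗ W m ⊗ W (1 + m) ⊗ W l ↑ 3 ⊗ (V 3 h ⊗ V 3 (W l))
    ≈⟨ solve 6 (λ n a b c h d → n :* a :* b :* c :^ 3 :* (h :* d) := (n :* h) :* (a :* b :* d :* c :^ 3)) ≈-refl _ _ _ _ _ _ ⟩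
  N g ⊗ V 3 h ⊗ (W m ⊗ W (1 + m) ⊗ V 3 (W l) ⊗ W l ↑ 3)
    ≈⟨ ⊗-cong (N-∏W l) ≈-refl ⟩
  g ⊗ h ↑ 3 ⊗ (W m ⊗ W (1 + m) ⊗ V 3 (W l) ⊗ W l ↑ 3)
    ≈⟨ solve 6 (λ g h a b d c → g :* h :^ 3 :* (a :* b :* d :* c :^ 3) := g :* a :* b :* d :* (h :* c) :^ 3) ≈-refl _ _ _ _ _ _ ⟩
  g ⊗ W m ⊗ W (1 + m) ⊗ V 3 (W l) ⊗ (h ⊗ W l) ↑ 3
    ≈⟨ ⊗-cong split (↑-congˡ 3 (∏-snoc W 0 l)) ⟨
  ∏ W 0 (3 + m) ⊗ ∏ W 0 (suc l) ↑ 3 ∎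
  where
  open ≈R
  m = l * 3
  g = ∏ W 0 m
  h = ∏ W 0 l
  split : ∏ W 0 (3 + m) ≈ g ⊗ W m ⊗ W (1 + m) ⊗ V 3 (W l)
  split = ≈-trans (∏-snoc W 0 (2 + m)) (⊗-cong (≈-trans (∏-snoc W 0 (1 + m)) (⊗-cong (∏-snoc W 0 m) ≈-refl))
    (≈-trans (V-≡ {3 + m} {3 * suc l} w (ℕ.*-comm (suc l) 3)) (≈-sym (V-V 3 (suc l) w))))

Nθ⊗θ₃ : N θ ⊗ θ₃ ≈ θ ↑ 4
Nθ⊗θ₃ = ≈-from-≤ λ n →
  -- Up to degree n, the norm reads its argument up to degree 2 + 3n, which 3 (n + 1) factors cover.
  let m = suc n * 3
      bound : 2 + 3 * n ≤ m
      bound = ℕ.≤-trans (ℕ.≤-reflexive (cong (λ i → 2 + i) (ℕ.*-comm 3 n))) (ℕ.n≤1+n _)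
      n≤m : n ≤ m
      n≤m = ℕ.≤-trans (ℕ.n≤1+n n) (ℕ.m≤m*n (suc n) 3)
      small : θ ≈⟨≤ n ⟩ ∏ W 0 (suc n)
      small = θ-product n (suc n) (ℕ.n≤1+n n)
  in ≈⟨≤⟩-trans n (⊗-cong≤ n (N-cong≤ n (θ-product (2 + 3 * n) m bound)) (V-cong≤ 3 n small))
    (≈⟨≤⟩-trans n (≡⇒≈⟨≤⟩ n (N-∏W (suc n)))
      (≈⟨≤⟩-sym n (⊗-cong≤ n {θ} {∏ W 0 m} (θ-product n m n≤m)
        (⊗-cong≤ n {θ} {∏ W 0 (suc n)} small (⊗-cong≤ n {θ} {∏ W 0 (suc n)} small (⊗-cong≤ n {θ} {∏ W 0 (suc n)} small (≈⟨≤⟩-refl n)))))))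

Nθ : N θ ≈ θ₃ ↑ 3 ⊕ ⊖ (κ (+ 8) ⊗ X ⊗ a ↑ 3)
Nθ = ≈-trans (N-weave θ₃ (⊖ (κ (+ 2) ⊗ a)) (κ (+ 0)) (begin
  θ
    ≈⟨ θ-dissection₃ ⟩
  V 3 θ₃ ⊕ ⊖ (κ (+ 2) ⊗ X ⊗ V 3 a)
    ≈⟨ solve 3 (λ x d a → d :- con (+ 2) :* x :* a := d :+ x :* (:- (con (+ 2) :* a)) :+ x :* x :* con (+ 0)) ≈-refl X _ _ ⟩
  _ ≈⟨ ⊕-cong (⊕-cong ≈-refl (⊗-cong ≈-refl (V₃ 1 (λ a → :- (con (+ 2) :* a)) (≈-refl ∷ [])))) (⊗-cong ≈-refl (V-κ 3 (+ 0))) ⟨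
  weave₃ θ₃ (⊖ (κ (+ 2) ⊗ a)) (κ (+ 0)) ∎))
  (solve 3 (λ x d a → normᵖ x d (:- (con (+ 2) :* a)) (con (+ 0)) := d :^ 3 :- con (+ 8) :* x :* a :^ 3) ≈-refl X θ₃ a)
  where open ≈R

Nψ : N ψ ≈ A ↑ 3 ⊕ X ⊗ ψ₃ ↑ 3
Nψ = ≈-trans (N-weave A ψ₃ (κ (+ 0)) (begin
  ψ
    ≈⟨ ψ-dissection₃ ⟩
  V 3 A ⊕ X ⊗ V 3 ψ₃
    ≈⟨ solve 3 (λ x d a → d :+ x :* a := d :+ x :* a :+ x :* x :* con (+ 0)) ≈-refl X _ _ ⟩
  _ ≈⟨ ⊕-cong ≈-refl (⊗-cong ≈-refl (V-κ 3 (+ 0))) ⟨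
  weave₃ A ψ₃ (κ (+ 0)) ∎))
  (solve 3 (λ x d a → normᵖ x d a (con (+ 0)) := d :^ 3 :+ x :* a :^ 3) ≈-refl X A ψ₃)
  where open ≈R

unit-θ₃ : Unit θ₃
unit-θ₃ = unit-V 3 unit-θ

unit-ψ₃ : Unit ψ₃
unit-ψ₃ = unit-V 3 unit-ψ

unit-⊕X : ∀ {f} g → Unit f → Unit (f ⊕ X ⊗ g)
unit-⊕X g uf = unit (trans (⊕-at _ _ 0) (cong₂ _+ℤ_ (at0 uf) (X⊗-at0 g)))

-- The analogue for ψ is deduced from the one for θ: reflecting the latter gives the norm of φ, and
-- the norm of ψ² = φ ψ(q²) then shows that both sides x satisfy x² = φ⁴ x(q²).
Nψ⊗ψ₃ : N ψ ⊗ ψ₃ ≈ ψ ↑ 4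
Nψ⊗ψ₃ = V2-ratio-square {m = φ ↑ 4}
  (unit-⊗ (unit-cong Nψ (unit-⊕X _ (unit-↑ 3 unit-A))) unit-ψ₃)
  (unit-↑ 4 unit-ψ)
  (begin
    (N ψ ⊗ ψ₃) ↑ 2                      ≈⟨ solve 2 (λ x y → (x :* y) :^ 2 := x :* x :* y :^ 2) ≈-refl _ _ ⟩
    N ψ ⊗ N ψ ⊗ ψ₃ ↑ 2                  ≈⟨ ⊗-cong Nψ² ψ₃² ⟩
    N φ ⊗ V 2 (N ψ) ⊗ (φ₃ ⊗ V 2 ψ₃)     ≈⟨ solve 4 (λ a b c d → a :* b :* (c :* d) := a :* c :* (b :* d)) ≈-refl _ _ _ _ ⟩
    N φ ⊗ φ₃ ⊗ (V 2 (N ψ) ⊗ V 2 ψ₃)     ≈⟨ ⊗-cong Nφ⊗φ₃ (≈-sym (V-⊗ 2 _ _)) ⟩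
    φ ↑ 4 ⊗ V 2 (N ψ ⊗ ψ₃) ∎)
  (begin
    (ψ ↑ 4) ↑ 2                         ≈⟨ solve 1 (λ x → (x :^ 4) :^ 2 := (x :^ 2) :^ 4) ≈-refl ψ ⟩
    (ψ ↑ 2) ↑ 4                         ≈⟨ ↑-congˡ 4 ψ² ⟩
    (φ ⊗ V 2 ψ) ↑ 4                     ≈⟨ solve 2 (λ x y → (x :* y) :^ 4 := x :^ 4 :* y :^ 4) ≈-refl _ _ ⟩
    φ ↑ 4 ⊗ V 2 ψ ↑ 4                   ≈⟨ ⊗-cong ≈-refl (V₂ 1 (λ x → x :^ 4) (≈-refl ∷ [])) ⟨
    φ ↑ 4 ⊗ V 2 (ψ ↑ 4) ∎)
  where
  open ≈R
  Nψ² : N ψ ⊗ N ψ ≈ N φ ⊗ V 2 (N ψ)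
  Nψ² = begin
    N ψ ⊗ N ψ           ≈⟨ N-⊗ ψ ψ ⟨
    N (ψ ⊗ ψ)           ≈⟨ N-cong (solve 1 (λ x → x :* x := x :^ 2) ≈-refl ψ) ⟩
    N (ψ ↑ 2)           ≈⟨ N-cong ψ² ⟩
    N (φ ⊗ V 2 ψ)       ≈⟨ N-⊗ φ _ ⟩
    N φ ⊗ N (V 2 ψ)     ≈⟨ ⊗-cong ≈-refl (N-V2 ψ) ⟩
    N φ ⊗ V 2 (N ψ) ∎
  Nφ⊗φ₃ : N φ ⊗ φ₃ ≈ φ ↑ 4
  Nφ⊗φ₃ = begin
    N φ ⊗ φ₃            ≈⟨ ⊗-cong (≈-trans (≈-sym (N-ν θ)) (N-cong νθ)) νθ₃ ⟨
    ν (N θ) ⊗ ν θ₃      ≈⟨ ν-⊗ _ _ ⟨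
    ν (N θ ⊗ θ₃)        ≈⟨ ν-cong Nθ⊗θ₃ ⟩
    ν (θ ↑ 4)           ≈⟨ νʰ 1 (λ x → x :^ 4) (νθ ∷ []) ⟩
    φ ↑ 4 ∎

-- Product evaluations of `F` and `a`

unit-F : Unit F
unit-F = unit-cong (solve 4 (λ u c x y → u :* c :- con (+ 2) :* (x :* y) := u :* c :+ x :* (con (- (+ 2)) :* y)) ≈-refl _ _ _ _)
  (unit-⊕X _ (unit-⊗ (unit-V 2 unit-A) (unit-V 3 unit-φ)))

-- In the square, `V2F²` yields φ(-q³)³ + q a³. Multiplied by ψ(q³)³, and with φ(-q³) ψ(q³) = a A,
-- this is a³ (A³ + q ψ(q³)³), where the bracket is the norm of ψ.
V2F⊗ψ₃² : V 2 F ⊗ ψ₃ ↑ 2 ≈ a ↑ 2 ⊗ ψ ↑ 2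
V2F⊗ψ₃² = square-unit-cancel (unit-⊗ (unit-V 2 unit-F) (unit-↑ 2 unit-ψ₃)) (unit-⊗ (unit-↑ 2 unit-a) (unit-↑ 2 unit-ψ)) (begin
  (V 2 F ⊗ ψ₃ ↑ 2) ↑ 2
    ≈⟨ solve 2 (λ f p → (f :* p :^ 2) :^ 2 := f :^ 2 :* p :^ 4) ≈-refl (V 2 F) ψ₃ ⟩
  V 2 F ↑ 2 ⊗ ψ₃ ↑ 4
    ≈⟨ ⊗-cong V2F² ≈-refl ⟩
  a ⊗ (θ₃ ↑ 3 ⊕ X ⊗ a ↑ 3) ⊗ ψ₃ ↑ 4
    ≈⟨ solve 4 (λ a d x p → a :* (d :^ 3 :+ x :* a :^ 3) :* p :^ 4 := a :* (((d :* p) :^ 3 :+ x :* (a :* p) :^ 3) :* p)) ≈-refl a θ₃ X ψ₃ ⟩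
  a ⊗ (((θ₃ ⊗ ψ₃) ↑ 3 ⊕ X ⊗ (a ⊗ ψ₃) ↑ 3) ⊗ ψ₃)
    ≈⟨ ⊗-cong ≈-refl (⊗-cong (⊕-cong (↑-congˡ 3 a⊗A) ≈-refl) ≈-refl) ⟨
  a ⊗ (((a ⊗ A) ↑ 3 ⊕ X ⊗ (a ⊗ ψ₃) ↑ 3) ⊗ ψ₃)
    ≈⟨ solve 4 (λ a b x p → a :* (((a :* b) :^ 3 :+ x :* (a :* p) :^ 3) :* p) := a :^ 4 :* ((b :^ 3 :+ x :* p :^ 3) :* p)) ≈-refl a A X ψ₃ ⟩
  a ↑ 4 ⊗ ((A ↑ 3 ⊕ X ⊗ ψ₃ ↑ 3) ⊗ ψ₃)
    ≈⟨ ⊗-cong ≈-refl (≈-trans (⊗-cong (≈-sym Nψ) ≈-refl) Nψ⊗ψ₃) ⟩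
  a ↑ 4 ⊗ ψ ↑ 4
    ≈⟨ solve 2 (λ a p → a :^ 4 :* p :^ 4 := (a :^ 2 :* p :^ 2) :^ 2) ≈-refl a ψ ⟩
  (a ↑ 2 ⊗ ψ ↑ 2) ↑ 2 ∎)
  where open ≈R

-- That is, a(q) ψ(q)/ψ(q³) = f₂ is an even function of q.
aψ/ψ₃-even : a ⊗ ψ ⊗ ν ψ₃ ≈ a⁺ ⊗ ν ψ ⊗ ψ₃
aψ/ψ₃-even = square-unit-cancel
  (unit-⊗ (unit-⊗ unit-a unit-ψ) (unit-ν unit-ψ₃)) (unit-⊗ (unit-⊗ unit-a⁺ (unit-ν unit-ψ)) unit-ψ₃) (begin
  (a ⊗ ψ ⊗ ν ψ₃) ↑ 2              ≈⟨ solve 3 (λ a p q → (a :* p :* q) :^ 2 := a :^ 2 :* p :^ 2 :* q :^ 2) ≈-refl a ψ (ν ψ₃) ⟩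
  a ↑ 2 ⊗ ψ ↑ 2 ⊗ ν ψ₃ ↑ 2        ≈⟨ ⊗-cong V2F⊗ψ₃² ≈-refl ⟨
  V 2 F ⊗ ψ₃ ↑ 2 ⊗ ν ψ₃ ↑ 2       ≈⟨ solve 3 (λ f p q → f :* p :^ 2 :* q :^ 2 := f :* q :^ 2 :* p :^ 2) ≈-refl (V 2 F) ψ₃ (ν ψ₃) ⟩
  V 2 F ⊗ ν ψ₃ ↑ 2 ⊗ ψ₃ ↑ 2       ≈⟨ ⊗-cong reflected ≈-refl ⟩
  a⁺ ↑ 2 ⊗ ν ψ ↑ 2 ⊗ ψ₃ ↑ 2       ≈⟨ solve 3 (λ a p q → a :^ 2 :* p :^ 2 :* q :^ 2 := (a :* p :* q) :^ 2) ≈-refl a⁺ (ν ψ) ψ₃ ⟩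
  (a⁺ ⊗ ν ψ ⊗ ψ₃) ↑ 2 ∎)
  where
  open ≈R
  reflected : V 2 F ⊗ ν ψ₃ ↑ 2 ≈ a⁺ ↑ 2 ⊗ ν ψ ↑ 2
  reflected = begin
    V 2 F ⊗ ν ψ₃ ↑ 2       ≈⟨ νʰ 2 (λ f p → f :* p :^ 2) (ν-V2 F ∷ ≈-refl ∷ []) ⟨
    ν (V 2 F ⊗ ψ₃ ↑ 2)     ≈⟨ ν-cong V2F⊗ψ₃² ⟩
    ν (a ↑ 2 ⊗ ψ ↑ 2)      ≈⟨ νʰ 2 (λ a p → a :^ 2 :* p :^ 2) (νa ∷ ≈-refl ∷ []) ⟩
    a⁺ ↑ 2 ⊗ ν ψ ↑ 2 ∎

-- F(q²) is the square of a ψ/ψ(q³). Evenness allows one of the two factors to be replaced by its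
-- reflection; the products a a⁺, ψ `ν ψ` and ψ₃ `ν ψ₃` are all series in q², so exponents can be
-- halved.
F⊗ψ₃ : F ⊗ ψ₃ ≈ a ⊗ θ ⊗ ψ
F⊗ψ₃ = V-injective 2 (unit-cancel (V 2 θ₃) (unit-V 2 unit-θ₃) (unit-cancel ψ₃ unit-ψ₃ (begin
  ψ₃ ⊗ (V 2 θ₃ ⊗ V 2 (F ⊗ ψ₃))
    ≈⟨ ⊗-cong ≈-refl (⊗-cong ≈-refl (V-⊗ 2 F ψ₃)) ⟩
  ψ₃ ⊗ (V 2 θ₃ ⊗ (V 2 F ⊗ V 2 ψ₃))
    ≈⟨ solve 4 (λ p d f q → p :* (d :* (f :* q)) := f :* p :* (d :* q)) ≈-refl _ _ _ _ ⟩
  V 2 F ⊗ ψ₃ ⊗ (V 2 θ₃ ⊗ V 2 ψ₃)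
    ≈⟨ ⊗-cong ≈-refl ψ₃⊗νψ₃ ⟨
  V 2 F ⊗ ψ₃ ⊗ (ψ₃ ⊗ ν ψ₃)
    ≈⟨ solve 3 (λ f p q → f :* p :* (p :* q) := f :* p :^ 2 :* q) ≈-refl _ _ _ ⟩
  V 2 F ⊗ ψ₃ ↑ 2 ⊗ ν ψ₃
    ≈⟨ ⊗-cong V2F⊗ψ₃² ≈-refl ⟩
  a ↑ 2 ⊗ ψ ↑ 2 ⊗ ν ψ₃
    ≈⟨ solve 3 (λ a p q → a :^ 2 :* p :^ 2 :* q := a :* p :* (a :* p :* q)) ≈-refl a ψ (ν ψ₃) ⟩
  a ⊗ ψ ⊗ (a ⊗ ψ ⊗ ν ψ₃)
    ≈⟨ ⊗-cong ≈-refl aψ/ψ₃-even ⟩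
  a ⊗ ψ ⊗ (a⁺ ⊗ ν ψ ⊗ ψ₃)
    ≈⟨ solve 5 (λ a p b q r → a :* p :* (b :* q :* r) := r :* (a :* b :* (p :* q))) ≈-refl a ψ a⁺ (ν ψ) ψ₃ ⟩
  ψ₃ ⊗ (a ⊗ a⁺ ⊗ (ψ ⊗ ν ψ))
    ≈⟨ ⊗-cong ≈-refl (⊗-cong a⊗a⁺ ψ⊗νψ) ⟩
  ψ₃ ⊗ (V 2 a ⊗ V 2 θ₃ ⊗ (V 2 θ ⊗ V 2 ψ))
    ≈⟨ ⊗-cong ≈-refl (solve 4 (λ a d t p → a :* d :* (t :* p) := d :* (a :* t :* p)) ≈-refl _ _ _ _) ⟩
  ψ₃ ⊗ (V 2 θ₃ ⊗ (V 2 a ⊗ V 2 θ ⊗ V 2 ψ))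
    ≈⟨ ⊗-cong ≈-refl (⊗-cong ≈-refl (V₂ 3 (λ a t p → a :* t :* p) (≈-refl ∷ ≈-refl ∷ ≈-refl ∷ []))) ⟨
  ψ₃ ⊗ (V 2 θ₃ ⊗ V 2 (a ⊗ θ ⊗ ψ)) ∎)))
  where
  open ≈R
  ψ₃⊗νψ₃ : ψ₃ ⊗ ν ψ₃ ≈ V 2 θ₃ ⊗ V 2 ψ₃
  ψ₃⊗νψ₃ = begin
    ψ₃ ⊗ ν ψ₃             ≈⟨ ⊗-cong ≈-refl (ν-V3 ψ) ⟩
    ψ₃ ⊗ V 3 (ν ψ)        ≈⟨ V-⊗ 3 _ _ ⟨
    V 3 (ψ ⊗ ν ψ)         ≈⟨ V-cong 3 ψ⊗νψ ⟩
    V 3 (V 2 θ ⊗ V 2 ψ)   ≈⟨ V₃ 2 (λ x y → x :* y) (V3-V2 θ ∷ V3-V2 ψ ∷ []) ⟩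
    V 2 θ₃ ⊗ V 2 ψ₃ ∎

F² : F ↑ 2 ≈ V 2 F ⊗ θ ↑ 2
F² = unit-cancel (ψ₃ ↑ 2) (unit-↑ 2 unit-ψ₃) (begin
  ψ₃ ↑ 2 ⊗ F ↑ 2            ≈⟨ solve 2 (λ p f → p :^ 2 :* f :^ 2 := (f :* p) :^ 2) ≈-refl ψ₃ F ⟩
  (F ⊗ ψ₃) ↑ 2              ≈⟨ ↑-congˡ 2 F⊗ψ₃ ⟩
  (a ⊗ θ ⊗ ψ) ↑ 2           ≈⟨ solve 3 (λ a t p → (a :* t :* p) :^ 2 := a :^ 2 :* p :^ 2 :* t :^ 2) ≈-refl a θ ψ ⟩
  a ↑ 2 ⊗ ψ ↑ 2 ⊗ θ ↑ 2     ≈⟨ ⊗-cong V2F⊗ψ₃² ≈-refl ⟨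
  V 2 F ⊗ ψ₃ ↑ 2 ⊗ θ ↑ 2    ≈⟨ solve 3 (λ f p t → f :* p :^ 2 :* t :^ 2 := p :^ 2 :* (f :* t :^ 2)) ≈-refl _ ψ₃ θ ⟩
  ψ₃ ↑ 2 ⊗ (V 2 F ⊗ θ ↑ 2) ∎)
  where open ≈R

-- This is f₁⁶ in terms of φ(-q) = f₁²/f₂ and ψ = f₂²/f₁. Both sides x satisfy x² = φ(-q)⁶ x(q²).
F³ : F ↑ 3 ≈ θ ↑ 4 ⊗ ψ ↑ 2
F³ = V2-ratio-square {m = θ ↑ 6} (unit-↑ 3 unit-F) (unit-⊗ (unit-↑ 4 unit-θ) (unit-↑ 2 unit-ψ))
  (begin
    (F ↑ 3) ↑ 2                       ≈⟨ solve 1 (λ f → (f :^ 3) :^ 2 := (f :^ 2) :^ 3) ≈-refl F ⟩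
    (F ↑ 2) ↑ 3                       ≈⟨ ↑-congˡ 3 F² ⟩
    (V 2 F ⊗ θ ↑ 2) ↑ 3               ≈⟨ solve 2 (λ f t → (f :* t :^ 2) :^ 3 := t :^ 6 :* f :^ 3) ≈-refl (V 2 F) θ ⟩
    θ ↑ 6 ⊗ V 2 F ↑ 3                 ≈⟨ ⊗-cong ≈-refl (V₂ 1 (λ f → f :^ 3) (≈-refl ∷ [])) ⟨
    θ ↑ 6 ⊗ V 2 (F ↑ 3) ∎)
  (begin
    (θ ↑ 4 ⊗ ψ ↑ 2) ↑ 2               ≈⟨ ↑-congˡ 2 (⊗-cong ≈-refl ψ²) ⟩
    (θ ↑ 4 ⊗ (φ ⊗ V 2 ψ)) ↑ 2         ≈⟨ solve 3 (λ t f p → (t :^ 4 :* (f :* p)) :^ 2 := t :^ 6 :* ((f :* t) :^ 2 :* p :^ 2)) ≈-refl θ φ (V 2 ψ) ⟩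
    θ ↑ 6 ⊗ ((φ ⊗ θ) ↑ 2 ⊗ V 2 ψ ↑ 2) ≈⟨ ⊗-cong ≈-refl (⊗-cong (↑-congˡ 2 φ⊗θ) ≈-refl) ⟩
    θ ↑ 6 ⊗ ((V 2 θ ⊗ V 2 θ) ↑ 2 ⊗ V 2 ψ ↑ 2)
      ≈⟨ ⊗-cong ≈-refl (≈-trans (solve 2 (λ t p → (t :* t) :^ 2 :* p :^ 2 := t :^ 4 :* p :^ 2) ≈-refl (V 2 θ) (V 2 ψ))
           (≈-sym (V₂ 2 (λ t p → t :^ 4 :* p :^ 2) (≈-refl ∷ ≈-refl ∷ [])))) ⟩
    θ ↑ 6 ⊗ V 2 (θ ↑ 4 ⊗ ψ ↑ 2) ∎)
  where open ≈R

-- Evaluates a as f₁ f₆²/(f₂ f₃). In the square, `V2F⊗ψ₃²` trades a² ψ² for F(q²) ψ(q³)², and the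
-- resulting F(q²)³ is known from `F³`.
V2F⊗a : V 2 F ⊗ a ≈ θ ⊗ ψ ⊗ ψ₃
V2F⊗a = square-unit-cancel (unit-⊗ (unit-V 2 unit-F) unit-a) (unit-⊗ (unit-⊗ unit-θ unit-ψ) unit-ψ₃)
  (unit-cancel (ψ ↑ 2) (unit-↑ 2 unit-ψ) (begin
  ψ ↑ 2 ⊗ (V 2 F ⊗ a) ↑ 2          ≈⟨ solve 3 (λ p f a → p :^ 2 :* (f :* a) :^ 2 := f :^ 2 :* (a :^ 2 :* p :^ 2)) ≈-refl ψ (V 2 F) a ⟩
  V 2 F ↑ 2 ⊗ (a ↑ 2 ⊗ ψ ↑ 2)      ≈⟨ ⊗-cong ≈-refl V2F⊗ψ₃² ⟨
  V 2 F ↑ 2 ⊗ (V 2 F ⊗ ψ₃ ↑ 2)     ≈⟨ solve 2 (λ f p → f :^ 2 :* (f :* p :^ 2) := f :^ 3 :* p :^ 2) ≈-refl (V 2 F) ψ₃ ⟩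
  V 2 F ↑ 3 ⊗ ψ₃ ↑ 2               ≈⟨ ⊗-cong V2F³ ≈-refl ⟩
  θ ↑ 2 ⊗ ψ ↑ 4 ⊗ ψ₃ ↑ 2           ≈⟨ solve 3 (λ t p q → t :^ 2 :* p :^ 4 :* q :^ 2 := p :^ 2 :* (t :* p :* q) :^ 2) ≈-refl θ ψ ψ₃ ⟩
  ψ ↑ 2 ⊗ (θ ⊗ ψ ⊗ ψ₃) ↑ 2 ∎))
  where
  open ≈R
  V2F³ : V 2 F ↑ 3 ≈ θ ↑ 2 ⊗ ψ ↑ 4
  V2F³ = begin
    V 2 F ↑ 3                        ≈⟨ V₂ 1 (λ f → f :^ 3) (≈-refl ∷ []) ⟨
    V 2 (F ↑ 3)                      ≈⟨ V-cong 2 F³ ⟩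
    V 2 (θ ↑ 4 ⊗ ψ ↑ 2)              ≈⟨ V₂ 2 (λ t p → t :^ 4 :* p :^ 2) (≈-refl ∷ ≈-refl ∷ []) ⟩
    V 2 θ ↑ 4 ⊗ V 2 ψ ↑ 2            ≈⟨ solve 2 (λ t p → t :^ 4 :* p :^ 2 := (t :* t) :^ 2 :* p :^ 2) ≈-refl (V 2 θ) (V 2 ψ) ⟩
    (V 2 θ ⊗ V 2 θ) ↑ 2 ⊗ V 2 ψ ↑ 2  ≈⟨ ⊗-cong (↑-congˡ 2 φ⊗θ) ≈-refl ⟨
    (φ ⊗ θ) ↑ 2 ⊗ V 2 ψ ↑ 2          ≈⟨ solve 3 (λ f t p → (f :* t) :^ 2 :* p :^ 2 := t :^ 2 :* (f :* p) :^ 2) ≈-refl φ θ (V 2 ψ) ⟩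
    θ ↑ 2 ⊗ (φ ⊗ V 2 ψ) ↑ 2          ≈⟨ ⊗-cong ≈-refl (↑-congˡ 2 ψ²) ⟨
    θ ↑ 2 ⊗ (ψ ↑ 2) ↑ 2              ≈⟨ solve 2 (λ t p → t :^ 2 :* (p :^ 2) :^ 2 := t :^ 2 :* p :^ 4) ≈-refl θ ψ ⟩
    θ ↑ 2 ⊗ ψ ↑ 4 ∎

-- The odd part of the generating function and its sections modulo 3

S⊗V2θ : S ⊗ V 2 (θ ⊗ V 3 θ₃) ≈ φ ⊗ V 3 θ₃
S⊗V2θ = begin
  S ⊗ V 2 (θ ⊗ V 3 θ₃)
    ≈⟨ ⊗-cong ≈-refl (V₂ 2 (λ x y → x :* y) (≈-refl ∷ ≈-sym V9V2θ ∷ [])) ⟩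
  S ⊗ (V 2 θ ⊗ V 3 (V 3 (V 2 θ)))
    ≈⟨ ⊗-cong ≈-refl (⊗-cong ≈-refl (V-cong 3 (V-cong 3 (≈-sym gauss)))) ⟩
  S ⊗ (V 2 θ ⊗ V 3 (V 3 (θ ⊗ P)))
    ≈⟨ ⊗-cong ≈-refl (⊗-cong ≈-refl (≈-trans (V-cong 3 (V-⊗ 3 θ P)) (V-⊗ 3 _ _))) ⟩
  S ⊗ (V 2 θ ⊗ (V 3 θ₃ ⊗ V 3 (V 3 P)))
    ≈⟨ solve 4 (λ s t u p → s :* (t :* (u :* p)) := s :* p :* t :* u) ≈-refl S (V 2 θ) (V 3 θ₃) _ ⟩
  S ⊗ V 3 (V 3 P) ⊗ V 2 θ ⊗ V 3 θ₃
    ≈⟨ ⊗-cong (⊗-cong S⊗V9P ≈-refl) ≈-refl ⟩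
  P ⊗ V 2 θ ⊗ V 3 θ₃
    ≈⟨ ⊗-cong P⊗V2θ ≈-refl ⟩
  φ ⊗ V 3 θ₃ ∎
  where
  open ≈R
  V9V2θ : V 3 (V 3 (V 2 θ)) ≈ V 2 (V 3 θ₃)
  V9V2θ = ≈-trans (V-cong 3 (V3-V2 θ)) (V3-V2 θ₃)

O : PS
O = sec 2 1 S

weave₂-expand : ∀ f → f ≈ weave₂ (sec 2 0 f) (sec 2 1 f)
weave₂-expand f = weave₂-sec ≈-refl ≈-refl

-- The multiplier of `S` in `S⊗V2θ` is even, so only the odd part of φ(q) φ(-q⁹) is wanted. By the
-- 3-dissection of φ this product is φ(-q¹⁸)² + 2q (a⁺ φ(-q³))(q³), and `a⁺⊗θ₃` splits the last
-- factor by parity.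
O⊗θ : O ⊗ θ ⊗ V 3 θ₃ ≈ κ (+ 2) ⊗ V 3 (V 2 F)
O⊗θ = ≈-trans (≈-sym (sec-weave₂-1 (sec 2 0 S ⊗ (θ ⊗ V 3 θ₃)) (O ⊗ θ ⊗ V 3 θ₃)))
  (≈-trans (sec-cong 2 1 both) (sec-weave₂-1 (V 3 (θ₃ ↑ 2) ⊕ κ (+ 2) ⊗ (X ↑ 2 ⊗ V 3 (a ↑ 2))) _))
  where
  open ≈R
  both : weave₂ (sec 2 0 S ⊗ (θ ⊗ V 3 θ₃)) (O ⊗ θ ⊗ V 3 θ₃)
       ≈ weave₂ (V 3 (θ₃ ↑ 2) ⊕ κ (+ 2) ⊗ (X ↑ 2 ⊗ V 3 (a ↑ 2))) (κ (+ 2) ⊗ V 3 (V 2 F))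
  both = begin
    weave₂ (sec 2 0 S ⊗ (θ ⊗ V 3 θ₃)) (O ⊗ θ ⊗ V 3 θ₃)
      ≈⟨ ⊕-cong (V-⊗ 2 _ _) (⊗-cong ≈-refl (V-cong 2 (solve 3 (λ o t d → o :* t :* d := o :* (t :* d)) ≈-refl O θ _))) ⟩
    _ ≈⟨ ⊕-cong ≈-refl (⊗-cong ≈-refl (V-⊗ 2 O _)) ⟩
    V 2 (sec 2 0 S) ⊗ V 2 (θ ⊗ V 3 θ₃) ⊕ X ⊗ (V 2 O ⊗ V 2 (θ ⊗ V 3 θ₃))
      ≈⟨ solve 4 (λ x e o d → e :* d :+ x :* (o :* d) := (e :+ x :* o) :* d) ≈-refl X _ _ _ ⟩
    weave₂ (sec 2 0 S) O ⊗ V 2 (θ ⊗ V 3 θ₃)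
      ≈⟨ ⊗-cong (weave₂-expand S) ≈-refl ⟨
    S ⊗ V 2 (θ ⊗ V 3 θ₃)
      ≈⟨ S⊗V2θ ⟩
    φ ⊗ V 3 θ₃
      ≈⟨ ⊗-cong φ-dissection₃ ≈-refl ⟩
    (V 3 φ₃ ⊕ κ (+ 2) ⊗ X ⊗ V 3 a⁺) ⊗ V 3 θ₃
      ≈⟨ solve 4 (λ c x a d → (c :+ con (+ 2) :* x :* a) :* d := c :* d :+ con (+ 2) :* x :* (a :* d)) ≈-refl _ X _ _ ⟩
    V 3 φ₃ ⊗ V 3 θ₃ ⊕ κ (+ 2) ⊗ X ⊗ (V 3 a⁺ ⊗ V 3 θ₃)
      ≈⟨ ⊕-cong (V-⊗ 3 _ _) (⊗-cong ≈-refl (V-⊗ 3 _ _)) ⟨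
    V 3 (φ₃ ⊗ θ₃) ⊕ κ (+ 2) ⊗ X ⊗ V 3 (a⁺ ⊗ θ₃)
      ≈⟨ ⊕-cong (V-cong 3 (≈-trans φ₃⊗θ₃ (≈-sym (V₂ 1 (λ x → x :^ 2) (≈-refl ∷ []))))) (⊗-cong ≈-refl (V-cong 3 a⁺⊗θ₃)) ⟩
    V 3 (V 2 (θ₃ ↑ 2)) ⊕ κ (+ 2) ⊗ X ⊗ V 3 (V4F ⊕ X ⊗ V 2 a ↑ 2)
      ≈⟨ ⊕-cong (V3-V2 _) (⊗-cong ≈-refl (V₃ 3 (λ f x a → f :+ x :* a) (V3-V2 (V 2 F) ∷ X³ ∷
           ≈-trans (V-cong 3 (≈-sym (V₂ 1 (λ x → x :^ 2) (≈-refl ∷ [])))) (V3-V2 (a ↑ 2)) ∷ []))) ⟩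
    V 2 (V 3 (θ₃ ↑ 2)) ⊕ κ (+ 2) ⊗ X ⊗ (V 2 (V 3 (V 2 F)) ⊕ X ⊗ (X ⊗ X) ⊗ V 2 (V 3 (a ↑ 2)))
      ≈⟨ solve 4 (λ x d f a → d :+ con (+ 2) :* x :* (f :+ x :* (x :* x) :* a)
           := (d :+ con (+ 2) :* ((x :* x) :^ 2 :* a)) :+ x :* (con (+ 2) :* f)) ≈-refl X _ _ _ ⟩
    _ ≈⟨ ⊕-cong (V₂ 3 (λ d x a → d :+ con (+ 2) :* (x :^ 2 :* a)) (≈-refl ∷ X² ∷ ≈-refl ∷ []))
           (⊗-cong ≈-refl (V₂ 1 (λ f → con (+ 2) :* f) (≈-refl ∷ []))) ⟨
    weave₂ (V 3 (θ₃ ↑ 2) ⊕ κ (+ 2) ⊗ (X ↑ 2 ⊗ V 3 (a ↑ 2))) (κ (+ 2) ⊗ V 3 (V 2 F)) ∎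

-- Rationalises the denominator of O = 2 F(q⁶)/(φ(-q) φ(-q⁹)). With φ(-q) = d - 2q α, the conjugate
-- d² + 2q α d + 4q² α² completes φ(-q) to the norm, and the norm times φ(-q⁹) is φ(-q³)⁴, which
-- lies in class 0.
O-weave : weave₃ (sec 3 0 O ⊗ θ ↑ 4) (sec 3 1 O ⊗ θ ↑ 4) (sec 3 2 O ⊗ θ ↑ 4)
        ≈ weave₃ (κ (+ 2) ⊗ (V 2 F ⊗ θ₃ ↑ 2)) (κ (+ 4) ⊗ (V 2 F ⊗ a ⊗ θ₃)) (κ (+ 8) ⊗ (V 2 F ⊗ a ↑ 2))
O-weave = begin
  weave₃ (sec 3 0 O ⊗ θ ↑ 4) (sec 3 1 O ⊗ θ ↑ 4) (sec 3 2 O ⊗ θ ↑ 4)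
    ≈⟨ ⊕-cong (⊕-cong (V-⊗ 3 _ _) (⊗-cong ≈-refl (V-⊗ 3 _ _))) (⊗-cong ≈-refl (V-⊗ 3 _ _)) ⟩
  _ ≈⟨ solve 5 (λ x a b c t → a :* t :+ x :* (b :* t) :+ x :* x :* (c :* t) := (a :+ x :* b :+ x :* x :* c) :* t) ≈-refl X _ _ _ _ ⟩
  weave₃ (sec 3 0 O) (sec 3 1 O) (sec 3 2 O) ⊗ V 3 (θ ↑ 4)
    ≈⟨ ⊗-cong (≈-sym (weave₃-expand O)) (V-cong 3 (≈-trans (≈-sym Nθ⊗θ₃) (⊗-cong Nθ ≈-refl))) ⟩
  O ⊗ V 3 ((θ₃ ↑ 3 ⊕ ⊖ (κ (+ 8) ⊗ X ⊗ a ↑ 3)) ⊗ θ₃)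
    ≈⟨ ⊗-cong ≈-refl (V₃ 3 (λ d x a → (d :^ 3 :- con (+ 8) :* x :* a :^ 3) :* d) (≈-refl ∷ X³ ∷ ≈-refl ∷ [])) ⟩
  O ⊗ ((D₃ ↑ 3 ⊕ ⊖ (κ (+ 8) ⊗ (X ⊗ (X ⊗ X)) ⊗ α ↑ 3)) ⊗ D₃)
    ≈⟨ solve 4 (λ o d x a → o :* ((d :^ 3 :- con (+ 8) :* (x :* (x :* x)) :* a :^ 3) :* d)
         := o :* (d :- con (+ 2) :* x :* a) :* d :* (d :^ 2 :+ con (+ 2) :* x :* (a :* d) :+ con (+ 4) :* (x :* x) :* a :^ 2)) ≈-refl O D₃ X α ⟩
  O ⊗ (D₃ ⊕ ⊖ (κ (+ 2) ⊗ X ⊗ α)) ⊗ D₃ ⊗ conj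
    ≈⟨ ⊗-cong (⊗-cong (⊗-cong ≈-refl θ-dissection₃) ≈-refl) ≈-refl ⟨
  O ⊗ θ ⊗ D₃ ⊗ conj
    ≈⟨ ⊗-cong O⊗θ ≈-refl ⟩
  κ (+ 2) ⊗ V 3 (V 2 F) ⊗ conj
    ≈⟨ solve 4 (λ f d x a → con (+ 2) :* f :* (d :^ 2 :+ con (+ 2) :* x :* (a :* d) :+ con (+ 4) :* (x :* x) :* a :^ 2)
         := con (+ 2) :* (f :* d :^ 2) :+ x :* (con (+ 4) :* (f :* a :* d)) :+ x :* x :* (con (+ 8) :* (f :* a :^ 2))) ≈-refl _ D₃ X α ⟩
  _ ≈⟨ ⊕-cong (⊕-cong (V₃ 2 (λ f d → con (+ 2) :* (f :* d :^ 2)) (≈-refl ∷ ≈-refl ∷ []))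
         (⊗-cong ≈-refl (V₃ 3 (λ f a d → con (+ 4) :* (f :* a :* d)) (≈-refl ∷ ≈-refl ∷ ≈-refl ∷ []))))
         (⊗-cong ≈-refl (V₃ 2 (λ f a → con (+ 8) :* (f :* a :^ 2)) (≈-refl ∷ ≈-refl ∷ []))) ⟨
  weave₃ (κ (+ 2) ⊗ (V 2 F ⊗ θ₃ ↑ 2)) (κ (+ 4) ⊗ (V 2 F ⊗ a ⊗ θ₃)) (κ (+ 8) ⊗ (V 2 F ⊗ a ↑ 2)) ∎
  where
  open ≈R
  D₃ = V 3 θ₃
  α = V 3 a
  conj : PS
  conj = D₃ ↑ 2 ⊕ κ (+ 2) ⊗ X ⊗ (α ⊗ D₃) ⊕ κ (+ 4) ⊗ (X ⊗ X) ⊗ α ↑ 2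

-- Congruences

infix 4 _≈_mod_
_≈_mod_ : PS → PS → ℤ → Set
f ≈ g mod m = ∃ λ r → f ≈ g ⊕ κ m ⊗ r

y⁺ : PS
y⁺ zero    = + 0
y⁺ (suc n) = □ (suc n)

φ-mod-2 : φ ≈ κ (+ 1) ⊕ κ (+ 2) ⊗ y⁺
at φ-mod-2 zero    = sym (trans (⊕-at _ _ 0) (cong₂ _+ℤ_ (κ-at0 (+ 1)) (κ⊗-at (+ 2) y⁺ 0)))
at φ-mod-2 (suc n) = sym (trans (⊕-at _ _ (suc n)) (trans (cong₂ _+ℤ_ (κ-suc (+ 1) n) (κ⊗-at (+ 2) y⁺ (suc n))) (ℤ.+-identityˡ _)))

y : PS
y = ν y⁺

θ-mod-2 : θ ≈ κ (+ 1) ⊕ κ (+ 2) ⊗ y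
θ-mod-2 = ≈-trans (ν-cong φ-mod-2) (νʰ 1 (λ y → con (+ 1) :+ con (+ 2) :* y) (≈-refl ∷ []))

-- The binomial terms 8y, 24y², 32y³, 16y⁴ of (1 + 2y)⁴, divided by 8.
z : PS
z = y ⊕ κ (+ 3) ⊗ y ↑ 2 ⊕ κ (+ 4) ⊗ y ↑ 3 ⊕ κ (+ 2) ⊗ y ↑ 4

θ⁴ : θ ↑ 4 ≈ κ (+ 1) ⊕ κ (+ 8) ⊗ z
θ⁴ = ≈-trans (↑-congˡ 4 θ-mod-2) (solve 1 (λ y → (con (+ 1) :+ con (+ 2) :* y) :^ 4
  := con (+ 1) :+ con (+ 8) :* (y :+ con (+ 3) :* y :^ 2 :+ con (+ 4) :* y :^ 3 :+ con (+ 2) :* y :^ 4)) ≈-refl y)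

-- Multiplication by 1 - 8z inverts θ⁴ = 1 + 8z up to 1 - 64 z², whence the remainder z² f.
θ⁴-cancel : ∀ {f g} n → f ⊗ θ ↑ 4 ≈ κ (+ n) ⊗ g → f ≈ κ (+ n) ⊗ (g ⊕ ⊖ (κ (+ 8) ⊗ z ⊗ g)) mod + 64
θ⁴-cancel {f} {g} n e = z ⊗ z ⊗ f , lc (⊕-cong eq (⊖-cong (⊗-cong (≈-refl {κ (+ 8) ⊗ z}) eq)))
  (solve 4 (λ f g z c → f :+ (c :* g :- con (+ 8) :* z :* (c :* g))
     := (c :* (g :- con (+ 8) :* z :* g) :+ con (+ 64) :* (z :* z :* f))
        :+ (f :* (con (+ 1) :+ con (+ 8) :* z) :- con (+ 8) :* z :* (f :* (con (+ 1) :+ con (+ 8) :* z)))) ≈-refl f g z (κ (+ n)))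
  where
  eq : f ⊗ (κ (+ 1) ⊕ κ (+ 8) ⊗ z) ≈ κ (+ n) ⊗ g
  eq = ≈-trans (⊗-cong ≈-refl (≈-sym θ⁴)) e

-- The factor φ(-q³)² = (1 + 2s)² is 1 modulo 4, so with the leading 2 only F(q²) survives modulo 8.
o₀≈ : sec 3 0 O ≈ κ (+ 2) ⊗ V 2 F mod + 8
o₀≈ = let (r , e) = θ⁴-cancel 2 (proj₁ (weave₃-injective O-weave)) in
  _ , ≈-trans e (≈-trans (⊕-cong (⊗-cong ≈-refl (⊕-cong sq (⊖-cong (⊗-cong ≈-refl sq)))) ≈-refl)
    (solve 4 (λ f s z r → con (+ 2) :* (f :* (con (+ 1) :+ con (+ 2) :* s) :^ 2 :- con (+ 8) :* z :* (f :* (con (+ 1) :+ con (+ 2) :* s) :^ 2)) :+ con (+ 64) :* r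
       := con (+ 2) :* f :+ con (+ 8) :* (f :* (s :+ s :^ 2) :- con (+ 2) :* z :* (f :* (con (+ 1) :+ con (+ 2) :* s) :^ 2) :+ con (+ 8) :* r))
       ≈-refl (V 2 F) (V 3 y) z r))
  where
  sq : V 2 F ⊗ θ₃ ↑ 2 ≈ V 2 F ⊗ (κ (+ 1) ⊕ κ (+ 2) ⊗ V 3 y) ↑ 2
  sq = ⊗-cong ≈-refl (↑-congˡ 2 (≈-trans (V-cong 3 θ-mod-2) (V₃ 1 (λ y → con (+ 1) :+ con (+ 2) :* y) (≈-refl ∷ []))))

-- H = f₁ f₂ f₃ f₆.
H : PS
H = θ ⊗ ψ ⊗ (θ₃ ⊗ ψ₃)

G : PS
G = V 2 F ⊗ a ↑ 2

G-product : G ≈ a ⊗ (θ ⊗ ψ ⊗ ψ₃)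
G-product = ≈-trans (solve 2 (λ f a → f :* a :^ 2 := a :* (f :* a)) ≈-refl (V 2 F) a) (⊗-cong ≈-refl V2F⊗a)

o₁≈ : sec 3 1 O ≈ κ (+ 4) ⊗ H mod + 32
o₁≈ = let (r , e) = θ⁴-cancel 4 (≈-trans (proj₁ (proj₂ (weave₃-injective O-weave))) (⊗-cong ≈-refl H-product)) in
  _ , ≈-trans e (solve 3 (λ h z r → con (+ 4) :* (h :- con (+ 8) :* z :* h) :+ con (+ 64) :* r
    := con (+ 4) :* h :+ con (+ 32) :* (con (+ 2) :* r :- z :* h)) ≈-refl H z r)
  where
  H-product : V 2 F ⊗ a ⊗ θ₃ ≈ H
  H-product = ≈-trans (⊗-cong V2F⊗a ≈-refl) (solve 4 (λ t p q d → t :* p :* q :* d := t :* p :* (d :* q)) ≈-refl θ ψ ψ₃ θ₃)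

o₂≈ : sec 3 2 O ≈ κ (+ 8) ⊗ G mod + 64
o₂≈ = let (r , e) = θ⁴-cancel 8 (proj₂ (proj₂ (weave₃-injective O-weave))) in
  _ , ≈-trans e (solve 3 (λ h z r → con (+ 8) :* (h :- con (+ 8) :* z :* h) :+ con (+ 64) :* r
    := con (+ 8) :* h :+ con (+ 64) :* (r :- z :* h)) ≈-refl G z r)

-- The factor φ(-q³) ψ(q³) lies in class 0, so only φ(-q) ψ(q) is dissected. Its class 1 is φ(-q⁹)
-- ψ(q⁹) - 2 a(q³) A(q³), and `a⊗A` turns this into -φ(-q⁹) ψ(q⁹); class 2 is recognised through
-- `G-product`.
H-weave : H ≈ weave₃ (θ₃ ⊗ A ⊗ (θ ⊗ ψ)) (⊖ H) (⊖ (κ (+ 2) ⊗ G))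
H-weave = begin
  θ ⊗ ψ ⊗ (θ₃ ⊗ ψ₃)
    ≈⟨ ⊗-cong (⊗-cong θ-dissection₃ ψ-dissection₃) (≈-sym (V-⊗ 3 θ ψ)) ⟩
  (V 3 θ₃ ⊕ ⊖ (κ (+ 2) ⊗ X ⊗ V 3 a)) ⊗ (V 3 A ⊕ X ⊗ V 3 ψ₃) ⊗ h
    ≈⟨ lc (⊗-cong (≈-refl {κ (+ 2) ⊗ X ⊗ h}) (≈-sym aA₃))
        (solve 6 (λ x d a b p h → (d :- con (+ 2) :* x :* a) :* (b :+ x :* p) :* h :+ con (+ 2) :* x :* h :* (a :* b)
          := (d :* b :* h :+ x :* (:- (h :* (d :* p))) :+ x :* x :* (:- (con (+ 2) :* (a :* (h :* p))))) :+ con (+ 2) :* x :* h :* (d :* p))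
          ≈-refl X _ _ _ _ h) ⟩
  _ ≈⟨ ⊕-cong (⊕-cong (V₃ 3 (λ d b h → d :* b :* h) (≈-refl ∷ ≈-refl ∷ ≈-refl ∷ []))
         (⊗-cong ≈-refl (V₃ 3 (λ h d p → :- (h :* (d :* p))) (≈-refl ∷ ≈-refl ∷ ≈-refl ∷ []))))
         (⊗-cong ≈-refl (≈-trans (V-cong 3 (⊖-cong (⊗-cong ≈-refl G-product)))
           (V₃ 3 (λ a h p → :- (con (+ 2) :* (a :* (h :* p)))) (≈-refl ∷ ≈-refl ∷ ≈-refl ∷ [])))) ⟨
  weave₃ (θ₃ ⊗ A ⊗ (θ ⊗ ψ)) (⊖ H) (⊖ (κ (+ 2) ⊗ G)) ∎
  where
  open ≈R
  h = V 3 (θ ⊗ ψ)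
  aA₃ : V 3 a ⊗ V 3 A ≈ V 3 θ₃ ⊗ V 3 ψ₃
  aA₃ = ≈-trans (≈-sym (V-⊗ 3 a A)) (≈-trans (V-cong 3 a⊗A) (V-⊗ 3 θ₃ ψ₃))

sec31H : sec 3 1 H ≈ ⊖ H
sec31H = ≈-trans (sec-cong 3 1 H-weave) (sec-weave₃-1 _ _ _)

sec32H : sec 3 2 H ≈ ⊖ (κ (+ 2) ⊗ G)
sec32H = ≈-trans (sec-cong 3 2 H-weave) (sec-weave₃-2 _ _ _)

F-mod-2 : F ≈ V 2 A mod + 2
F-mod-2 = _ , ≈-trans (⊕-cong (⊗-cong ≈-refl (≈-trans (V-cong 3 φ-mod-2) (V₃ 1 (λ y → con (+ 1) :+ con (+ 2) :* y) (≈-refl ∷ [])))) ≈-refl)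
  (solve 3 (λ b y w → b :* (con (+ 1) :+ con (+ 2) :* y) :- con (+ 2) :* w := b :+ con (+ 2) :* (b :* y :- w)) ≈-refl (V 2 A) (V 3 y⁺) _)

-- The odd part of F(q²) a² is the cross term of a², which brings a factor 2; its cofactor is a
-- series in q² modulo 2, because F ≡ A(q²).
sec21G : sec 2 1 G ≈ ⊖ (κ (+ 2) ⊗ V 2 (A ⊗ V 2 A ⊗ a⁺)) mod + 4
sec21G = let (r , e) = F-mod-2 in _ , ≈-trans
  (≈-trans (sec-cong 2 1 split) (sec-weave₂-1 (F ⊗ (V 2 (V 2 A) ↑ 2 ⊕ X ⊗ V 2 a⁺ ↑ 2)) _))
  (≈-trans (⊖-cong (⊗-cong ≈-refl (⊗-cong e ≈-refl)))
    (≈-trans (solve 4 (λ b c d r → :- (con (+ 2) :* ((b :+ con (+ 2) :* r) :* (c :* d)))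
        := :- (con (+ 2) :* (b :* c :* d)) :+ con (+ 4) :* (:- (r :* c :* d))) ≈-refl (V 2 A) (V 2 (V 2 A)) (V 2 a⁺) r)
      (⊕-cong (⊖-cong (⊗-cong ≈-refl (≈-sym (V₂ 3 (λ b c d → b :* c :* d) (≈-refl ∷ ≈-refl ∷ ≈-refl ∷ []))))) ≈-refl)))
  where
  open ≈R
  split : G ≈ weave₂ (F ⊗ (V 2 (V 2 A) ↑ 2 ⊕ X ⊗ V 2 a⁺ ↑ 2)) (⊖ (κ (+ 2) ⊗ (F ⊗ (V 2 (V 2 A) ⊗ V 2 a⁺))))
  split = begin
    V 2 F ⊗ a ↑ 2
      ≈⟨ ⊗-cong ≈-refl (↑-congˡ 2 a-dissection₂) ⟩
    V 2 F ⊗ (V 2 (V 2 (V 2 A)) ⊕ ⊖ (X ⊗ V 2 (V 2 a⁺))) ↑ 2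
      ≈⟨ solve 4 (λ x f u s → f :* (u :- x :* s) :^ 2 := f :* (u :^ 2 :+ x :* x :* s :^ 2) :+ x :* (:- (con (+ 2) :* (f :* (u :* s))))) ≈-refl X _ _ _ ⟩
    _ ≈⟨ ⊕-cong (V₂ 4 (λ x f u s → f :* (u :^ 2 :+ x :* s :^ 2)) (X² ∷ ≈-refl ∷ ≈-refl ∷ ≈-refl ∷ []))
           (⊗-cong ≈-refl (V₂ 3 (λ f u s → :- (con (+ 2) :* (f :* (u :* s)))) (≈-refl ∷ ≈-refl ∷ ≈-refl ∷ []))) ⟨
    weave₂ (F ⊗ (V 2 (V 2 A) ↑ 2 ⊕ X ⊗ V 2 a⁺ ↑ 2)) (⊖ (κ (+ 2) ⊗ (F ⊗ (V 2 (V 2 A) ⊗ V 2 a⁺)))) ∎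

at-mod : ∀ {f g c m} (e : f ≈ κ c ⊗ g mod m) n → f n ≡ c *ℤ g n +ℤ m *ℤ proj₁ e n
at-mod {g = g} {c} {m} (r , e) n = trans (at e n) (trans (⊕-at _ _ n) (cong₂ _+ℤ_ (κ⊗-at c g n) (κ⊗-at m r n)))

V2-odd : ∀ f n → V 2 f (1 + 2 * n) ≡ + 0
V2-odd f n = V-off 2 f (1 + 2 * n) λ { (divides q e) → 1≢0 (trans (sym ([m+kn]%n≡m%n 1 n 2))
  (trans (cong (λ x → (1 + x) % 2) (ℕ.*-comm n 2)) (trans (cong (_% 2) e) ([m+kn]%n≡m%n 0 q 2)))) }
  where
  1≢0 : ¬ 1 ≡ 0
  1≢0 ()

-- The four divisibility statements

infix 4 _∣ᶻ_
-- The signed form exposes an integer quotient with an equation, so divisibilities combine by ring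
-- arithmetic; the relation on absolute values is recovered at the end.
_∣ᶻ_ : ℤ → ℤ → Set
_∣ᶻ_ = Signed._∣_

S9bar-odd : ∀ i n m → m ≡ 1 + 2 * (i + 3 * n) → S9bar m ≡ sec 3 i O n
S9bar-odd i n m refl = S9bar≡S m

S9bar-6n+3 : ∀ n → S9bar (6 * n + 3) ≡ + 4 *ℤ H n +ℤ + 32 *ℤ proj₁ o₁≈ n
S9bar-6n+3 n = trans (S9bar-odd 1 n (6 * n + 3) (index n)) (at-mod o₁≈ n)
  where
  index : ∀ n → 6 * n + 3 ≡ 1 + 2 * (1 + 3 * n)
  index = ℕ-Ring.solve-∀

S9bar-6n+5 : ∀ n → S9bar (6 * n + 5) ≡ + 8 *ℤ G n +ℤ + 64 *ℤ proj₁ o₂≈ n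
S9bar-6n+5 n = trans (S9bar-odd 2 n (6 * n + 5) (index n)) (at-mod o₂≈ n)
  where
  index : ∀ n → 6 * n + 5 ≡ 1 + 2 * (2 + 3 * n)
  index = ℕ-Ring.solve-∀

8∣S9bar[12n+7] : ∀ n → + 8 ∣ᶻ S9bar (12 * n + 7)
8∣S9bar[12n+7] n = Signed.divides (proj₁ o₀≈ m) (begin
  S9bar (12 * n + 7)                          ≡⟨ S9bar-odd 0 m (12 * n + 7) (index n) ⟩
  sec 3 0 O m                                 ≡⟨ at-mod o₀≈ m ⟩
  + 2 *ℤ V 2 F m +ℤ + 8 *ℤ proj₁ o₀≈ m        ≡⟨ cong (λ x → + 2 *ℤ x +ℤ + 8 *ℤ proj₁ o₀≈ m) (V2-odd F n) ⟩
  + 2 *ℤ + 0 +ℤ + 8 *ℤ proj₁ o₀≈ m            ≡⟨ value (proj₁ o₀≈ m) ⟩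
  proj₁ o₀≈ m *ℤ + 8 ∎)
  where
  open ≡-Reasoning
  -- 12n + 7 = 6m + 1 with `m` odd, where the coefficient of F(q²) vanishes.
  m = 1 + 2 * n
  index : ∀ n → 12 * n + 7 ≡ 1 + 2 * (3 * (1 + 2 * n))
  index = ℕ-Ring.solve-∀
  value : ∀ r → + 2 *ℤ + 0 +ℤ + 8 *ℤ r ≡ r *ℤ + 8
  value = ℤ-Ring.solve-∀

H-at-3n+1 : ∀ n → H (1 + 3 * n) ≡ - H n
H-at-3n+1 n = trans (at sec31H n) (⊖-at H n)

H-at-3n+2 : ∀ n → H (2 + 3 * n) ≡ - (+ 2 *ℤ G n)
H-at-3n+2 n = trans (at sec32H n) (trans (⊖-at _ n) (cong -_ (κ⊗-at (+ 2) G n)))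

-- Since 3 (6n + 3) = 6 (3n + 1) + 3, one tripling replaces H(n) by H(3n + 1) = -H(n); the remaining
-- triplings are the induction hypothesis at 3n + 1.
tripling-3 : ∀ α n → + 16 ∣ᶻ S9bar (6 * n + 3) - ((- (+ 1)) ^ℤ α) *ℤ S9bar (3 ^ α * (6 * n + 3))
tripling-3 zero n = Signed.divides (+ 0) (trans (cong (λ m → S9bar (6 * n + 3) - + 1 *ℤ S9bar m) (ℕ.*-identityˡ (6 * n + 3))) (value (S9bar (6 * n + 3))))
  where
  value : ∀ s → s - + 1 *ℤ s ≡ + 0 *ℤ + 16
  value = ℤ-Ring.solve-∀
tripling-3 (suc α) n = Signed.divides (+ 2 *ℤ r n +ℤ + 2 *ℤ r (1 + 3 * n) - k) (begin
  S9bar (6 * n + 3) - (- (+ 1) *ℤ ε) *ℤ S9bar (3 ^ suc α * (6 * n + 3))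
    ≡⟨ cong (λ m → S9bar (6 * n + 3) - (- (+ 1) *ℤ ε) *ℤ S9bar m) (index (3 ^ α) n) ⟩
  S9bar (6 * n + 3) - (- (+ 1) *ℤ ε) *ℤ t
    ≡⟨ regroup (S9bar (6 * n + 3)) (S9bar (6 * (1 + 3 * n) + 3)) ε t ⟩
  S9bar (6 * n + 3) +ℤ S9bar (6 * (1 + 3 * n) + 3) - (S9bar (6 * (1 + 3 * n) + 3) - ε *ℤ t)
    ≡⟨ cong₂ _-_ (cong₂ _+ℤ_ (S9bar-6n+3 n) (trans (S9bar-6n+3 (1 + 3 * n))
         (cong (λ x → + 4 *ℤ x +ℤ + 32 *ℤ r (1 + 3 * n)) (H-at-3n+1 n)))) (Signed._∣_.equality hyp) ⟩
  (+ 4 *ℤ H n +ℤ + 32 *ℤ r n) +ℤ (+ 4 *ℤ (- H n) +ℤ + 32 *ℤ r (1 + 3 * n)) - k *ℤ + 16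
    ≡⟨ value (H n) (r n) (r (1 + 3 * n)) k ⟩
  (+ 2 *ℤ r n +ℤ + 2 *ℤ r (1 + 3 * n) - k) *ℤ + 16 ∎)
  where
  open ≡-Reasoning
  r = proj₁ o₁≈
  hyp = tripling-3 α (1 + 3 * n)
  k = Signed._∣_.quotient hyp
  ε = (- (+ 1)) ^ℤ α
  t = S9bar (3 ^ α * (6 * (1 + 3 * n) + 3))
  index : ∀ p n → (3 * p) * (6 * n + 3) ≡ p * (6 * (1 + 3 * n) + 3)
  index = ℕ-Ring.solve-∀
  regroup : ∀ s u e t → s - (- (+ 1) *ℤ e) *ℤ t ≡ s +ℤ u - (u - e *ℤ t)
  regroup = ℤ-Ring.solve-∀
  value : ∀ h r r' k → (+ 4 *ℤ h +ℤ + 32 *ℤ r) +ℤ (+ 4 *ℤ (- h) +ℤ + 32 *ℤ r') - k *ℤ + 16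
                     ≡ (+ 2 *ℤ r +ℤ + 2 *ℤ r' - k) *ℤ + 16
  value = ℤ-Ring.solve-∀

sign-cases : ∀ α → (- (+ 1)) ^ℤ α ≡ + 1 ⊎ (- (+ 1)) ^ℤ α ≡ - (+ 1)
sign-cases zero = inj₁ refl
sign-cases (suc α) with (- (+ 1)) ^ℤ α | sign-cases α
... | _ | inj₁ refl = inj₂ refl
... | _ | inj₂ refl = inj₁ refl

-- Since 8 divides S9bar (6n+5), the sign produced by tripling-3 is invisible modulo 16.
tripling-5 : ∀ α n → + 16 ∣ᶻ S9bar (6 * n + 5) - S9bar (3 ^ α * (6 * n + 5))
tripling-5 zero n = Signed.divides (+ 0) (trans (cong (λ m → S9bar (6 * n + 5) - S9bar m) (ℕ.*-identityˡ (6 * n + 5))) (value (S9bar (6 * n + 5))))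
  where
  value : ∀ s → s - s ≡ + 0 *ℤ + 16
  value = ℤ-Ring.solve-∀
tripling-5 (suc α) n = cases (sign-cases α)
  where
  -- 3 (6n + 5) = 6 (3n + 2) + 3: the first tripling moves to the class of `tripling-3`, and 4 H(3n
  -- + 2) = -8 G(n) links the two.
  hyp = tripling-3 α (2 + 3 * n)
  k = Signed._∣_.quotient hyp
  e = Signed._∣_.equality hyp
  g = G n
  r = proj₁ o₂≈ n
  r' = proj₁ o₁≈ (2 + 3 * n)
  t = S9bar (3 ^ α * (6 * (2 + 3 * n) + 3))
  u = S9bar (6 * (2 + 3 * n) + 3)
  index : ∀ p n → (3 * p) * (6 * n + 5) ≡ p * (6 * (2 + 3 * n) + 3)
  index = ℕ-Ring.solve-∀
  goal≡ : S9bar (6 * n + 5) - S9bar (3 ^ suc α * (6 * n + 5)) ≡ + 8 *ℤ g +ℤ + 64 *ℤ r - t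
  goal≡ = cong₂ _-_ (S9bar-6n+5 n) (cong S9bar (index (3 ^ α) n))
  u≡ : u ≡ + 4 *ℤ (- (+ 2 *ℤ g)) +ℤ + 32 *ℤ r'
  u≡ = trans (S9bar-6n+3 (2 + 3 * n)) (cong (λ x → + 4 *ℤ x +ℤ + 32 *ℤ r') (H-at-3n+2 n))
  plus₁ : ∀ g r t u → + 8 *ℤ g +ℤ + 64 *ℤ r - t ≡ + 8 *ℤ g +ℤ + 64 *ℤ r - u +ℤ (u - + 1 *ℤ t)
  plus₁ = ℤ-Ring.solve-∀
  plus₂ : ∀ g r r' k → + 8 *ℤ g +ℤ + 64 *ℤ r - (+ 4 *ℤ (- (+ 2 *ℤ g)) +ℤ + 32 *ℤ r') +ℤ k *ℤ + 16
                     ≡ (g +ℤ + 4 *ℤ r - + 2 *ℤ r' +ℤ k) *ℤ + 16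
  plus₂ = ℤ-Ring.solve-∀
  minus₁ : ∀ g r t u → + 8 *ℤ g +ℤ + 64 *ℤ r - t ≡ + 8 *ℤ g +ℤ + 64 *ℤ r +ℤ u - (u - (- (+ 1)) *ℤ t)
  minus₁ = ℤ-Ring.solve-∀
  minus₂ : ∀ g r r' k → + 8 *ℤ g +ℤ + 64 *ℤ r +ℤ (+ 4 *ℤ (- (+ 2 *ℤ g)) +ℤ + 32 *ℤ r') - k *ℤ + 16
                      ≡ (+ 4 *ℤ r +ℤ + 2 *ℤ r' - k) *ℤ + 16
  minus₂ = ℤ-Ring.solve-∀
  cases : (- (+ 1)) ^ℤ α ≡ + 1 ⊎ (- (+ 1)) ^ℤ α ≡ - (+ 1) → + 16 ∣ᶻ S9bar (6 * n + 5) - S9bar (3 ^ suc α * (6 * n + 5))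
  cases (inj₁ ε≡) = Signed.divides (g +ℤ + 4 *ℤ r - + 2 *ℤ r' +ℤ k) (trans goal≡ (trans (plus₁ g r t u)
    (trans (cong₂ (λ x d → + 8 *ℤ g +ℤ + 64 *ℤ r - x +ℤ d) u≡ (trans (cong (λ ε → u - ε *ℤ t) (sym ε≡)) e)) (plus₂ g r r' k))))
  cases (inj₂ ε≡) = Signed.divides (+ 4 *ℤ r +ℤ + 2 *ℤ r' - k) (trans goal≡ (trans (minus₁ g r t u)
    (trans (cong₂ (λ x d → + 8 *ℤ g +ℤ + 64 *ℤ r +ℤ x - d) u≡ (trans (cong (λ ε → u - ε *ℤ t) (sym ε≡)) e)) (minus₂ g r r' k))))

32∣S9bar[24n+23] : ∀ n → + 32 ∣ᶻ S9bar (24 * n + 23)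
32∣S9bar[24n+23] n = Signed.divides (r +ℤ + 2 *ℤ s) (begin
  S9bar (24 * n + 23)                                  ≡⟨ S9bar-odd 2 m (24 * n + 23) (index n) ⟩
  sec 3 2 O m                                          ≡⟨ at-mod o₂≈ m ⟩
  + 8 *ℤ G m +ℤ + 64 *ℤ s                              ≡⟨ cong (λ x → + 8 *ℤ x +ℤ + 64 *ℤ s) G-value ⟩
  + 8 *ℤ (- (+ 2 *ℤ + 0) +ℤ + 4 *ℤ r) +ℤ + 64 *ℤ s     ≡⟨ value r s ⟩
  (r +ℤ + 2 *ℤ s) *ℤ + 32 ∎)
  where
  open ≡-Reasoning
  -- 24n + 23 = 6m + 5 with m = 4n + 3. The outer 1 + 2 · selects the odd part of `G`; the inner
  -- index is odd, where the series in q² from `sec21G` vanishes.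
  m = 1 + 2 * (1 + 2 * n)
  r = proj₁ sec21G (1 + 2 * n)
  s = proj₁ o₂≈ m
  index : ∀ n → 24 * n + 23 ≡ 1 + 2 * (2 + 3 * (1 + 2 * (1 + 2 * n)))
  index = ℕ-Ring.solve-∀
  value : ∀ r s → + 8 *ℤ (- (+ 2 *ℤ + 0) +ℤ + 4 *ℤ r) +ℤ + 64 *ℤ s ≡ (r +ℤ + 2 *ℤ s) *ℤ + 32
  value = ℤ-Ring.solve-∀
  G-value : G m ≡ - (+ 2 *ℤ + 0) +ℤ + 4 *ℤ r
  G-value = begin
    G m                                                ≡⟨ at (proj₂ sec21G) (1 + 2 * n) ⟩
    _                                                  ≡⟨ ⊕-at _ _ (1 + 2 * n) ⟩
    _                                                  ≡⟨ cong₂ _+ℤ_ (trans (⊖-at _ (1 + 2 * n)) (cong -_ (trans (κ⊗-at (+ 2) _ (1 + 2 * n))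
                                                            (cong (+ 2 *ℤ_) (V2-odd (A ⊗ V 2 A ⊗ a⁺) n))))) (κ⊗-at (+ 4) _ (1 + 2 * n)) ⟩
    - (+ 2 *ℤ + 0) +ℤ + 4 *ℤ r ∎

theorem3p3 : (n α : ℕ) →
    ((+ 8) ∣ S9bar (12 * n + 7))
    × ((+ 16) ∣ (S9bar (6 * n + 3) - ((- (+ 1)) ^ℤ α) *ℤ S9bar (3 ^ α * (6 * n + 3))))
    × ((+ 16) ∣ (S9bar (6 * n + 5) - S9bar (3 ^ α * (6 * n + 5))))
    × ((+ 32) ∣ S9bar (24 * n + 23))
theorem3p3 n α =
    Signed.∣⇒∣ᵤ (8∣S9bar[12n+7] n)
  , Signed.∣⇒∣ᵤ (tripling-3 α n)
  , Signed.∣⇒∣ᵤ (tripling-5 α n)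
  , Signed.∣⇒∣ᵤ (32∣S9bar[24n+23] n)
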